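{- Let $n\ge 2$ and $\pi,\tau\in S_n$. Then $\pi\sim\tau$ if and only if $\tau$ can be obtained from $\pi$ by a finite sequence of operations, each of which is either a flip of a bordered cylindrical block or the reverse-complement operation.
   Context: For $x=(x_1,\dots,x_{n-1})\in\mathbb{R}^{n-1}$ put $Z_0=0$ and $Z_i=x_1+\dots+x_i$. If $Z_0,\dots,Z_{n-1}$ are pairwise distinct, let $p(x)\in S_n$ be the permutation with the same relative order as $(Z_0,Z_1,\dots,Z_{n-1})$, i.e. $p(x)(i)=|\{k\in\{0,\dots,n-1\}: Z_k\le Z_{i-1}\}|$ for $1\le i\le n$; otherwise $p(x)$ is undefined (and the statement "$p(x)=\pi$" is false). For $\pi,\tau\in S_n$ write $\pi\sim\tau$ if there exists $\rho\in S_{n-1}$ such that for every $x\in\mathbb{R}^{n-1}$: $p(x_1,\dots,x_{n-1})=\pi$ if and only if $p(x_{\rho(1)},\dots,x_{\rho(n-1)})=\tau$. The reverse-complement of $\pi\in S_n$ is $\pi^{RC}(i)=n+1-\pi(n+1-i)$. Positions $1,\dots,n$ are regarded cyclically ($n$ and $1$ adjacent). A cylindrical block of $\pi$ is a nonempty set of positions forming a cyclically consecutive set whose values form a set of consecutive integers $\{c,c+1,\dots,d\}$. It is either an ordinary block (positions $i,i+1,\dots,j$ with $1\le i\le j\le n$) or a wrapping block (positions $b,b+1,\dots,n,1,2,\dots,a$ with $1\le a<b-1<n$, hence $a\ge1$, $b\le n$). Read its entries in cyclic order: $w=(\pi(i),\dots,\pi(j))$ in the ordinary case and $w=(\pi(b),\dots,\pi(n),\pi(1),\dots,\pi(a))=(w_1,\dots,w_m)$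 in the wrapping case. The block is bordered if $\{w_1,w_m\}=\{c,d\}$, i.e. its smallest and largest values occur at its two outer positions. Let $w'$ be the reverse-complement of $w$ inside the block: $w'_k=c+d-w_{m+1-k}$. The flip of an ordinary bordered block replaces $(\pi(i),\dots,\pi(j))$ by $w'$, leaving other entries unchanged. The flip of a wrapping bordered block (with $a$ entries at the left end) produces the permutation $(w'_{a+1},\dots,w'_m,\pi(a+1),\dots,\pi(b-1),w'_1,\dots,w'_a)$; e.g. flipping the block of values $\{2,\dots,7\}$ in $5712634$ gives $5637124$.
   Formalization: In the definition of π∼τ, the step vectors x range over rational vectors in ℚ^{n-1} instead of real vectors in ℝ^{n-1}; since the pattern sets are open convex cones, the two relations agree by density. -}

module Defs where

open import Data.Nat using (ℕ; zero; suc; _+_; _∸_; _≤_)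
open import Data.Fin using (Fin; zero; suc; toℕ)
open import Data.Fin.Permutation using (Permutation′; _⟨$⟩ʳ_)
open import Data.Rational using (ℚ; 0ℚ) renaming (_+_ to _+ℚ_; _≤?_ to _≤ℚ?_)
open import Data.Vec using (Vec; []; _∷_; lookup; tabulate; toList)
open import Data.List using (List; []; _∷_; _++_; length; filter; reverse; map; head; last; take; drop; allFin)
open import Data.List.Membership.Propositional using (_∈_)
open import Data.Maybe using (just)
open import Data.Product using (_×_; ∃)
open import Data.Sum using (_⊎_)
open import Relation.Binary.PropositionalEquality using (_≡_; _≢_)
open import Function.Bundles using (_⇔_)

word : {n : ℕ} → Permutation′ n → List ℕ
word {n} π = toList (tabulate (λ i → suc (toℕ (π ⟨$⟩ʳ i))))

Z : {m : ℕ} → Vec ℚ m → Fin (suc m) → ℚ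
Z xs       zero    = 0ℚ
Z (x ∷ xs) (suc i) = x +ℚ Z xs i

-- "p(x) = π"  (false when some Z_k coincide).
-- Position i (1-based) corresponds to the Fin index i-1, and
-- π(i) = |{k : Z_k ≤ Z_{i-1}}|.
PatternIs : {m : ℕ} → Vec ℚ m → Permutation′ (suc m) → Set
PatternIs {m} x π =
  (∀ (i j : Fin (suc m)) → i ≢ j → Z x i ≢ Z x j) ×
  (∀ (i : Fin (suc m)) →
     suc (toℕ (π ⟨$⟩ʳ i)) ≡ length (filter (λ k → Z x k ≤ℚ? Z x i) (allFin (suc m))))

permuteVec : {m : ℕ} → Permutation′ m → Vec ℚ m → Vec ℚ m
permuteVec ρ x = tabulate (λ i → lookup x (ρ ⟨$⟩ʳ i))

Sim : {m : ℕ} → Permutation′ (suc m) → Permutation′ (suc m) → Set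
Sim {m} π τ = ∃ λ (ρ : Permutation′ m) →
  ∀ (x : Vec ℚ m) → PatternIs x π ⇔ PatternIs (permuteVec ρ x) τ

RC : List ℕ → List ℕ
RC w = reverse (map (λ v → suc (length w) ∸ v) w)

-- reverse-complement inside a block with value range {c,...,d}
flipW : ℕ → ℕ → List ℕ → List ℕ
flipW c d w = reverse (map (λ v → (c + d) ∸ v) w)

ValuesRange : List ℕ → ℕ → ℕ → Set
ValuesRange w c d = ∀ v → (v ∈ w) ⇔ (c ≤ v × v ≤ d)

Bordered : List ℕ → ℕ → ℕ → Set
Bordered w c d = (head w ≡ just c × last w ≡ just d) ⊎ (head w ≡ just d × last w ≡ just c)

-- One operation: reverse-complement, flip of an ordinary bordered block
-- (positions i..j), or flip of a wrapping bordered block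
-- (positions b..n,1..a with a ≥ 1, b ≤ n, b-1-a ≥ 1).
data Move : List ℕ → List ℕ → Set where
  rc      : ∀ π → Move π (RC π)
  ordFlip : ∀ (L w R : List ℕ) (c d : ℕ) →
            ValuesRange w c d → Bordered w c d →
            Move (L ++ w ++ R) (L ++ flipW c d w ++ R)
  wrapFlip : ∀ (A M B : List ℕ) (c d : ℕ) →
            A ≢ [] → M ≢ [] → B ≢ [] →
            ValuesRange (B ++ A) c d → Bordered (B ++ A) c d →
            Move (A ++ M ++ B)
                 (drop (length A) (flipW c d (B ++ A)) ++ M ++
                  take (length A) (flipW c d (B ++ A)))

{-# OPTIONS --safe #-}
module Submission where

-- Label the steps of the walk (Z_0, …, Z_{n-1}) and follow the pairs (arrangement of the labels, word).
-- A flip of a bordered block reflects the corresponding part of the walk in its strip of heights: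
-- this reverses a segment of the arrangement (for a wrapping block, the two outer segments), and
-- no point outside the block is disturbed. Reverse-complement reverses the whole arrangement.
-- Hence moves preserve ∼.
--
-- Conversely, the step vectors with a given pattern form the interior of a simplicial cone, whose
-- facet functionals are the differences of heights of consecutive values; each is, up to sign, the
-- indicator of the labels between the positions of two consecutive values. If a word with some
-- arrangement has the same cone as a word with arrangement 0, 1, …, m - 1, then their facets
-- coincide, and so do the sums of their facet functionals, so for any two cyclically adjacent
-- values the labels between them form an interval of ℕ. Suppose the arrangement is
-- 0, …, k - 1, l, …, q, … with l > k and q the last label below l. The interval property forbids
-- cyclically adjacent values inside and outside the segment from l to q, so the values inside
-- are one of the two arcs cut out by the values at its ends, and a flip, possibly followed by
-- reverse-complement (or reverse-complement alone), reverses the segment. Repeating this sorts the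
-- arrangement, and the cone with the sorted arrangement determines the word.

open import Defs
open import Data.Empty using (⊥)
open import Data.Fin using (Fin; zero; suc; toℕ; fromℕ<; cast)
open import Data.Fin.Permutation using (Permutation; Permutation′; _⟨$⟩ʳ_; _⟨$⟩ˡ_)
import Data.Fin.Permutation as Perm
import Data.Fin.Properties as Fin
open import Data.Integer using (ℤ; +_; -[1+_]; 0ℤ; 1ℤ; +≤+)
import Data.Integer as ℤ
import Data.Integer.Properties as ℤ
import Data.Integer.Tactic.RingSolver as ℤ-Ring
import Algebra.Properties.AbelianGroup ℤ.+-0-abelianGroup as ℤ-Group
open import Data.List using (List; InitLast; initLast; _∷ʳ′_; []; _∷_; _++_; _∷ʳ_; [_]; length; map; reverse; filter; foldl; head; last; take; drop; upTo; applyUpTo; allFin; tabulate; lookup)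
import Data.List.Properties as List
open import Data.List.Membership.Propositional using (_∈_; _∉_)
import Data.List.Membership.Propositional.Properties as Mem
open import Data.List.Relation.Binary.Permutation.Propositional using (_↭_; ↭-refl; ↭-sym; ↭-trans; ↭-reflexive)
import Data.List.Relation.Binary.Permutation.Propositional as ↭
import Data.List.Relation.Binary.Permutation.Propositional.Properties as ↭
open import Data.List.Relation.Unary.All using (All; []; _∷_)
import Data.List.Relation.Unary.All as All
import Data.List.Relation.Unary.All.Properties as All
open import Data.List.Relation.Unary.AllPairs using ([]; _∷_)
open import Data.List.Relation.Unary.Any using (here; there)
import Data.List.Relation.Unary.Any.Properties as Any
open import Data.List.Relation.Unary.Unique.Propositional using (Unique)
import Data.List.Relation.Unary.Unique.Propositional.Properties as Unique
open import Data.Maybe using (just)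
open import Data.Nat using (ℕ; zero; suc; _+_; _*_; _∸_; _≤_; _<_; _≟_; _≤?_; _<?_; z≤n; s≤s; s≤s⁻¹)
import Data.Nat.Properties as ℕ
open import Data.Nat.Induction using (<-wellFounded)
open import Data.Product using (∃; ∃₂; _×_; _,_; proj₁; proj₂)
open import Data.Rational using (ℚ; 0ℚ) renaming (_+_ to _+ℚ_; _-_ to _-ℚ_; _≤_ to _≤ℚ_; _<_ to _<ℚ_; _≤?_ to _≤ℚ?_)
import Data.Rational as ℚ
import Data.Rational.Properties as ℚ
import Data.Rational.Unnormalised as ℚᵘ
import Data.Rational.Unnormalised.Properties as ℚᵘₚ
open import Data.Rational.Solver using (module +-*-Solver)
open import Data.Sum using (_⊎_; inj₁; inj₂; [_,_]′)
import Data.Sum as Sum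
open import Data.Vec using (Vec)
import Data.Vec as Vec
import Data.Vec.Properties as Vec
open import Function using (_∘_; id; case_of_; _⇔_; mk⇔; Equivalence)
open import Function.Construct.Composition using (_⇔-∘_)
open import Function.Construct.Symmetry using (⇔-sym)
open import Induction.WellFounded using (Acc; acc)
open import Relation.Binary.Construct.Closure.ReflexiveTransitive using (Star; ε; _◅_; _◅◅_)
open import Relation.Binary.Definitions using (tri<; tri≈; tri>)
open import Relation.Binary.PropositionalEquality using (_≡_; _≢_; refl; sym; trans; cong; cong₂; subst; subst₂; module ≡-Reasoning)
open import Relation.Nullary using (¬_; Dec; yes; no; contradiction)
open import Data.List.Membership.Propositional.Properties.WithK using (unique∧set⇒bag)
open import Data.List.Relation.Binary.BagAndSetEquality using (∼bag⇒↭)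
import Data.List.Relation.Binary.Permutation.Setoid.Properties as ↭ₛ
open import Relation.Binary.PropositionalEquality.Properties using (setoid)
import Data.List.Relation.Binary.Permutation.Homogeneous as ↭-Homogeneous

-- Walks and their reflections

-- The cone is studied through integer vectors. Steps with prescribed integer gaps are differences
-- of integer heights, so the gaps are unimodular coordinates, and the cone determines the sum of
-- its facet functionals exactly and not merely each facet up to a factor. That sum telescopes to
-- the height of the largest value minus that of the smallest; it makes 1 and `m + 1` adjacent,
-- which is where wrapping blocks come from. The single facets enter only through their supports.
--
-- The choice of `q` makes the interval property bite at both ends of the segment: labels before it
-- are below `q`, labels after it are above `l`, and `q < l`. For adjacent values inside and
-- outside, the labels between them would include some `e < q` and `l` but not `q`, or `q` and some
-- `e > l` but not `l`.

walk : ℚ → List ℚ → List ℚ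
walk z []       = z ∷ []
walk z (d ∷ ds) = z ∷ walk (z +ℚ d) ds

end : ℚ → List ℚ → ℚ
end = foldl _+ℚ_

starts : ℚ → List ℚ → List ℚ
starts z []       = []
starts z (d ∷ ds) = z ∷ starts (z +ℚ d) ds

ends : ℚ → List ℚ → List ℚ
ends z []       = []
ends z (d ∷ ds) = walk (z +ℚ d) ds

-- Two consecutive pieces of a walk share a point. Here the joint goes to the right piece, in
-- `walk-++ʳ` to the left one; cutting out a block uses the first at its left end and the second at
-- its right end, so that it owns both its end points.
walk-++ˡ : ∀ z as bs → walk z (as ++ bs) ≡ starts z as ++ walk (end z as) bs
walk-++ˡ z []       bs = refl
walk-++ˡ z (a ∷ as) bs = cong (z ∷_) (walk-++ˡ (z +ℚ a) as bs)

walk-++ʳ : ∀ z as bs → walk z (as ++ bs) ≡ walk z as ++ ends (end z as) bs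
walk-++ʳ z []       []       = refl
walk-++ʳ z []       (b ∷ bs) = refl
walk-++ʳ z (a ∷ as) bs       = cong (z ∷_) (walk-++ʳ (z +ℚ a) as bs)

walk-++-∷ : ∀ z as b bs → walk z (as ++ b ∷ bs) ≡ walk z as ++ walk (end z as +ℚ b) bs
walk-++-∷ z as b bs = walk-++ʳ z as (b ∷ bs)

length-walk : ∀ z ds → length (walk z ds) ≡ suc (length ds)
length-walk z []       = refl
length-walk z (d ∷ ds) = cong suc (length-walk (z +ℚ d) ds)

length-starts : ∀ z ds → length (starts z ds) ≡ length ds
length-starts z []       = refl
length-starts z (d ∷ ds) = cong suc (length-starts (z +ℚ d) ds)

minus-plus : ∀ a b c → a -ℚ (b +ℚ c) +ℚ c ≡ a -ℚ b
minus-plus = solve 3 (λ a b c → a :- (b :+ c) :+ c := a :- b) refl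
  where open +-*-Solver

plus-minus : ∀ a b → (a +ℚ b) -ℚ b ≡ a
plus-minus = solve 2 (λ a b → (a :+ b) :- b := a) refl
  where open +-*-Solver

end-reverse : ∀ s z ds → end (s -ℚ end z ds) (reverse ds) ≡ s -ℚ z
end-reverse s z []       = refl
end-reverse s z (d ∷ ds) = begin
  end w (reverse (d ∷ ds))  ≡⟨ cong (end w) (List.unfold-reverse d ds) ⟩
  end w (reverse ds ∷ʳ d)   ≡⟨ List.foldl-∷ʳ _+ℚ_ w d (reverse ds) ⟩
  end w (reverse ds) +ℚ d   ≡⟨ cong (_+ℚ d) (end-reverse s (z +ℚ d) ds) ⟩
  s -ℚ (z +ℚ d) +ℚ d        ≡⟨ minus-plus s z d ⟩
  s -ℚ z                    ∎
  where
  open ≡-Reasoning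
  w = s -ℚ end (z +ℚ d) ds

-- Reflecting the heights negates every step and reading backwards negates it again, so the steps
-- reappear unchanged in reverse order. This is why flips permute the steps.
walk-reverse : ∀ s z ds → reverse (map (s -ℚ_) (walk z ds)) ≡ walk (s -ℚ end z ds) (reverse ds)
walk-reverse s z []       = refl
walk-reverse s z (d ∷ ds) = begin
  reverse (s -ℚ z ∷ map (s -ℚ_) (walk (z +ℚ d) ds))
    ≡⟨ List.unfold-reverse (s -ℚ z) (map (s -ℚ_) (walk (z +ℚ d) ds)) ⟩
  reverse (map (s -ℚ_) (walk (z +ℚ d) ds)) ∷ʳ (s -ℚ z)
    ≡⟨ cong (_∷ʳ (s -ℚ z)) (walk-reverse s (z +ℚ d) ds) ⟩
  walk w (reverse ds) ∷ʳ (s -ℚ z)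
    ≡⟨ cong (walk w (reverse ds) ∷ʳ_) (sym (minus-plus s z d)) ⟩
  walk w (reverse ds) ∷ʳ (s -ℚ (z +ℚ d) +ℚ d)
    ≡⟨ cong (λ t → walk w (reverse ds) ∷ʳ (t +ℚ d)) (sym (end-reverse s (z +ℚ d) ds)) ⟩
  walk w (reverse ds) ∷ʳ (end w (reverse ds) +ℚ d)
    ≡⟨ sym (walk-++-∷ w (reverse ds) d []) ⟩
  walk w (reverse ds ∷ʳ d)
    ≡⟨ cong (walk w) (sym (List.unfold-reverse d ds)) ⟩
  walk w (reverse (d ∷ ds)) ∎
  where
  open ≡-Reasoning
  w = s -ℚ end (z +ℚ d) ds

Point : Set
Point = ℚ × ℕ

infix 4 _≼_
-- `weak` covers equal values, so that comparing a point of a block with its extreme points needs no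
-- separate case for the extreme points themselves.
record _≼_ (p q : Point) : Set where
  constructor _,_
  field
    weak   : proj₂ p ≤ proj₂ q → proj₁ p ≤ℚ proj₁ q
    strict : proj₂ p < proj₂ q → proj₁ p <ℚ proj₁ q

Monotone : List Point → Set
Monotone ps = ∀ {p q} → p ∈ ps → q ∈ ps → p ≼ q

below : ∀ {p q : Point} → proj₁ p <ℚ proj₁ q → p ≼ q
below z<z′ = (λ _ → ℚ.<⇒≤ z<z′) , (λ _ → z<z′)

above : ∀ {p q : Point} → proj₂ q < proj₂ p → p ≼ q
above v>v′ = (λ v≤v′ → contradiction v≤v′ (ℕ.<⇒≱ v>v′))
           , (λ v<v′ → contradiction v<v′ (ℕ.<-asym v>v′))

-- The base height `z` is free because wrapping flips and reverse-complement move the starting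
-- point; only differences of heights matter.
Ordered : List ℚ → List ℕ → Set
Ordered ds u = ∃₂ λ z ps → map proj₁ ps ≡ walk z ds × map proj₂ ps ≡ u × Monotone ps

reflect : ℚ → ℕ → Point → Point
reflect s t (z , v) = s -ℚ z , t ∸ v

minus-antimono-≤ : ∀ s {z z′} → z ≤ℚ z′ → s -ℚ z′ ≤ℚ s -ℚ z
minus-antimono-≤ s z≤z′ = ℚ.+-monoʳ-≤ s (ℚ.neg-antimono-≤ z≤z′)

minus-antimono-< : ∀ s {z z′} → z <ℚ z′ → s -ℚ z′ <ℚ s -ℚ z
minus-antimono-< s z<z′ = ℚ.+-monoʳ-< s (ℚ.neg-antimono-< z<z′)

∸-cancel-≤ : ∀ {t a b} → a ≤ t → t ∸ a ≤ t ∸ b → b ≤ t → b ≤ a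
∸-cancel-≤ a≤t le b≤t = subst₂ _≤_ (ℕ.m∸[m∸n]≡n b≤t) (ℕ.m∸[m∸n]≡n a≤t) (ℕ.∸-monoʳ-≤ _ le)

reflect-≼ : ∀ s {t} {p q} → proj₂ p ≤ t → proj₂ q ≤ t → q ≼ p → reflect s t p ≼ reflect s t q
reflect-≼ s p≤ q≤ (weak , strict)
  = (λ le → minus-antimono-≤ s (weak (∸-cancel-≤ p≤ le q≤)))
  , (λ lt → minus-antimono-< s (strict (ℕ.≰⇒> λ p≤q → ℕ.<⇒≱ lt (ℕ.∸-monoʳ-≤ _ p≤q))))

Outside : ℕ → ℕ → ℕ → Set
Outside c d v = v < c ⊎ d < v

Inside : ℕ → ℕ → ℕ → Set
Inside c d v = c ≤ v × v ≤ d

-- The reflected block stays within the strip between the heights of its extreme values,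
-- which no outside point enters.
module Block {ps : List Point} (mono : Monotone ps) {zc zd : ℚ} {c d : ℕ}
             (pc : (zc , c) ∈ ps) (pd : (zd , d) ∈ ps) where

  -- The reflection exchanging the heights `zc` and `zd`, just as `c + d ∸ v` exchanges the values
  -- `c` and `d`.
  s : ℚ
  s = zc +ℚ zd

  φ : Point → Point
  φ = reflect s (c + d)

  Kept : Point → Set
  Kept p = p ∈ ps × Outside c d (proj₂ p)

  Moved : Point → Set
  Moved p = ∃ λ q → q ∈ ps × Inside c d (proj₂ q) × p ≡ φ q

  private
    ≤c+d : ∀ {v} → Inside c d v → v ≤ c + d
    ≤c+d (_ , v≤d) = ℕ.≤-trans v≤d (ℕ.m≤n+m d c)

    φ-inside : ∀ {v} → Inside c d v → Inside c d (c + d ∸ v)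
    φ-inside {v} (c≤v , v≤d)
      = subst (_≤ c + d ∸ v) (ℕ.m+n∸n≡m c d) (ℕ.∸-monoʳ-≤ (c + d) v≤d)
      , subst (c + d ∸ v ≤_) (ℕ.m+n∸m≡n c d) (ℕ.∸-monoʳ-≤ (c + d) c≤v)

    zc≤φ : ∀ {q} → q ∈ ps → Inside c d (proj₂ q) → zc ≤ℚ proj₁ (φ q)
    zc≤φ {q} q∈ (_ , q≤d) = subst (_≤ℚ s -ℚ proj₁ q) (plus-minus zc zd)
      (minus-antimono-≤ s (_≼_.weak (mono q∈ pd) q≤d))

    φ≤zd : ∀ {q} → q ∈ ps → Inside c d (proj₂ q) → proj₁ (φ q) ≤ℚ zd
    φ≤zd {q} q∈ (c≤q , _) =
      subst (s -ℚ proj₁ q ≤ℚ_) (trans (cong (_-ℚ zc) (ℚ.+-comm zc zd)) (plus-minus zd zc))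
      (minus-antimono-≤ s (_≼_.weak (mono pc q∈) c≤q))

    kept-moved : ∀ {p q} → Kept p → Moved q → (p ≼ q) × (q ≼ p)
    kept-moved (p∈ , inj₁ p<c) (q , q∈ , q-in , refl)
      = below (ℚ.<-≤-trans (_≼_.strict (mono p∈ pc) p<c) (zc≤φ q∈ q-in))
      , above (ℕ.<-≤-trans p<c (proj₁ (φ-inside q-in)))
    kept-moved (p∈ , inj₂ d<p) (q , q∈ , q-in , refl)
      = above (ℕ.≤-<-trans (proj₂ (φ-inside q-in)) d<p)
      , below (ℚ.≤-<-trans (φ≤zd q∈ q-in) (_≼_.strict (mono pd p∈) d<p))

  monotone : ∀ {ps′} → (∀ {p} → p ∈ ps′ → Kept p ⊎ Moved p) → Monotone ps′
  monotone cover p∈ q∈ with cover p∈ | cover q∈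
  ... | inj₁ (p∈ps , _) | inj₁ (q∈ps , _) = mono p∈ps q∈ps
  ... | inj₁ p-kept     | inj₂ q-moved    = proj₁ (kept-moved p-kept q-moved)
  ... | inj₂ p-moved    | inj₁ q-kept     = proj₂ (kept-moved q-kept p-moved)
  ... | inj₂ (p , p∈ps , p-in , refl) | inj₂ (q , q∈ps , q-in , refl)
    = reflect-≼ s (≤c+d p-in) (≤c+d q-in) (mono q∈ps p∈ps)

map-++⁻ : ∀ {A B : Set} (f : A → B) {as bs} xs → map f xs ≡ as ++ bs →
          ∃₂ λ ys zs → xs ≡ ys ++ zs × map f ys ≡ as × map f zs ≡ bs
map-++⁻ f {[]}     xs       eq = [] , xs , refl , refl , eq
map-++⁻ f {a ∷ as} (x ∷ xs) eq with map-++⁻ f xs (List.∷-injectiveʳ eq)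
... | ys , zs , refl , ys≡ , zs≡ = x ∷ ys , zs , refl , cong₂ _∷_ (List.∷-injectiveˡ eq) ys≡ , zs≡

++-injective : ∀ {A : Set} (as : List A) {bs cs ds} → length as ≡ length cs →
               as ++ bs ≡ cs ++ ds → as ≡ cs × bs ≡ ds
++-injective []       {cs = []}     _   eq = refl , eq
++-injective (a ∷ as) {cs = c ∷ cs} len eq
  with ++-injective as (ℕ.suc-injective len) (List.∷-injectiveʳ eq)
... | as≡cs , bs≡ds = cong₂ _∷_ (List.∷-injectiveˡ eq) as≡cs , bs≡ds

head-point : ∀ {z ds v} (Q : List Point) → map proj₁ Q ≡ walk z ds → head (map proj₂ Q) ≡ just v → (z , v) ∈ Q
head-point {ds = []}    ((_ , v) ∷ _) eq refl = here (cong (_, v) (sym (List.∷-injectiveˡ eq)))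
head-point {ds = _ ∷ _} ((_ , v) ∷ _) eq refl = here (cong (_, v) (sym (List.∷-injectiveˡ eq)))

last-point : ∀ {z ds v} (Q : List Point) → map proj₁ Q ≡ walk z ds → last (map proj₂ Q) ≡ just v → (end z ds , v) ∈ Q
last-point {ds = []}         ((_ , v) ∷ [])     eq refl = here (cong (_, v) (sym (List.∷-injectiveˡ eq)))
last-point {ds = d ∷ []}     (_ ∷ [])     ()
last-point {ds = d ∷ _ ∷ _}  (_ ∷ [])     ()
last-point {ds = d ∷ ds}     (_ ∷ q ∷ Q)  eq last≡ = there (last-point {ds = ds} (q ∷ Q) (List.∷-injectiveʳ eq) last≡)

-- Borderedness enters here: in either orientation the heights at the two outer positions are those
-- of the extreme values, so the reflection of the strip exchanges the ends of the block. Read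
-- backwards, the reflected block fits onto the unmoved part of the walk.
extremes : ∀ {w c d} {z₁ z₂ : ℚ} {ps : List Point} →
           (∀ {v} → head w ≡ just v → (z₁ , v) ∈ ps) →
           (∀ {v} → last w ≡ just v → (z₂ , v) ∈ ps) →
           Bordered w c d →
           ∃₂ λ zc zd → (zc , c) ∈ ps × (zd , d) ∈ ps × zc +ℚ zd ≡ z₁ +ℚ z₂
extremes hd lst (inj₁ (h , l)) = _ , _ , hd h , lst l , refl
extremes {z₁ = z₁} {z₂} hd lst (inj₂ (h , l)) = _ , _ , lst l , hd h , ℚ.+-comm z₂ z₁

map-reverse-map : ∀ {A B : Set} (f : A → B) {g : A → A} {h : B → B} → (∀ x → f (g x) ≡ h (f x)) →
                  ∀ xs → map f (reverse (map g xs)) ≡ reverse (map h (map f xs))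
map-reverse-map f {g} {h} comm xs = begin
  map f (reverse (map g xs))  ≡⟨ List.reverse-map f (map g xs) ⟩
  reverse (map f (map g xs))  ≡⟨ cong reverse (sym (List.map-∘ xs)) ⟩
  reverse (map (f ∘ g) xs)    ≡⟨ cong reverse (List.map-cong comm xs) ⟩
  reverse (map (h ∘ f) xs)    ≡⟨ cong reverse (List.map-∘ xs) ⟩
  reverse (map h (map f xs))  ∎
  where open ≡-Reasoning

map-++₃ : ∀ {A B : Set} (f : A → B) xs ys zs → map f (xs ++ ys ++ zs) ≡ map f xs ++ map f ys ++ map f zs
map-++₃ f xs ys zs = trans (List.map-++ f xs (ys ++ zs)) (cong (map f xs ++_) (List.map-++ f ys zs))

cong₃-++ : ∀ {A : Set} {a a′ b b′ c c′ : List A} → a ≡ a′ → b ≡ b′ → c ≡ c′ →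
           a ++ b ++ c ≡ a′ ++ b′ ++ c′
cong₃-++ refl refl refl = refl

∈-++₃⁻ : ∀ {A : Set} {x : A} xs ys {zs} → x ∈ xs ++ ys ++ zs → x ∈ xs ⊎ x ∈ ys ⊎ x ∈ zs
∈-++₃⁻ xs ys = Sum.map₂ (Mem.∈-++⁻ ys) ∘ Mem.∈-++⁻ xs

∈-reverse-map⁻ : ∀ {A B : Set} {f : A → B} {y} xs → y ∈ reverse (map f xs) → ∃ λ x → x ∈ xs × y ≡ f x
∈-reverse-map⁻ xs y∈ = Mem.∈-map⁻ _ (Any.reverse⁻ y∈)

∈-proj₂ : ∀ {p : Point} {ps vs} → map proj₂ ps ≡ vs → p ∈ ps → proj₂ p ∈ vs
∈-proj₂ refl = Mem.∈-map⁺ proj₂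

rc-ordered : ∀ {ds u} → (∀ {v} → v ∈ u → v ≤ suc (length u)) → Ordered ds u → Ordered (reverse ds) (RC u)
rc-ordered {ds} {u} bound (z , ps , walk≡ , u≡ , mono)
  = s -ℚ end z ds , ps′ , walk≡′ , trans (map-reverse-map proj₂ (λ _ → refl) ps) (cong RC′ u≡) , mono′
  where
  -- Any centre of reflection would do, since the base height is free.
  s = 0ℚ
  t = suc (length u)
  ps′ = reverse (map (reflect s t) ps)
  RC′ = λ w → reverse (map (λ v → suc (length u) ∸ v) w)
  walk≡′ = trans (map-reverse-map proj₁ (λ _ → refl) ps)
           (trans (cong (reverse ∘ map (s -ℚ_)) walk≡) (walk-reverse s z ds))
  mono′ : Monotone ps′
  mono′ p∈ q∈ with ∈-reverse-map⁻ ps p∈ | ∈-reverse-map⁻ ps q∈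
  ... | p , p∈ps , refl | q , q∈ps , refl
    = reflect-≼ s (bound (∈-proj₂ u≡ p∈ps)) (bound (∈-proj₂ u≡ q∈ps)) (mono q∈ps p∈ps)

-- A block of `k + 1` values has `k` inner steps, and only these are reversed. The step entering it,
-- if any, is the last of `D₁`; the step leaving it, if any, is the first of `D₃`.
ordFlip-ordered : ∀ {L w R c d} D₁ {D₂ D₃} → length D₁ ≡ length L → suc (length D₂) ≡ length w →
  ValuesRange w c d → Bordered w c d → All (Outside c d) L → All (Outside c d) R →
  Ordered (D₁ ++ D₂ ++ D₃) (L ++ w ++ R) → Ordered (D₁ ++ reverse D₂ ++ D₃) (L ++ flipW c d w ++ R)
ordFlip-ordered {L} {w} {R} {c} {d} D₁ {D₂} {D₃} len₁ len₂ range bordered L-out R-out (z , ps , walk≡ , u≡ , mono)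
  with map-++⁻ proj₂ {L} ps u≡
... | P₁ , _ , refl , refl , u≡′ with map-++⁻ proj₂ {w} _ u≡′
... | Q , P₃ , refl , refl , refl = z , P₁ ++ reverse (map φ Q) ++ P₃ , walk′ , word′ , monotone cover
  where
  z₁ = end z D₁
  z₂ = end z₁ D₂

  split₁ : map proj₁ P₁ ≡ starts z D₁ × map proj₁ (Q ++ P₃) ≡ walk z₁ (D₂ ++ D₃)
  split₁ = ++-injective (map proj₁ P₁)
    (trans (List.length-map proj₁ P₁) (trans (sym (List.length-map proj₂ P₁)) (trans (sym len₁) (sym (length-starts z D₁)))))
    (trans (sym (List.map-++ proj₁ P₁ (Q ++ P₃))) (trans walk≡ (walk-++ˡ z D₁ (D₂ ++ D₃))))

  split₂ : map proj₁ Q ≡ walk z₁ D₂ × map proj₁ P₃ ≡ ends z₂ D₃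
  split₂ = ++-injective (map proj₁ Q)
    (trans (List.length-map proj₁ Q) (trans (sym (List.length-map proj₂ Q)) (trans (sym len₂) (sym (length-walk z₁ D₂)))))
    (trans (sym (List.map-++ proj₁ Q P₃)) (trans (proj₂ split₁) (walk-++ʳ z₁ D₂ D₃)))

  Q⊆ : ∀ {p} → p ∈ Q → p ∈ P₁ ++ Q ++ P₃
  Q⊆ = Mem.∈-++⁺ʳ P₁ ∘ Mem.∈-++⁺ˡ

  ext = extremes {map proj₂ Q} {c} {d} {z₁} {z₂} {P₁ ++ Q ++ P₃}
    (Q⊆ ∘ head-point Q (proj₁ split₂)) (Q⊆ ∘ last-point Q (proj₁ split₂)) bordered
  s≡ : proj₁ ext +ℚ proj₁ (proj₂ ext) ≡ z₁ +ℚ z₂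
  s≡ = proj₂ (proj₂ (proj₂ (proj₂ ext)))

  open Block mono (proj₁ (proj₂ (proj₂ ext))) (proj₁ (proj₂ (proj₂ (proj₂ ext))))

  s-z₂ : s -ℚ z₂ ≡ z₁
  s-z₂ = trans (cong (_-ℚ z₂) s≡) (plus-minus z₁ z₂)

  reversed : reverse (map (s -ℚ_) (walk z₁ D₂)) ≡ walk z₁ (reverse D₂)
  reversed = trans (walk-reverse s z₁ D₂) (cong (λ y → walk y (reverse D₂)) s-z₂)

  end-reversed : end z₁ (reverse D₂) ≡ z₂
  end-reversed = trans (cong (λ y → end y (reverse D₂)) (sym s-z₂))
    (trans (end-reverse s z₁ D₂) (trans (cong (_-ℚ z₁) (trans s≡ (ℚ.+-comm z₁ z₂))) (plus-minus z₂ z₁)))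

  walk′ : map proj₁ (P₁ ++ reverse (map φ Q) ++ P₃) ≡ walk z (D₁ ++ reverse D₂ ++ D₃)
  walk′ = begin
    map proj₁ (P₁ ++ reverse (map φ Q) ++ P₃)
      ≡⟨ map-++₃ proj₁ P₁ (reverse (map φ Q)) P₃ ⟩
    map proj₁ P₁ ++ map proj₁ (reverse (map φ Q)) ++ map proj₁ P₃
      ≡⟨ cong₃-++ (proj₁ split₁)
           (trans (map-reverse-map proj₁ (λ _ → refl) Q) (trans (cong (reverse ∘ map (s -ℚ_)) (proj₁ split₂)) reversed))
           (trans (proj₂ split₂) (cong (λ y → ends y D₃) (sym end-reversed))) ⟩
    starts z D₁ ++ walk z₁ (reverse D₂) ++ ends (end z₁ (reverse D₂)) D₃
      ≡⟨ cong (starts z D₁ ++_) (sym (walk-++ʳ z₁ (reverse D₂) D₃)) ⟩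
    starts z D₁ ++ walk z₁ (reverse D₂ ++ D₃)
      ≡⟨ sym (walk-++ˡ z D₁ (reverse D₂ ++ D₃)) ⟩
    walk z (D₁ ++ reverse D₂ ++ D₃) ∎
    where open ≡-Reasoning

  word′ : map proj₂ (P₁ ++ reverse (map φ Q) ++ P₃) ≡ map proj₂ P₁ ++ flipW c d (map proj₂ Q) ++ map proj₂ P₃
  word′ = trans (map-++₃ proj₂ P₁ (reverse (map φ Q)) P₃)
    (cong (λ w′ → map proj₂ P₁ ++ w′ ++ map proj₂ P₃) (map-reverse-map proj₂ (λ _ → refl) Q))

  cover : ∀ {p} → p ∈ P₁ ++ reverse (map φ Q) ++ P₃ → Kept p ⊎ Moved p
  cover p∈ with ∈-++₃⁻ P₁ (reverse (map φ Q)) p∈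
  ... | inj₁ p∈P₁ = inj₁ (Mem.∈-++⁺ˡ p∈P₁ , All.lookup L-out (Mem.∈-map⁺ proj₂ p∈P₁))
  ... | inj₂ (inj₂ p∈P₃) = inj₁ (Mem.∈-++⁺ʳ P₁ (Mem.∈-++⁺ʳ Q p∈P₃) , All.lookup R-out (Mem.∈-map⁺ proj₂ p∈P₃))
  ... | inj₂ (inj₁ p∈Q′) with ∈-reverse-map⁻ Q p∈Q′
  ... | q , q∈Q , p≡ = inj₂ (q , Q⊆ q∈Q , Equivalence.to (range (proj₂ q)) (Mem.∈-map⁺ proj₂ q∈Q) , p≡)

head-++ : ∀ {A : Set} (xs : List A) {ys} → xs ≢ [] → head (xs ++ ys) ≡ head xs
head-++ []       xs≢[] = contradiction refl xs≢[]
head-++ (x ∷ xs) xs≢[] = refl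

last-++ : ∀ {A : Set} (xs : List A) {ys} → ys ≢ [] → last (xs ++ ys) ≡ last ys
last-++ xs           {[]}     ys≢[] = contradiction refl ys≢[]
last-++ []           {y ∷ ys} ys≢[] = refl
last-++ (x ∷ [])     {y ∷ ys} ys≢[] = refl
last-++ (x ∷ x′ ∷ xs) {y ∷ ys} ys≢[] = last-++ (x′ ∷ xs) ys≢[]

-- The steps `e` and `f` join the block to the middle `M`, whose points stay put. The outer
-- positions of the block in cyclic order are the two neighbours of `M`, at heights `zb` and `za`.
-- The reflection exchanges these, so the image of `B` can lead into `e` and the image of `A` can
-- follow `f`.
wrapFlip-ordered : ∀ {A M B c d} Da {e Dm f Db} →
  suc (length Da) ≡ length A → suc (length Dm) ≡ length M → suc (length Db) ≡ length B →
  A ≢ [] → B ≢ [] →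
  ValuesRange (B ++ A) c d → Bordered (B ++ A) c d → All (Outside c d) M →
  Ordered (Da ++ e ∷ Dm ++ f ∷ Db) (A ++ M ++ B) →
  Ordered (reverse Db ++ e ∷ Dm ++ f ∷ reverse Da) (flipW c d B ++ M ++ flipW c d A)
wrapFlip-ordered {A} {M} {B} {c} {d} Da {e} {Dm} {f} {Db} lenA lenM lenB A≢[] B≢[] range bordered M-out (z , ps , walk≡ , u≡ , mono)
  with map-++⁻ proj₂ {A} ps u≡
... | Pa , _ , refl , refl , u≡′ with map-++⁻ proj₂ {M} _ u≡′
... | Pm , Pb , refl , refl , refl = zb″ , Pb′ ++ Pm ++ Pa′ , walk′ , word′ , monotone cover
  where
  za = end z Da
  zm = za +ℚ e
  zb = end zm Dm +ℚ f
  z₂ = end zb Db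

  walk-shape : ∀ z Da Db → walk z (Da ++ e ∷ Dm ++ f ∷ Db) ≡
               walk z Da ++ walk (end z Da +ℚ e) Dm ++ walk (end (end z Da +ℚ e) Dm +ℚ f) Db
  walk-shape z Da Db = trans (walk-++-∷ z Da e (Dm ++ f ∷ Db)) (cong (walk z Da ++_) (walk-++-∷ _ Dm f Db))

  length-points : ∀ P z D → suc (length D) ≡ length (map proj₂ P) → length (map proj₁ P) ≡ length (walk z D)
  length-points P z D len = trans (List.length-map proj₁ P)
    (trans (sym (List.length-map proj₂ P)) (trans (sym len) (sym (length-walk z D))))

  split₁ : map proj₁ Pa ≡ walk z Da × map proj₁ (Pm ++ Pb) ≡ walk zm Dm ++ walk zb Db
  split₁ = ++-injective (map proj₁ Pa) (length-points Pa z Da lenA)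
    (trans (sym (List.map-++ proj₁ Pa (Pm ++ Pb))) (trans walk≡ (walk-shape z Da Db)))

  split₂ : map proj₁ Pm ≡ walk zm Dm × map proj₁ Pb ≡ walk zb Db
  split₂ = ++-injective (map proj₁ Pm) (length-points Pm zm Dm lenM)
    (trans (sym (List.map-++ proj₁ Pm Pb)) (proj₂ split₁))

  inA : ∀ {p} → p ∈ Pa → p ∈ Pa ++ Pm ++ Pb
  inA = Mem.∈-++⁺ˡ
  inM : ∀ {p} → p ∈ Pm → p ∈ Pa ++ Pm ++ Pb
  inM = Mem.∈-++⁺ʳ Pa ∘ Mem.∈-++⁺ˡ
  inB : ∀ {p} → p ∈ Pb → p ∈ Pa ++ Pm ++ Pb
  inB = Mem.∈-++⁺ʳ Pa ∘ Mem.∈-++⁺ʳ Pm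

  ext = extremes {map proj₂ Pb ++ map proj₂ Pa} {c} {d} {zb} {za} {Pa ++ Pm ++ Pb}
    (λ h → inB (head-point Pb (proj₂ split₂) (trans (sym (head-++ (map proj₂ Pb) B≢[])) h)))
    (λ l → inA (last-point Pa (proj₁ split₁) (trans (sym (last-++ (map proj₂ Pb) A≢[])) l))) bordered
  s≡ : proj₁ ext +ℚ proj₁ (proj₂ ext) ≡ zb +ℚ za
  s≡ = proj₂ (proj₂ (proj₂ (proj₂ ext)))

  open Block mono (proj₁ (proj₂ (proj₂ ext))) (proj₁ (proj₂ (proj₂ (proj₂ ext))))

  Pa′ = reverse (map φ Pa)
  Pb′ = reverse (map φ Pb)
  zb″ = s -ℚ end zb Db

  s-zb : s -ℚ zb ≡ za
  s-zb = trans (cong (_-ℚ zb) (trans s≡ (ℚ.+-comm zb za))) (plus-minus za zb)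
  s-za : s -ℚ za ≡ zb
  s-za = trans (cong (_-ℚ za) s≡) (plus-minus zb za)

  reflected : ∀ {P z D} → map proj₁ P ≡ walk z D → map proj₁ (reverse (map φ P)) ≡ walk (s -ℚ end z D) (reverse D)
  reflected {P} {z} {D} eq = trans (map-reverse-map proj₁ (λ _ → refl) P)
    (trans (cong (reverse ∘ map (s -ℚ_)) eq) (walk-reverse s z D))

  joint : end zb″ (reverse Db) ≡ za
  joint = trans (end-reverse s zb Db) s-zb

  walk′ : map proj₁ (Pb′ ++ Pm ++ Pa′) ≡ walk zb″ (reverse Db ++ e ∷ Dm ++ f ∷ reverse Da)
  walk′ = begin
    map proj₁ (Pb′ ++ Pm ++ Pa′)
      ≡⟨ map-++₃ proj₁ Pb′ Pm Pa′ ⟩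
    map proj₁ Pb′ ++ map proj₁ Pm ++ map proj₁ Pa′
      ≡⟨ cong₃-++ (reflected {Pb} {zb} {Db} (proj₂ split₂)) (proj₁ split₂)
           (trans (reflected {Pa} {z} {Da} (proj₁ split₁)) (cong (λ y → walk y (reverse Da)) s-za)) ⟩
    walk zb″ (reverse Db) ++ walk (za +ℚ e) Dm ++ walk (end (za +ℚ e) Dm +ℚ f) (reverse Da)
      ≡⟨ cong (λ y → walk zb″ (reverse Db) ++ walk (y +ℚ e) Dm ++ walk (end (y +ℚ e) Dm +ℚ f) (reverse Da)) (sym joint) ⟩
    walk zb″ (reverse Db) ++ walk (end zb″ (reverse Db) +ℚ e) Dm ++ walk (end (end zb″ (reverse Db) +ℚ e) Dm +ℚ f) (reverse Da)
      ≡⟨ sym (walk-shape zb″ (reverse Db) (reverse Da)) ⟩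
    walk zb″ (reverse Db ++ e ∷ Dm ++ f ∷ reverse Da) ∎
    where open ≡-Reasoning

  word′ : map proj₂ (Pb′ ++ Pm ++ Pa′) ≡ flipW c d (map proj₂ Pb) ++ map proj₂ Pm ++ flipW c d (map proj₂ Pa)
  word′ = trans (map-++₃ proj₂ Pb′ Pm Pa′)
    (cong₂ (λ b a → b ++ map proj₂ Pm ++ a) (map-reverse-map proj₂ (λ _ → refl) Pb) (map-reverse-map proj₂ (λ _ → refl) Pa))

  inside : ∀ {q : Point} → proj₂ q ∈ map proj₂ Pb ++ map proj₂ Pa → Inside c d (proj₂ q)
  inside {q} = Equivalence.to (range (proj₂ q))

  cover : ∀ {p} → p ∈ Pb′ ++ Pm ++ Pa′ → Kept p ⊎ Moved p
  cover p∈ with ∈-++₃⁻ Pb′ Pm p∈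
  ... | inj₂ (inj₁ p∈Pm) = inj₁ (inM p∈Pm , All.lookup M-out (Mem.∈-map⁺ proj₂ p∈Pm))
  ... | inj₁ p∈Pb′ with ∈-reverse-map⁻ Pb p∈Pb′
  ... | q , q∈Pb , p≡ = inj₂ (q , inB q∈Pb , inside {q} (Mem.∈-++⁺ˡ (Mem.∈-map⁺ proj₂ q∈Pb)) , p≡)
  cover p∈ | inj₂ (inj₂ p∈Pa′) with ∈-reverse-map⁻ Pa p∈Pa′
  ... | q , q∈Pa , p≡ = inj₂ (q , inA q∈Pa , inside {q} (Mem.∈-++⁺ʳ (map proj₂ Pb) (Mem.∈-map⁺ proj₂ q∈Pa)) , p≡)

-- Flips as involutive rearrangements of values

unique-resp-↭ : ∀ {A : Set} {xs ys : List A} → xs ↭ ys → Unique xs → Unique ys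
unique-resp-↭ xs↭ys = ↭ₛ.Unique-resp-↭ (setoid _) (↭.↭⇒↭ₛ xs↭ys)

unique-++⁻ : ∀ {A : Set} (xs : List A) {ys} → Unique (xs ++ ys) →
             Unique xs × Unique ys × (∀ {x} → x ∈ xs → x ∉ ys)
unique-++⁻ []       uniq = [] , uniq , λ ()
unique-++⁻ (x ∷ xs) (x∉ ∷ uniq) with unique-++⁻ xs uniq
... | uxs , uys , disj = All.++⁻ˡ xs x∉ ∷ uxs , uys , λ
  { (here refl)  y∈ys → All.lookup (All.++⁻ʳ xs x∉) y∈ys refl
  ; (there y∈xs) y∈ys → disj y∈xs y∈ys }

unique-map-local : ∀ {A B : Set} {f : A → B} {xs} →
  (∀ {x y} → x ∈ xs → y ∈ xs → f x ≡ f y → x ≡ y) → Unique xs → Unique (map f xs)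
unique-map-local {xs = []}     inj []          = []
unique-map-local {xs = x ∷ xs} inj (x∉ ∷ uniq) =
  All.map⁺ (All.tabulate λ y∈ fx≡fy → All.lookup x∉ y∈ (inj (here refl) (there y∈) fx≡fy))
  ∷ unique-map-local (λ x∈ y∈ → inj (there x∈) (there y∈)) uniq

flipW-++ : ∀ c d xs ys → flipW c d (xs ++ ys) ≡ flipW c d ys ++ flipW c d xs
flipW-++ c d xs ys = trans (cong reverse (List.map-++ _ xs ys)) (List.reverse-++ (map _ xs) (map _ ys))

length-flipW : ∀ c d w → length (flipW c d w) ≡ length w
length-flipW c d w = trans (List.length-reverse (map _ w)) (List.length-map _ w)

map-id-local : ∀ {A : Set} {f : A → A} xs → (∀ {x} → x ∈ xs → f x ≡ x) → map f xs ≡ xs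
map-id-local []       f≡ = refl
map-id-local (x ∷ xs) f≡ = cong₂ _∷_ (f≡ (here refl)) (map-id-local xs (f≡ ∘ there))

-- The bound keeps truncated subtraction from losing information. This yields the converse half of
-- each equivalence between walks, by flipping the flipped block back.
flipW-involutive : ∀ c d {w} → (∀ {v} → v ∈ w → v ≤ c + d) → flipW c d (flipW c d w) ≡ w
flipW-involutive c d {w} bound = begin
  reverse (map f (reverse (map f w)))   ≡⟨ cong reverse (List.reverse-map f (map f w)) ⟩
  reverse (reverse (map f (map f w)))   ≡⟨ List.reverse-involutive (map f (map f w)) ⟩
  map f (map f w)                       ≡⟨ sym (List.map-∘ w) ⟩
  map (f ∘ f) w                         ≡⟨ map-id-local w (ℕ.m∸[m∸n]≡n ∘ bound) ⟩
  w                                     ∎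
  where
  open ≡-Reasoning
  f = c + d ∸_

range-≤ : ∀ {w c d v} → ValuesRange w c d → v ∈ w → v ≤ c + d
range-≤ {c = c} {d} range v∈w = ℕ.≤-trans (proj₂ (Equivalence.to (range _) v∈w)) (ℕ.m≤n+m d c)

∈-flipW : ∀ {w c d} → ValuesRange w c d → ∀ v → v ∈ flipW c d w → v ∈ w
∈-flipW {w} {c} {d} range v v∈ with ∈-reverse-map⁻ w v∈
... | v′ , v′∈ , refl with Equivalence.to (range v′) v′∈
... | c≤v′ , v′≤d = Equivalence.from (range _)
  ( subst (_≤ c + d ∸ v′) (ℕ.m+n∸n≡m c d) (ℕ.∸-monoʳ-≤ (c + d) v′≤d)
  , subst (c + d ∸ v′ ≤_) (ℕ.m+n∸m≡n c d) (ℕ.∸-monoʳ-≤ (c + d) c≤v′) )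

flipW-∈ : ∀ {w c d} → ValuesRange w c d → ∀ v → v ∈ w → v ∈ flipW c d w
flipW-∈ {w} {c} {d} range v v∈ = subst (_∈ flipW c d w) (ℕ.m∸[m∸n]≡n (range-≤ range v∈))
  (Any.reverse⁺ (Mem.∈-map⁺ (c + d ∸_) (∈-flipW range _ (Any.reverse⁺ (Mem.∈-map⁺ (c + d ∸_) v∈)))))

range-flipW : ∀ {w c d} → ValuesRange w c d → ValuesRange (flipW c d w) c d
range-flipW range v = range v ⇔-∘ mk⇔ (∈-flipW range v) (flipW-∈ range v)

flipW-↭ : ∀ {w c d} → Unique w → ValuesRange w c d → flipW c d w ↭ w
flipW-↭ {w} {c} {d} uniq range = ∼bag⇒↭ (unique∧set⇒bag
  (unique-resp-↭ (↭-sym (↭.↭-reverse (map (c + d ∸_) w))) (unique-map-local injective uniq))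
  uniq (mk⇔ (∈-flipW range _) (flipW-∈ range _)))
  where
  injective : ∀ {x y} → x ∈ w → y ∈ w → c + d ∸ x ≡ c + d ∸ y → x ≡ y
  injective x∈ y∈ = ℕ.∸-cancelˡ-≡ (range-≤ range x∈) (range-≤ range y∈)

head-reverse : ∀ {A : Set} (xs : List A) → head (reverse xs) ≡ last xs
head-reverse []       = refl
head-reverse (x ∷ []) = refl
head-reverse (x ∷ y ∷ xs) = begin
  head (reverse (x ∷ y ∷ xs))  ≡⟨ cong head (List.unfold-reverse x (y ∷ xs)) ⟩
  head (reverse (y ∷ xs) ∷ʳ x) ≡⟨ head-++ (reverse (y ∷ xs)) reverse≢[] ⟩
  head (reverse (y ∷ xs))      ≡⟨ head-reverse (y ∷ xs) ⟩
  last (y ∷ xs)                ∎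
  where
  open ≡-Reasoning
  reverse≢[] : reverse (y ∷ xs) ≢ []
  reverse≢[] eq = case trans (sym (List.length-reverse (y ∷ xs))) (cong length eq) of λ ()

last-reverse : ∀ {A : Set} (xs : List A) → last (reverse xs) ≡ head xs
last-reverse xs = trans (sym (head-reverse (reverse xs))) (cong head (List.reverse-involutive xs))

head-map : ∀ {A B : Set} (f : A → B) {x} xs → head xs ≡ just x → head (map f xs) ≡ just (f x)
head-map f (_ ∷ _) refl = refl

last-map : ∀ {A B : Set} (f : A → B) {x} xs → last xs ≡ just x → last (map f xs) ≡ just (f x)
last-map f (_ ∷ [])     refl = refl
last-map f (_ ∷ y ∷ xs) eq   = last-map f (y ∷ xs) eq

bordered-flipW : ∀ {w c d} → Bordered w c d → Bordered (flipW c d w) c d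
bordered-flipW {w} {c} {d} = Sum.map
  (λ (h , l) → flipped-head (ℕ.m+n∸n≡m c d) l , flipped-last (ℕ.m+n∸m≡n c d) h)
  (λ (h , l) → flipped-head (ℕ.m+n∸m≡n c d) l , flipped-last (ℕ.m+n∸n≡m c d) h)
  where
  flipped-head : ∀ {v v′} → c + d ∸ v ≡ v′ → last w ≡ just v → head (flipW c d w) ≡ just v′
  flipped-head eq l = trans (head-reverse (map _ w)) (trans (last-map (c + d ∸_) w l) (cong just eq))
  flipped-last : ∀ {v v′} → c + d ∸ v ≡ v′ → head w ≡ just v → last (flipW c d w) ≡ just v′
  flipped-last eq h = trans (last-reverse (map _ w)) (trans (head-map (c + d ∸_) w h) (cong just eq))

outside : ∀ {w c d v} → ValuesRange w c d → v ∉ w → Outside c d v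
outside {c = c} {d} {v} range v∉w with v <? c | d <? v
... | yes v<c | _       = inj₁ v<c
... | no _    | yes d<v = inj₂ d<v
... | no v≮c  | no d≮v  = contradiction (Equivalence.from (range v) (ℕ.≮⇒≥ v≮c , ℕ.≮⇒≥ d≮v)) v∉w

-- Flips rearrange the steps

-- es lists the labels of the steps in the order in which they are taken.
Valid : ℕ → List ℕ → List ℕ → Set
Valid m es u = es ↭ upTo m × u ↭ map suc (upTo (suc m))

-- `x` gives each label its step, so both arrangements are compared for one choice of steps.
Same : List ℕ → List ℕ → List ℕ → List ℕ → Set
Same es u es′ u′ = ∀ (x : ℕ → ℚ) → Ordered (map x es) u ⇔ Ordered (map x es′) u′

module _ {m : ℕ} {es u : List ℕ} (valid : Valid m es u) where

  unique-labels : Unique es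
  unique-labels = unique-resp-↭ (↭-sym (proj₁ valid)) (Unique.upTo⁺ m)

  unique-values : Unique u
  unique-values = unique-resp-↭ (↭-sym (proj₂ valid)) (Unique.map⁺ ℕ.suc-injective (Unique.upTo⁺ (suc m)))

  length-labels : length es ≡ m
  length-labels = trans (↭.↭-length (proj₁ valid)) (List.length-upTo m)

  length-values : length u ≡ suc m
  length-values = trans (↭.↭-length (proj₂ valid)) (trans (List.length-map suc (upTo (suc m))) (List.length-upTo (suc m)))

  values : ValuesRange u 1 (suc m)
  values v = mk⇔ to from
    where
    to : v ∈ u → 1 ≤ v × v ≤ suc m
    to v∈ with Mem.∈-map⁻ suc (↭.∈-resp-↭ (proj₂ valid) v∈)
    ... | i , i∈ , refl = s≤s z≤n , Mem.∈-upTo⁻ i∈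
    from : 1 ≤ v × v ≤ suc m → v ∈ u
    from (s≤s _ , v≤) = ↭.∈-resp-↭ (↭-sym (proj₂ valid)) (Mem.∈-map⁺ suc (Mem.∈-upTo⁺ v≤))

Step : ℕ → List ℕ → List ℕ → List ℕ → List ℕ → Set
Step m es u es′ u′ = Valid m es′ u′ × Same es u es′ u′

rc-step : ∀ {m es u} → Valid m es u → Step m es u (reverse es) (RC u)
rc-step {m} {es} {u} valid = (reverse-valid , RC-valid) , λ x → mk⇔ (to x) (from x)
  where
  -- `flipW` depends only on the sum of its bounds: with bounds 0 and `suc n` it is `RC` by
  -- computation, and for `n = suc m` the sum is that of the value range from 1 to `suc m`.
  RC≡ : RC u ≡ flipW 1 (suc m) u
  RC≡ = cong (λ n → flipW 0 (suc n) u) (length-values valid)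
  reverse-valid = ↭-trans (↭.↭-reverse es) (proj₁ valid)
  RC-valid = ↭-trans (↭-reflexive RC≡) (↭-trans (flipW-↭ (unique-values valid) (values valid)) (proj₂ valid))
  valid′ : Valid m (reverse es) (RC u)
  valid′ = reverse-valid , RC-valid
  once : ∀ {es u} → Valid m es u → ∀ x → Ordered (map x es) u → Ordered (map x (reverse es)) (RC u)
  once {es} {u} v x o = subst (λ ds → Ordered ds (RC u)) (sym (List.reverse-map x es))
    (rc-ordered (λ v∈ → ℕ.m≤n⇒m≤1+n (subst (_ ≤_) (sym (length-values v)) (proj₂ (Equivalence.to (values v _) v∈)))) o)
  to = once valid
  RC²≡ : RC (RC u) ≡ u
  RC²≡ = trans (cong (λ n → flipW 0 (suc n) (RC u)) (length-values valid′))
    (trans (cong (flipW 1 (suc m)) RC≡) (flipW-involutive 1 (suc m) (range-≤ (values valid))))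
  from : ∀ x → Ordered (map x (reverse es)) (RC u) → Ordered (map x es) u
  from x o = subst₂ (λ e w → Ordered (map x e) w) (List.reverse-involutive es) RC²≡ (once valid′ x o)

ordFlip-step : ∀ {m L w R c d} D₁ {D₂ D₃} → length D₁ ≡ length L → suc (length D₂) ≡ length w →
  ValuesRange w c d → Bordered w c d → Valid m (D₁ ++ D₂ ++ D₃) (L ++ w ++ R) →
  Step m (D₁ ++ D₂ ++ D₃) (L ++ w ++ R) (D₁ ++ reverse D₂ ++ D₃) (L ++ flipW c d w ++ R)
ordFlip-step {m} {L} {w} {R} {c} {d} D₁ {D₂} {D₃} len₁ len₂ range bordered valid
  = valid′ , λ x → mk⇔ (once range bordered len₂ x) (from x)
  where
  unique-w : Unique w × Unique (L ++ R) × (∀ {v} → v ∈ w → v ∉ L ++ R)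
  unique-w = unique-++⁻ w (unique-resp-↭ (↭.shifts L w) (unique-values valid))

  rest-outside : ∀ {v} → v ∈ L ++ R → Outside c d v
  rest-outside v∈ = outside range (λ v∈w → proj₂ (proj₂ unique-w) v∈w v∈)

  valid′ : Valid m (D₁ ++ reverse D₂ ++ D₃) (L ++ flipW c d w ++ R)
  valid′ = ↭-trans (↭.++⁺ˡ D₁ (↭.++⁺ʳ D₃ (↭.↭-reverse D₂))) (proj₁ valid)
         , ↭-trans (↭.++⁺ˡ L (↭.++⁺ʳ R (flipW-↭ (proj₁ unique-w) range))) (proj₂ valid)

  once : ∀ {w D₂} → ValuesRange w c d → Bordered w c d → suc (length D₂) ≡ length w → ∀ x →
         Ordered (map x (D₁ ++ D₂ ++ D₃)) (L ++ w ++ R) →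
         Ordered (map x (D₁ ++ reverse D₂ ++ D₃)) (L ++ flipW c d w ++ R)
  once {w} {D₂} range bordered len₂ x o = subst (λ ds → Ordered ds (L ++ flipW c d w ++ R))
    (sym (trans (map-++₃ x D₁ (reverse D₂) D₃) (cong (λ e → map x D₁ ++ e ++ map x D₃) (List.reverse-map x D₂))))
    (ordFlip-ordered {L} {w} {R} {c} {d} (map x D₁) {map x D₂} {map x D₃} (trans (List.length-map x D₁) len₁) (trans (cong suc (List.length-map x D₂)) len₂)
      range bordered (All.tabulate (rest-outside ∘ Mem.∈-++⁺ˡ)) (All.tabulate (rest-outside ∘ Mem.∈-++⁺ʳ L))
      (subst (λ ds → Ordered ds (L ++ w ++ R)) (map-++₃ x D₁ D₂ D₃) o))

  from : ∀ x → Ordered (map x (D₁ ++ reverse D₂ ++ D₃)) (L ++ flipW c d w ++ R) →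
         Ordered (map x (D₁ ++ D₂ ++ D₃)) (L ++ w ++ R)
  from x o = subst₂ (λ e v → Ordered (map x (D₁ ++ e ++ D₃)) (L ++ v ++ R))
    (List.reverse-involutive D₂) (flipW-involutive c d (range-≤ range))
    (once (range-flipW range) (bordered-flipW {w} bordered)
      (trans (cong suc (List.length-reverse D₂)) (trans len₂ (sym (length-flipW c d w)))) x o)

wrapFlip-step : ∀ {m A M B c d} Da {e Dm f Db} →
  suc (length Da) ≡ length A → suc (length Dm) ≡ length M → suc (length Db) ≡ length B →
  ValuesRange (B ++ A) c d → Bordered (B ++ A) c d → Valid m (Da ++ e ∷ Dm ++ f ∷ Db) (A ++ M ++ B) →
  Step m (Da ++ e ∷ Dm ++ f ∷ Db) (A ++ M ++ B)
         (reverse Db ++ e ∷ Dm ++ f ∷ reverse Da) (flipW c d B ++ M ++ flipW c d A)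
wrapFlip-step {m} {A} {M} {B} {c} {d} Da {e} {Dm} {f} {Db} lenA lenM lenB range bordered valid
  = valid′ , λ x → mk⇔ (once {A} {B} {Da} {Db} lenA lenB range bordered x) (from x)
  where
  nonempty : ∀ (D xs : List ℕ) → suc (length D) ≡ length xs → xs ≢ []
  nonempty _ _ len refl = case len of λ ()

  shuffle : ∀ {X : Set} (xs ys zs : List X) → xs ++ ys ++ zs ↭ (zs ++ xs) ++ ys
  shuffle xs ys zs = ↭-trans (↭-reflexive (sym (List.++-assoc xs ys zs)))
    (↭-trans (↭.++-comm (xs ++ ys) zs) (↭-reflexive (sym (List.++-assoc zs xs ys))))

  swap-outer : ∀ {X : Set} (xs ys zs : List X) → zs ++ ys ++ xs ↭ xs ++ ys ++ zs
  swap-outer xs ys zs = ↭-trans (↭.shifts zs ys) (↭-trans (↭.++⁺ˡ ys (↭.++-comm zs xs)) (↭.shifts ys xs))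

  unique-BA : Unique (B ++ A) × Unique M × (∀ {v} → v ∈ B ++ A → v ∉ M)
  unique-BA = unique-++⁻ (B ++ A) (unique-resp-↭ (shuffle A M B) (unique-values valid))

  M-outside : All (Outside c d) M
  M-outside = All.tabulate λ v∈M → outside range λ v∈BA → proj₂ (proj₂ unique-BA) v∈BA v∈M

  assoc-ends : ∀ {X : Set} (xs : List X) {e ys f zs} → xs ++ e ∷ ys ++ f ∷ zs ≡ xs ++ (e ∷ ys ++ [ f ]) ++ zs
  assoc-ends xs {e} {ys} {f} {zs} = cong (λ t → xs ++ e ∷ t) (sym (List.++-assoc ys [ f ] zs))

  valid′ : Valid m (reverse Db ++ e ∷ Dm ++ f ∷ reverse Da) (flipW c d B ++ M ++ flipW c d A)
  valid′ = labels , word′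
    where
    mid = e ∷ Dm ++ [ f ]
    labels = ↭-trans (↭-reflexive (assoc-ends (reverse Db)))
      (↭-trans (↭.++⁺ (↭.↭-reverse Db) (↭.++⁺ˡ mid (↭.↭-reverse Da)))
      (↭-trans (swap-outer Da mid Db) (↭-trans (↭-reflexive (sym (assoc-ends Da))) (proj₁ valid))))
    word′ = ↭-trans (shuffle (flipW c d B) M (flipW c d A))
      (↭-trans (↭-reflexive (cong (_++ M) (sym (flipW-++ c d B A))))
      (↭-trans (↭.++⁺ʳ M (flipW-↭ (proj₁ unique-BA) range))
      (↭-trans (↭-sym (shuffle A M B)) (proj₂ valid))))

  map-shape : ∀ x Da Db → map x (Da ++ e ∷ Dm ++ f ∷ Db) ≡ map x Da ++ x e ∷ map x Dm ++ x f ∷ map x Db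
  map-shape x Da Db = trans (List.map-++ x Da (e ∷ Dm ++ f ∷ Db)) (cong (λ t → map x Da ++ x e ∷ t) (List.map-++ x Dm (f ∷ Db)))

  once : ∀ {A B Da Db} → suc (length Da) ≡ length A → suc (length Db) ≡ length B →
    ValuesRange (B ++ A) c d → Bordered (B ++ A) c d → ∀ (x : ℕ → ℚ) →
    Ordered (map x (Da ++ e ∷ Dm ++ f ∷ Db)) (A ++ M ++ B) →
    Ordered (map x (reverse Db ++ e ∷ Dm ++ f ∷ reverse Da)) (flipW c d B ++ M ++ flipW c d A)
  once {A} {B} {Da} {Db} lenA lenB range bordered x o =
    subst (λ ds → Ordered ds (flipW c d B ++ M ++ flipW c d A))
      (sym (trans (map-shape x (reverse Db) (reverse Da))
        (cong₂ (λ b a → b ++ x e ∷ map x Dm ++ x f ∷ a) (List.reverse-map x Db) (List.reverse-map x Da))))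
      (wrapFlip-ordered {A} {M} {B} {c} {d} (map x Da) (len Da lenA) (len Dm lenM) (len Db lenB)
        (nonempty Da A lenA) (nonempty Db B lenB) range bordered M-outside
        (subst (λ ds → Ordered ds (A ++ M ++ B)) (map-shape x Da Db) o))
    where
    len : ∀ D {n} → suc (length D) ≡ n → suc (length (map x D)) ≡ n
    len D eq = trans (cong suc (List.length-map x D)) eq

  from : ∀ x → Ordered (map x (reverse Db ++ e ∷ Dm ++ f ∷ reverse Da)) (flipW c d B ++ M ++ flipW c d A) →
               Ordered (map x (Da ++ e ∷ Dm ++ f ∷ Db)) (A ++ M ++ B)
  from x o = subst₂ (λ es u → Ordered (map x es) u)
    (cong₂ (λ a b → a ++ e ∷ Dm ++ f ∷ b) (List.reverse-involutive Da) (List.reverse-involutive Db))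
    (cong₂ (λ a b → a ++ M ++ b)
      (flipW-involutive c d (range-≤ range ∘ Mem.∈-++⁺ʳ B)) (flipW-involutive c d (range-≤ range ∘ Mem.∈-++⁺ˡ)))
    (once {flipW c d B} {flipW c d A} {reverse Db} {reverse Da}
      (len Db B lenB) (len Da A lenA)
      (subst (λ w → ValuesRange w c d) (flipW-++ c d B A) (range-flipW range))
      (subst (λ w → Bordered w c d) (flipW-++ c d B A) (bordered-flipW {B ++ A} bordered)) x o)
    where
    len : ∀ (D w : List ℕ) → suc (length D) ≡ length w → suc (length (reverse D)) ≡ length (flipW c d w)
    len D w eq = trans (cong suc (List.length-reverse D)) (trans eq (sym (length-flipW c d w)))

-- Patterns as words of ordered walks

toList-tabulate : ∀ {A : Set} {n} (f : Fin n → A) → Vec.toList (Vec.tabulate f) ≡ tabulate f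
toList-tabulate {n = zero}  f = refl
toList-tabulate {n = suc n} f = cong (f zero ∷_) (toList-tabulate (f ∘ suc))

walk-tabulate : ∀ z {m} (x : Vec ℚ m) → tabulate (λ i → z +ℚ Z x i) ≡ walk z (Vec.toList x)
walk-tabulate z Vec.[]       = cong [_] (ℚ.+-identityʳ z)
walk-tabulate z (x Vec.∷ xs) = cong₂ _∷_ (ℚ.+-identityʳ z)
  (trans (List.tabulate-cong (λ i → sym (ℚ.+-assoc z x (Z xs i)))) (walk-tabulate (z +ℚ x) xs))

points-≡ : (ps qs : List Point) → map proj₁ ps ≡ map proj₁ qs → map proj₂ ps ≡ map proj₂ qs → ps ≡ qs
points-≡ []       []       _   _   = refl
points-≡ (p ∷ ps) (q ∷ qs) eq₁ eq₂ = cong₂ _∷_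
  (cong₂ _,_ (List.∷-injectiveˡ eq₁) (List.∷-injectiveˡ eq₂))
  (points-≡ ps qs (List.∷-injectiveʳ eq₁) (List.∷-injectiveʳ eq₂))

<ℚ⇒≱ : ∀ {a b} → a <ℚ b → ¬ (b ≤ℚ a)
<ℚ⇒≱ lt le = ℚ.<-irrefl refl (ℚ.<-≤-trans lt le)

+ℚ-cancelˡ-< : ∀ z {a b} → z +ℚ a <ℚ z +ℚ b → a <ℚ b
+ℚ-cancelˡ-< z {a} {b} lt = ℚ.≰⇒> λ b≤a → <ℚ⇒≱ lt (ℚ.+-monoʳ-≤ z b≤a)

-- A form between counting ranks, as in `PatternIs`, and listing points, as in `Ordered`. Since `π`
-- is injective, the strict implication also excludes coincident heights.
SameOrder : ∀ {m} → Vec ℚ m → Permutation′ (suc m) → Set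
SameOrder x π = ∀ i j → toℕ (π ⟨$⟩ʳ i) < toℕ (π ⟨$⟩ʳ j) → Z x i <ℚ Z x j

module _ {m : ℕ} (x : Vec ℚ m) (π : Permutation′ (suc m)) where

  private
    value : Fin (suc m) → ℕ
    value i = suc (toℕ (π ⟨$⟩ʳ i))

    point : ℚ → Fin (suc m) → Point
    point z i = z +ℚ Z x i , value i

    points : ℚ → List Point
    points z = tabulate (point z)

    heights≡ : ∀ z → map proj₁ (points z) ≡ walk z (Vec.toList x)
    heights≡ z = trans (List.map-tabulate (point z) proj₁) (walk-tabulate z x)

    word≡ : ∀ z → map proj₂ (points z) ≡ word π
    word≡ z = trans (List.map-tabulate (point z) proj₂) (sym (toList-tabulate value))

  ordered⇒sameOrder : Ordered (Vec.toList x) (word π) → SameOrder x π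
  ordered⇒sameOrder (z , ps , walk≡ , u≡ , mono) i j lt
    with refl ← points-≡ ps (points z) (trans walk≡ (sym (heights≡ z))) (trans u≡ (sym (word≡ z)))
    = +ℚ-cancelˡ-< z (_≼_.strict (mono (Mem.∈-tabulate⁺ {f = point z} i) (Mem.∈-tabulate⁺ {f = point z} j)) (s≤s lt))

  sameOrder⇒ordered : SameOrder x π → Ordered (Vec.toList x) (word π)
  sameOrder⇒ordered order = 0ℚ , points 0ℚ , heights≡ 0ℚ , word≡ 0ℚ , mono
    where
    strict : ∀ i j → value i < value j → 0ℚ +ℚ Z x i <ℚ 0ℚ +ℚ Z x j
    strict i j lt = ℚ.+-monoʳ-< 0ℚ (order i j (s≤s⁻¹ lt))
    weak : ∀ i j → value i ≤ value j → 0ℚ +ℚ Z x i ≤ℚ 0ℚ +ℚ Z x j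
    weak i j le with ℕ.m≤n⇒m<n∨m≡n le
    ... | inj₁ lt = ℚ.<⇒≤ (strict i j lt)
    ... | inj₂ eq = ℚ.≤-reflexive (cong (λ k → 0ℚ +ℚ Z x k)
      (trans (sym (Perm.inverseˡ π)) (trans (cong (π ⟨$⟩ˡ_) (Fin.toℕ-injective (ℕ.suc-injective eq))) (Perm.inverseˡ π))))
    mono : Monotone (points 0ℚ)
    mono p∈ q∈ with Mem.∈-tabulate⁻ {f = point 0ℚ} p∈ | Mem.∈-tabulate⁻ {f = point 0ℚ} q∈
    ... | i , refl | j , refl = weak i j , strict i j

permutation⇒↭-upTo : ∀ {n} (ρ : Permutation′ n) → tabulate (toℕ ∘ (ρ ⟨$⟩ʳ_)) ↭ upTo n
permutation⇒↭-upTo {n} ρ = ∼bag⇒↭ (unique∧set⇒bag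
  (Unique.tabulate⁺ λ eq → trans (sym (Perm.inverseˡ ρ)) (trans (cong (ρ ⟨$⟩ˡ_) (Fin.toℕ-injective eq)) (Perm.inverseˡ ρ)))
  (Unique.upTo⁺ n) (mk⇔ to from))
  where
  to : ∀ {k} → k ∈ tabulate (toℕ ∘ (ρ ⟨$⟩ʳ_)) → k ∈ upTo n
  to k∈ with Mem.∈-tabulate⁻ {f = toℕ ∘ (ρ ⟨$⟩ʳ_)} k∈
  ... | i , refl = Mem.∈-upTo⁺ (Fin.toℕ<n (ρ ⟨$⟩ʳ i))
  from : ∀ {k} → k ∈ upTo n → k ∈ tabulate (toℕ ∘ (ρ ⟨$⟩ʳ_))
  from k∈ = subst (_∈ tabulate (toℕ ∘ (ρ ⟨$⟩ʳ_)))
    (trans (cong toℕ (Perm.inverseʳ ρ)) (Fin.toℕ-fromℕ< (Mem.∈-upTo⁻ k∈)))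
    (Mem.∈-tabulate⁺ (ρ ⟨$⟩ˡ fromℕ< (Mem.∈-upTo⁻ k∈)))

length-filter-mono : ∀ {A : Set} {P Q : A → Set} (P? : ∀ x → Dec (P x)) (Q? : ∀ x → Dec (Q x)) →
  (∀ {x} → P x → Q x) → ∀ xs → length (filter P? xs) ≤ length (filter Q? xs)
length-filter-mono P? Q? P⇒Q []       = z≤n
length-filter-mono P? Q? P⇒Q (x ∷ xs) with P? x | Q? x
... | yes p | yes q = s≤s (length-filter-mono P? Q? P⇒Q xs)
... | yes p | no ¬q = contradiction (P⇒Q p) ¬q
... | no ¬p | yes q = ℕ.m≤n⇒m≤1+n (length-filter-mono P? Q? P⇒Q xs)
... | no ¬p | no ¬q = length-filter-mono P? Q? P⇒Q xs

length-filter-map : ∀ {A B : Set} {P : B → Set} (P? : ∀ x → Dec (P x)) (f : A → B) xs →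
  length (filter P? (map f xs)) ≡ length (filter (P? ∘ f) xs)
length-filter-map P? f []       = refl
length-filter-map P? f (x ∷ xs) with P? (f x)
... | yes _ = cong suc (length-filter-map P? f xs)
... | no _  = length-filter-map P? f xs

length-filter-upTo : ∀ {t n} → t < n → length (filter (_≤? t) (upTo n)) ≡ suc t
length-filter-upTo {t} {n} t<n = trans (↭.↭-length (∼bag⇒↭ (unique∧set⇒bag
    (Unique.filter⁺ (_≤? t) (Unique.upTo⁺ n)) (Unique.upTo⁺ (suc t)) (mk⇔ to from))))
  (List.length-upTo (suc t))
  where
  to : ∀ {k} → k ∈ filter (_≤? t) (upTo n) → k ∈ upTo (suc t)
  to k∈ = Mem.∈-upTo⁺ (s≤s (proj₂ (Mem.∈-filter⁻ (_≤? t) {xs = upTo n} k∈)))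
  from : ∀ {k} → k ∈ upTo (suc t) → k ∈ filter (_≤? t) (upTo n)
  from k∈ = Mem.∈-filter⁺ (_≤? t) (Mem.∈-upTo⁺ (ℕ.<-≤-trans (Mem.∈-upTo⁻ k∈) t<n)) (s≤s⁻¹ (Mem.∈-upTo⁻ k∈))

module _ {m : ℕ} (x : Vec ℚ m) (π : Permutation′ (suc m)) where

  private
    n = suc m
    val : Fin n → ℕ
    val i = toℕ (π ⟨$⟩ʳ i)
    rank : Fin n → ℕ
    rank i = length (filter (λ k → Z x k ≤ℚ? Z x i) (allFin n))

  -- If `Z x j` were at most `Z x i`, every index counted in the rank of `j` would be counted in
  -- that of `i`.
  patternIs⇒sameOrder : PatternIs x π → SameOrder x π
  patternIs⇒sameOrder (_ , rank≡) i j lt = ℚ.≰⇒> λ zj≤zi → ℕ.<⇒≱ lt (s≤s⁻¹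
    (subst₂ _≤_ (sym (rank≡ j)) (sym (rank≡ i))
      (length-filter-mono (λ k → Z x k ≤ℚ? Z x j) (λ k → Z x k ≤ℚ? Z x i) (λ le → ℚ.≤-trans le zj≤zi) (allFin n))))

  sameOrder⇒patternIs : SameOrder x π → PatternIs x π
  sameOrder⇒patternIs order = distinct , λ i → sym (rank≡ i)
    where
    val-injective : ∀ {i j} → val i ≡ val j → i ≡ j
    val-injective eq = trans (sym (Perm.inverseˡ π)) (trans (cong (π ⟨$⟩ˡ_) (Fin.toℕ-injective eq)) (Perm.inverseˡ π))

    distinct : ∀ i j → i ≢ j → Z x i ≢ Z x j
    distinct i j i≢j eq with ℕ.<-cmp (val i) (val j)
    ... | tri< lt _ _ = ℚ.<-irrefl eq (order i j lt)
    ... | tri≈ _ e _  = i≢j (val-injective e)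
    ... | tri> _ _ gt = ℚ.<-irrefl (sym eq) (order j i gt)

    order-≤ : ∀ {i j} → val i ≤ val j → Z x i ≤ℚ Z x j
    order-≤ {i} {j} le with ℕ.m≤n⇒m<n∨m≡n le
    ... | inj₁ lt = ℚ.<⇒≤ (order i j lt)
    ... | inj₂ eq = ℚ.≤-reflexive (cong (Z x) (val-injective eq))

    order-≤⁻ : ∀ {i j} → Z x i ≤ℚ Z x j → val i ≤ val j
    order-≤⁻ {i} {j} le = ℕ.≮⇒≥ λ lt → <ℚ⇒≱ (order j i lt) le

    rank≡ : ∀ i → rank i ≡ suc (val i)
    rank≡ i = begin
      rank i
        ≡⟨ ℕ.≤-antisym (length-filter-mono Z? val? order-≤⁻ (allFin n)) (length-filter-mono val? Z? order-≤ (allFin n)) ⟩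
      length (filter val? (allFin n))
        ≡⟨ sym (length-filter-map (_≤? val i) val (allFin n)) ⟩
      length (filter (_≤? val i) (map val (allFin n)))
        ≡⟨ cong (length ∘ filter (_≤? val i)) (List.map-tabulate id val) ⟩
      length (filter (_≤? val i) (tabulate val))
        ≡⟨ ↭.↭-length (↭.filter-↭ (_≤? val i) (permutation⇒↭-upTo π)) ⟩
      length (filter (_≤? val i) (upTo n))
        ≡⟨ length-filter-upTo (Fin.toℕ<n (π ⟨$⟩ʳ i)) ⟩
      suc (val i) ∎
      where
      open ≡-Reasoning
      Z? = λ k → Z x k ≤ℚ? Z x i
      val? = λ k → val k ≤? val i

  patternIs⇔ordered : PatternIs x π ⇔ Ordered (Vec.toList x) (word π)
  patternIs⇔ordered = mk⇔ (sameOrder⇒ordered x π ∘ patternIs⇒sameOrder) (sameOrder⇒patternIs ∘ ordered⇒sameOrder x π)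

word-↭ : ∀ {n} (π : Permutation′ n) → word π ↭ map suc (upTo n)
word-↭ {n} π = ↭-trans (↭-reflexive (trans (toList-tabulate (λ i → suc (toℕ (π ⟨$⟩ʳ i)))) (sym (List.map-tabulate (toℕ ∘ (π ⟨$⟩ʳ_)) suc))))
  (↭.map⁺ suc (permutation⇒↭-upTo π))

↭-upTo⇒permutation : ∀ {m es} → es ↭ upTo m → ∃ λ (ρ : Permutation′ m) → tabulate (toℕ ∘ (ρ ⟨$⟩ʳ_)) ≡ es
↭-upTo⇒permutation {m} {es} es↭ with refl ← trans (↭.↭-length es↭) (List.length-upTo m)
  = σ Perm.∘ₚ Perm.cast-id len , trans (List.tabulate-cong lookup≡) (List.tabulate-lookup es)
  where
  len = List.length-upTo (length es)
  es↭ₛ = ↭.↭⇒↭ₛ es↭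
  σ : Permutation (length es) (length (upTo (length es)))
  σ = ↭-Homogeneous.onIndices es↭ₛ
  lookup≡ : ∀ i → toℕ (cast len (σ ⟨$⟩ʳ i)) ≡ lookup es i
  lookup≡ i = trans (Fin.toℕ-cast len (σ ⟨$⟩ʳ i))
    (trans (sym (List.lookup-upTo (length es) (σ ⟨$⟩ʳ i))) (sym (↭ₛ.onIndices-lookup (setoid ℕ) es↭ₛ i)))

-- Moves preserve similarity

split-length : ∀ {A : Set} a {b} (xs : List A) → length xs ≡ a + b →
               ∃₂ λ ys zs → xs ≡ ys ++ zs × length ys ≡ a × length zs ≡ b
split-length zero    xs       eq = [] , xs , refl , refl , eq
split-length (suc a) (x ∷ xs) eq with split-length a xs (ℕ.suc-injective eq)
... | ys , zs , refl , len₁ , len₂ = x ∷ ys , zs , refl , cong suc len₁ , len₂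

take-++-length : ∀ {A : Set} (xs : List A) {ys n} → length xs ≡ n → take n (xs ++ ys) ≡ xs
take-++-length []       refl = refl
take-++-length (x ∷ xs) refl = cong (x ∷_) (take-++-length xs refl)

drop-++-length : ∀ {A : Set} (xs : List A) {ys n} → length xs ≡ n → drop n (xs ++ ys) ≡ ys
drop-++-length []       refl = refl
drop-++-length (x ∷ xs) refl = drop-++-length xs refl

wrapFlip≡ : ∀ c d A M B → drop (length A) (flipW c d (B ++ A)) ++ M ++ take (length A) (flipW c d (B ++ A))
                          ≡ flipW c d B ++ M ++ flipW c d A
wrapFlip≡ c d A M B = cong₂ (λ b a → b ++ M ++ a)
  (trans (cong (drop (length A)) (flipW-++ c d B A)) (drop-++-length (flipW c d A) (length-flipW c d A)))
  (trans (cong (take (length A)) (flipW-++ c d B A)) (take-++-length (flipW c d A) (length-flipW c d A)))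

bordered⇒nonempty : ∀ {w c d} → Bordered w c d → ∃ λ k → length w ≡ suc k
bordered⇒nonempty {_ ∷ w} _ = length w , refl
bordered⇒nonempty {[]} (inj₁ (() , _))
bordered⇒nonempty {[]} (inj₂ (() , _))

nonempty-length : ∀ {A : Set} (xs : List A) → xs ≢ [] → ∃ λ k → length xs ≡ suc k
nonempty-length []       xs≢[] = contradiction refl xs≢[]
nonempty-length (x ∷ xs) _     = length xs , refl

labels-length : ∀ {m es u} → Valid m es u → suc (length es) ≡ length u
labels-length valid = trans (cong suc (length-labels valid)) (sym (length-values valid))

move⇒step : ∀ {m es u u′} → Valid m es u → Move u u′ → ∃ λ es′ → Step m es u es′ u′
move⇒step {es = es} valid (rc u) = reverse es , rc-step valid
move⇒step {es = es} valid (ordFlip L w R c d range bordered)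
  with bordered⇒nonempty {w} bordered
... | k , lenw with split-length (length L) {k + length R} es (ℕ.suc-injective (begin
    suc (length es)                      ≡⟨ labels-length valid ⟩
    length (L ++ w ++ R)                 ≡⟨ List.length-++ L ⟩
    length L + length (w ++ R)           ≡⟨ cong (λ n → length L + n) (List.length-++ w) ⟩
    length L + (length w + length R)     ≡⟨ cong (λ n → length L + (n + length R)) lenw ⟩
    length L + suc (k + length R)        ≡⟨ ℕ.+-suc (length L) (k + length R) ⟩
    suc (length L + (k + length R))      ∎))
  where open ≡-Reasoning
... | D₁ , D , refl , len₁ , lenD with split-length k D lenD
... | D₂ , D₃ , refl , len₂ , len₃ = D₁ ++ reverse D₂ ++ D₃ ,
  ordFlip-step {L = L} {w} {R} {c} {d} D₁ {D₂} {D₃} len₁ (trans (cong suc len₂) (sym lenw)) range bordered valid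
move⇒step {m} {es = es} valid (wrapFlip A M B c d A≢[] M≢[] B≢[] range bordered)
  with nonempty-length A A≢[] | nonempty-length M M≢[] | nonempty-length B B≢[]
... | a , lenA | k , lenM | b , lenB with split-length a {suc (k + suc b)} es (ℕ.suc-injective (begin
    suc (length es)                      ≡⟨ labels-length valid ⟩
    length (A ++ M ++ B)                 ≡⟨ List.length-++ A ⟩
    length A + length (M ++ B)           ≡⟨ cong (λ n → length A + n) (List.length-++ M) ⟩
    length A + (length M + length B)     ≡⟨ cong₂ _+_ lenA (cong₂ _+_ lenM lenB) ⟩
    suc (a + suc (k + suc b))            ∎))
  where open ≡-Reasoning
... | Da , e ∷ D , refl , refl , lenD with split-length k D (ℕ.suc-injective lenD)
... | Dm , f ∷ Db , refl , refl , refl = reverse Db ++ e ∷ Dm ++ f ∷ reverse Da ,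
  subst (Step m _ _ _) (sym (wrapFlip≡ c d A M B))
    (wrapFlip-step {A = A} {M} {B} Da (sym lenA) (sym lenM) (sym lenB) range bordered valid)

step-trans : ∀ {m es u es′ u′ es″ u″} → Step m es u es′ u′ → Step m es′ u′ es″ u″ → Step m es u es″ u″
step-trans (_ , same₁) (valid , same₂) = valid , λ x → same₂ x ⇔-∘ same₁ x

moves⇒step : ∀ {m es u u′} → Valid m es u → Star Move u u′ → ∃ λ es′ → Step m es u es′ u′
moves⇒step {es = es} valid ε = es , valid , λ x → mk⇔ id id
moves⇒step valid (move ◅ moves) with move⇒step valid move
... | es′ , step with moves⇒step (proj₁ step) moves
... | es″ , step′ = es″ , step-trans step step′

tabulate-toℕ : ∀ {A : Set} (f : ℕ → A) n → tabulate {n = n} (f ∘ toℕ) ≡ applyUpTo f n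
tabulate-toℕ f zero    = refl
tabulate-toℕ f (suc n) = cong (f 0 ∷_) (tabulate-toℕ (f ∘ suc) n)

valid-word : ∀ {m} es (π : Permutation′ (suc m)) → es ↭ upTo m → Valid m es (word π)
valid-word es π es↭ = es↭ , word-↭ π

same⇒sim : ∀ {m} (π τ : Permutation′ (suc m)) (ρ : Permutation′ m) →
           Same (upTo m) (word π) (tabulate (toℕ ∘ (ρ ⟨$⟩ʳ_))) (word τ) → Sim π τ
same⇒sim {m} π τ ρ same = ρ , λ X →
  ⇔-sym (patternIs⇔ordered (permuteVec ρ X) τ)
  ⇔-∘ (subst₂ (λ ds ds′ → Ordered ds (word π) ⇔ Ordered ds′ (word τ)) (steps X) (permuted X) (same (extend X))
  ⇔-∘ patternIs⇔ordered X π)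
  where
  extend : Vec ℚ m → ℕ → ℚ
  extend X l with l <? m
  ... | yes l<m = Vec.lookup X (fromℕ< l<m)
  ... | no _    = 0ℚ

  extend-toℕ : ∀ X i → extend X (toℕ i) ≡ Vec.lookup X i
  extend-toℕ X i with toℕ i <? m
  ... | yes l<m = cong (Vec.lookup X) (Fin.fromℕ<-toℕ i l<m)
  ... | no l≮m  = contradiction (Fin.toℕ<n i) l≮m

  map-extend : ∀ X (f : Fin m → Fin m) → map (extend X) (tabulate (toℕ ∘ f)) ≡ Vec.toList (Vec.tabulate (Vec.lookup X ∘ f))
  map-extend X f = trans (List.map-tabulate (toℕ ∘ f) (extend X))
    (trans (List.tabulate-cong (extend-toℕ X ∘ f)) (sym (toList-tabulate (Vec.lookup X ∘ f))))

  steps : ∀ X → map (extend X) (upTo m) ≡ Vec.toList X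
  steps X = trans (cong (map (extend X)) (sym (tabulate-toℕ id m)))
    (trans (map-extend X id) (cong Vec.toList (Vec.tabulate∘lookup X)))

  permuted : ∀ X → map (extend X) (tabulate (toℕ ∘ (ρ ⟨$⟩ʳ_))) ≡ Vec.toList (permuteVec ρ X)
  permuted X = map-extend X (ρ ⟨$⟩ʳ_)

moves⇒sim : ∀ {m} (π τ : Permutation′ (suc m)) → Star Move (word π) (word τ) → Sim π τ
moves⇒sim {m} π τ moves with moves⇒step (valid-word (upTo m) π ↭-refl) moves
... | es , (es↭ , _) , same with ↭-upTo⇒permutation es↭
... | ρ , refl = same⇒sim π τ ρ same

-- Labels are named after positions in the walk for `τ`: step `i` of the vector for `π` gets the
-- label that `ρ` sends to `i`, so the permuted vector reads its labels in the order `0, …, m - 1`.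
sim⇒same : ∀ {m} (π τ : Permutation′ (suc m)) → Sim π τ →
           ∃ λ es → es ↭ upTo m × Same es (word π) (upTo m) (word τ)
sim⇒same {m} π τ (ρ , sim) = es , permutation⇒↭-upTo (Perm.flip ρ) , λ x →
  subst (λ ds → PatternIs (permuteVec ρ (X x)) τ ⇔ Ordered ds (word τ)) (target x) (patternIs⇔ordered (permuteVec ρ (X x)) τ)
  ⇔-∘ (sim (X x) ⇔-∘
  subst (λ ds → Ordered ds (word π) ⇔ PatternIs (X x) π) (source x) (⇔-sym (patternIs⇔ordered (X x) π)))
  where
  es = tabulate (toℕ ∘ (ρ ⟨$⟩ˡ_))
  X : (ℕ → ℚ) → Vec ℚ m
  X x = Vec.tabulate (x ∘ toℕ ∘ (ρ ⟨$⟩ˡ_))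

  source : ∀ x → Vec.toList (X x) ≡ map x es
  source x = trans (toList-tabulate (x ∘ toℕ ∘ (ρ ⟨$⟩ˡ_))) (sym (List.map-tabulate (toℕ ∘ (ρ ⟨$⟩ˡ_)) x))

  target : ∀ x → Vec.toList (permuteVec ρ (X x)) ≡ map x (upTo m)
  target x = begin
    Vec.toList (permuteVec ρ (X x))
      ≡⟨ toList-tabulate (λ i → Vec.lookup (X x) (ρ ⟨$⟩ʳ i)) ⟩
    tabulate (λ i → Vec.lookup (X x) (ρ ⟨$⟩ʳ i))
      ≡⟨ List.tabulate-cong (λ i → trans (Vec.lookup∘tabulate (x ∘ toℕ ∘ (ρ ⟨$⟩ˡ_)) (ρ ⟨$⟩ʳ i)) (cong (x ∘ toℕ) (Perm.inverseˡ ρ))) ⟩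
    tabulate (x ∘ toℕ)
      ≡⟨ sym (List.map-tabulate toℕ x) ⟩
    map x (tabulate toℕ)
      ≡⟨ cong (map x) (tabulate-toℕ id m) ⟩
    map x (upTo m) ∎
    where open ≡-Reasoning

-- The integer points of a simplicial cone

-- Serves as a unit vector of gaps and as the unit vector of a label; `gap v (δ l)` is the
-- coefficient of label `l`.
δ : ℕ → ℕ → ℤ
δ v w with w ≟ v
... | yes _ = 1ℤ
... | no _  = 0ℤ

δ-refl : ∀ v → δ v v ≡ 1ℤ
δ-refl v with v ≟ v
... | yes _  = refl
... | no v≢v = contradiction refl v≢v

δ-≢ : ∀ {v w} → w ≢ v → δ v w ≡ 0ℤ
δ-≢ {v} {w} w≢v with w ≟ v
... | yes w≡v = contradiction w≡v w≢v
... | no _    = refl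

δ-nonneg : ∀ v w → 0ℤ ℤ.≤ δ v w
δ-nonneg v w with w ≟ v
... | yes _ = +≤+ z≤n
... | no _  = +≤+ z≤n

sumTo : ℕ → (ℕ → ℤ) → ℤ
sumTo zero    h = 0ℤ
sumTo (suc m) h = sumTo m h ℤ.+ h m

sumTo-mono : ∀ m {h k} → (∀ {v} → v < m → h v ℤ.≤ k v) → sumTo m h ℤ.≤ sumTo m k
sumTo-mono zero    le = ℤ.≤-refl
sumTo-mono (suc m) le = ℤ.+-mono-≤ (sumTo-mono m (le ∘ ℕ.m<n⇒m<1+n)) (le (ℕ.n<1+n m))

sumTo-cong : ∀ m {h k} → (∀ {v} → v < m → h v ≡ k v) → sumTo m h ≡ sumTo m k
sumTo-cong zero    eq = refl
sumTo-cong (suc m) eq = cong₂ ℤ._+_ (sumTo-cong m (eq ∘ ℕ.m<n⇒m<1+n)) (eq (ℕ.n<1+n m))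

sumTo-zero : ∀ m → sumTo m (λ _ → 0ℤ) ≡ 0ℤ
sumTo-zero zero    = refl
sumTo-zero (suc m) = trans (ℤ.+-identityʳ _) (sumTo-zero m)

sumTo-δ : ∀ {m v} → v < m → sumTo m (δ v) ≡ 1ℤ
sumTo-δ {suc m} {v} v<1+m with ℕ.m≤n⇒m<n∨m≡n (s≤s⁻¹ v<1+m)
... | inj₁ v<m  = cong₂ ℤ._+_ (sumTo-δ v<m) (δ-≢ (ℕ.>⇒≢ v<m))
... | inj₂ refl = cong₂ ℤ._+_
  (trans (sumTo-cong m (δ-≢ ∘ ℕ.<⇒≢)) (sumTo-zero m)) (δ-refl v)

combine : ∀ b c p q r s → (b ℤ.* p ℤ.+ c ℤ.* q) ℤ.+ (b ℤ.* r ℤ.+ c ℤ.* s) ≡ b ℤ.* (p ℤ.+ r) ℤ.+ c ℤ.* (q ℤ.+ s)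
combine = ℤ-Ring.solve-∀

sumTo-linear : ∀ m b c h k → sumTo m (λ v → b ℤ.* h v ℤ.+ c ℤ.* k v) ≡ b ℤ.* sumTo m h ℤ.+ c ℤ.* sumTo m k
sumTo-linear zero    b c h k = sym (cong₂ ℤ._+_ (ℤ.*-zeroʳ b) (ℤ.*-zeroʳ c))
sumTo-linear (suc m) b c h k = trans (cong (ℤ._+ (b ℤ.* h m ℤ.+ c ℤ.* k m)) (sumTo-linear m b c h k))
  (combine b c (sumTo m h) (sumTo m k) (h m) (k m))

-- The gaps are independent functionals, defining the simplicial cone { x | every gap of x is nonnegative }.
record Gaps (m : ℕ) : Set where
  field
    gap     : ℕ → (ℕ → ℤ) → ℤ
    linear  : ∀ v b x c y → gap v (λ l → b ℤ.* x l ℤ.+ c ℤ.* y l) ≡ b ℤ.* gap v x ℤ.+ c ℤ.* gap v y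
    realize : ∀ (t : ℕ → ℤ) → ∃ λ x → ∀ {v} → v < m → gap v x ≡ t v

  Strict : (ℕ → ℤ) → Set
  Strict x = ∀ {v} → v < m → 0ℤ ℤ.< gap v x

  Weak : (ℕ → ℤ) → Set
  Weak x = ∀ {v} → v < m → 0ℤ ℤ.≤ gap v x

  total : (ℕ → ℤ) → ℤ
  total x = sumTo m (λ v → gap v x)

  total-linear : ∀ b x c y → total (λ l → b ℤ.* x l ℤ.+ c ℤ.* y l) ≡ b ℤ.* total x ℤ.+ c ℤ.* total y
  total-linear b x c y = trans (sumTo-cong m (λ {v} _ → linear v b x c y))
    (sumTo-linear m b c (λ v → gap v x) (λ v → gap v y))

  unit : ℕ → ℤ
  unit = proj₁ (realize (λ _ → 1ℤ))

  gap-unit : ∀ {v} → v < m → gap v unit ≡ 1ℤ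
  gap-unit = proj₂ (realize (λ _ → 1ℤ))

  total-nonneg : ∀ {x} → Weak x → 0ℤ ℤ.≤ total x
  total-nonneg {x} weak = subst (ℤ._≤ total x) (sumTo-zero m) (sumTo-mono m weak)

open Gaps

bounded : ∀ m (h : ℕ → ℤ) → ∃ λ b → ∀ {v} → v < m → ℤ.∣ h v ∣ ≤ b
bounded zero    h = 0 , λ ()
bounded (suc m) h with bounded m h
... | b , bound = b + ℤ.∣ h m ∣ , λ v<1+m → case ℕ.m≤n⇒m<n∨m≡n (s≤s⁻¹ v<1+m) of λ
  { (inj₁ v<m)  → ℕ.≤-trans (bound v<m) (ℕ.m≤m+n b _)
  ; (inj₂ refl) → ℕ.m≤n+m _ b }

+-nonneg : ∀ {b} e → ℤ.∣ e ∣ ≤ b → 0ℤ ℤ.≤ + b ℤ.+ e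
+-nonneg (+ n)    _  = +≤+ z≤n
+-nonneg -[1+ n ] le = subst (0ℤ ℤ.≤_) (sym (ℤ.⊖-≥ le)) (+≤+ z≤n)

*-nonneg : ∀ {a b} → 0ℤ ℤ.≤ a → 0ℤ ℤ.≤ b → 0ℤ ℤ.≤ a ℤ.* b
*-nonneg {+ a} {+ b} _ _ = subst (0ℤ ℤ.≤_) (ℤ.pos-* a b) (+≤+ z≤n)

module _ {m : ℕ} (F G : Gaps m) (F⇒G : ∀ {x} → Strict F x → Strict G x) where

  -- A discrete passage to the closure: `b x + unit F` is strictly inside the cone of `F` for every
  -- `b ≥ 0`. With `b` the positive `G`-gap of `unit F`, a `G`-gap of `x` that is at most -1 would
  -- make that of the combination nonpositive.
  weak-transfer : ∀ {x} → Weak F x → Weak G x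
  weak-transfer {x} weak {v} v<m = ℤ.≮⇒≥ λ gx<0 → ℤ.<-irrefl refl (begin-strict
      0ℤ                                   <⟨ strict-G v<m ⟩
      gap G v y                            ≡⟨ linear G v b x 1ℤ (unit F) ⟩
      b ℤ.* gap G v x ℤ.+ 1ℤ ℤ.* b         ≡⟨ factor b (gap G v x) ⟩
      b ℤ.* (1ℤ ℤ.+ gap G v x)             ≤⟨ ℤ.*-monoˡ-≤-nonNeg b {{ℤ.nonNegative b≥0}} (ℤ.i<j⇒suc[i]≤j gx<0) ⟩
      b ℤ.* 0ℤ                             ≡⟨ ℤ.*-zeroʳ b ⟩
      0ℤ                                   ∎)
    where
    open ℤ.≤-Reasoning
    factor : ∀ b p → b ℤ.* p ℤ.+ 1ℤ ℤ.* b ≡ b ℤ.* (1ℤ ℤ.+ p)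
    factor = ℤ-Ring.solve-∀
    b = gap G v (unit F)
    b≥0 : 0ℤ ℤ.≤ b
    b≥0 = ℤ.<⇒≤ (F⇒G (λ w<m → subst (0ℤ ℤ.<_) (sym (gap-unit F w<m)) (ℤ.+<+ (s≤s z≤n))) v<m)
    y = λ l → b ℤ.* x l ℤ.+ 1ℤ ℤ.* unit F l
    strict-G : Strict G y
    strict-G = F⇒G λ {w} w<m → ℤ.suc[i]≤j⇒i<j (begin
      1ℤ                                           ≡⟨ sym (ℤ.+-identityˡ 1ℤ) ⟩
      0ℤ ℤ.+ 1ℤ                                    ≤⟨ ℤ.+-monoˡ-≤ 1ℤ (*-nonneg b≥0 (weak w<m)) ⟩
      b ℤ.* gap F w x ℤ.+ 1ℤ                       ≡⟨ cong (λ t → b ℤ.* gap F w x ℤ.+ 1ℤ ℤ.* t) (sym (gap-unit F w<m)) ⟩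
      b ℤ.* gap F w x ℤ.+ 1ℤ ℤ.* gap F w (unit F)  ≡⟨ sym (linear F w b x 1ℤ (unit F)) ⟩
      gap F w y                                    ∎)

module _ {m : ℕ} (F G : Gaps m) (F⇒G : ∀ {x} → Strict F x → Strict G x) (G⇒F : ∀ {x} → Strict G x → Strict F x) where

  private
    F→G : ∀ {x} → Weak F x → Weak G x
    F→G = weak-transfer F G F⇒G
    G→F : ∀ {x} → Weak G x → Weak F x
    G→F = weak-transfer G F G⇒F

  -- A point in the relative interior of the facet v of one cone lies on some facet of the other.
  facet : ∀ {v} → v < m → ∃ λ q → q < m × (∀ y → gap F v y ≡ 0ℤ → gap G q y ≡ 0ℤ)
  facet {v} v<m = case ℕ.anyUpTo? (λ q → gap G q x ℤ.≟ 0ℤ) m of λ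
    { (yes (q , q<m , gq≡0)) → q , q<m , vanish q<m gq≡0
    ; (no none) → contradiction (G⇒F (strict none) v<m)
        (λ fx>0 → ℤ.<-irrefl refl (subst (0ℤ ℤ.<_) (trans (gap-x v<m) (cong (λ t → 1ℤ ℤ.- t) (δ-refl v))) fx>0)) }
    where
    x = proj₁ (realize F (λ w → 1ℤ ℤ.- δ v w))
    gap-x : ∀ {w} → w < m → gap F w x ≡ 1ℤ ℤ.- δ v w
    gap-x = proj₂ (realize F (λ w → 1ℤ ℤ.- δ v w))
    gap-x-≢ : ∀ {w} → w < m → w ≢ v → gap F w x ≡ 1ℤ
    gap-x-≢ w<m w≢v = trans (gap-x w<m) (cong (λ t → 1ℤ ℤ.- t) (δ-≢ w≢v))
    gap-x-≡ : gap F v x ≡ 0ℤ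
    gap-x-≡ = trans (gap-x v<m) (cong (λ t → 1ℤ ℤ.- t) (δ-refl v))

    weak-x : Weak F x
    weak-x {w} w<m with w ≟ v
    ... | yes refl = ℤ.≤-reflexive (sym gap-x-≡)
    ... | no w≢v   = subst (0ℤ ℤ.≤_) (sym (gap-x-≢ w<m w≢v)) (+≤+ z≤n)

    strict : ¬ (∃ λ q → q < m × gap G q x ≡ 0ℤ) → Strict G x
    strict none {q} q<m = ℤ.≤∧≢⇒< (F→G weak-x q<m) (λ 0≡ → none (q , q<m , sym 0≡))

    -- For large `b` both `b x + y` and `b x - y` lie in the weak cone of `F`: their gap `v` is 0
    -- and in every other gap `b` dominates. Hence both lie in that of `G`; since gap `q` vanishes
    -- at `x`, it has to vanish at `y`.
    vanish : ∀ {q} → q < m → gap G q x ≡ 0ℤ → ∀ y → gap F v y ≡ 0ℤ → gap G q y ≡ 0ℤ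
    vanish {q} q<m gq≡0 y fy≡0 = ℤ.≤-antisym
      (subst (ℤ._≤ 0ℤ) (ℤ.neg-involutive (gap G q y)) (ℤ.neg-mono-≤ (subst (0ℤ ℤ.≤_) (ℤ.-1*i≡-i (gap G q y)) (nonneg ℤ.-1ℤ refl))))
      (subst (0ℤ ℤ.≤_) (ℤ.*-identityˡ (gap G q y)) (nonneg 1ℤ refl))
      where
      b = proj₁ (bounded m (λ w → gap F w y))
      nonneg : ∀ c → ℤ.∣ c ∣ ≡ 1 → 0ℤ ℤ.≤ c ℤ.* gap G q y
      nonneg c ∣c∣≡1 = subst (0ℤ ℤ.≤_)
        (trans (linear G q (+ b) x c y)
          (trans (cong (λ t → + b ℤ.* t ℤ.+ c ℤ.* gap G q y) gq≡0)
            (trans (cong (ℤ._+ c ℤ.* gap G q y) (ℤ.*-zeroʳ (+ b))) (ℤ.+-identityˡ _))))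
        (F→G weak q<m)
        where
        weak : Weak F (λ l → + b ℤ.* x l ℤ.+ c ℤ.* y l)
        weak {w} w<m with w ≟ v
        ... | yes refl = ℤ.≤-reflexive (sym (trans (linear F v (+ b) x c y)
          (cong₂ ℤ._+_ (trans (cong (+ b ℤ.*_) gap-x-≡) (ℤ.*-zeroʳ (+ b))) (trans (cong (c ℤ.*_) fy≡0) (ℤ.*-zeroʳ c)))))
        ... | no w≢v = subst (0ℤ ℤ.≤_)
          (sym (trans (linear F w (+ b) x c y)
            (cong (ℤ._+ c ℤ.* gap F w y) (trans (cong (+ b ℤ.*_) (gap-x-≢ w<m w≢v)) (ℤ.*-identityʳ (+ b))))))
          (+-nonneg (c ℤ.* gap F w y) (subst (_≤ b)
            (sym (trans (ℤ.abs-* c (gap F w y)) (trans (cong (_* ℤ.∣ gap F w y ∣) ∣c∣≡1) (ℕ.*-identityˡ _))))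
            (proj₂ (bounded m (λ w → gap F w y)) w<m)))

  -- The total is the maximal length of a decomposition into nonzero integer points of the cone,
  -- hence determined by the cone.
  total-≤ : ∀ N {x} → Weak G x → total G x ℤ.≤ + N → total G x ℤ.≤ total F x
  total-≤ zero weak le = ℤ.≤-trans le (total-nonneg F (G→F weak))
  total-≤ (suc N) {x} weak le with ℕ.anyUpTo? (λ w → 0ℤ ℤ.<? gap G w x) m
  ... | no none = ℤ.≤-trans
    (subst (total G x ℤ.≤_) (sumTo-zero m) (sumTo-mono m λ {w} w<m → ℤ.≮⇒≥ λ lt → none (w , w<m , lt)))
    (total-nonneg F (G→F weak))
  -- Split off `y`, the generator of the ray of `G` dual to gap `w`. Its `G`-total is 1 and its
  -- `F`-total an integer at least 1, so induction applies to the remainder `z`.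
  ... | yes (w , w<m , gw>0) = subst₂ ℤ._≤_ (split G) (split F)
    (ℤ.+-mono-≤ (total-≤ N weak-z total-z≤N) (subst (ℤ._≤ total F y) (sym total-y) total-y≥1))
    where
    y = proj₁ (realize G (δ w))
    gap-y : ∀ {u} → u < m → gap G u y ≡ δ w u
    gap-y = proj₂ (realize G (δ w))
    weak-y : Weak G y
    weak-y {u} u<m = subst (0ℤ ℤ.≤_) (sym (gap-y u<m)) (δ-nonneg w u)
    total-y : total G y ≡ 1ℤ
    total-y = trans (sumTo-cong m gap-y) (sumTo-δ w<m)

    total-y≥1 : 1ℤ ℤ.≤ total F y
    total-y≥1 with ℕ.anyUpTo? (λ u → 0ℤ ℤ.<? gap F u y) m
    ... | yes (u , u<m , fu>0) = subst (ℤ._≤ total F y) (sumTo-δ u<m) (sumTo-mono m λ {k} k<m → dominated k<m)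
      where
      dominated : ∀ {k} → k < m → δ u k ℤ.≤ gap F k y
      dominated {k} k<m with k ≟ u
      ... | yes refl = ℤ.i<j⇒suc[i]≤j fu>0
      ... | no _     = G→F weak-y k<m
    -- Without a positive `F`-gap, `-y` would also lie in the weak cone of `F`, hence of `G`,
    -- although its gap `w` is -1.
    ... | no none = contradiction (F→G weak-neg w<m) (λ le → ℤ.<⇒≱ (ℤ.-<+ {0} {0}) (subst (0ℤ ℤ.≤_)
        (trans (linear G w ℤ.-1ℤ y 0ℤ y) (cong (λ t → ℤ.-1ℤ ℤ.* t ℤ.+ 0ℤ ℤ.* t) (trans (gap-y w<m) (δ-refl w)))) le))
      where
      weak-neg : Weak F (λ l → ℤ.-1ℤ ℤ.* y l ℤ.+ 0ℤ ℤ.* y l)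
      weak-neg {u} u<m = subst (0ℤ ℤ.≤_)
        (sym (trans (linear F u ℤ.-1ℤ y 0ℤ y) (trans (ℤ.+-identityʳ _) (ℤ.-1*i≡-i (gap F u y)))))
        (ℤ.neg-mono-≤ (ℤ.≮⇒≥ λ lt → none (u , u<m , lt)))

    z = λ l → 1ℤ ℤ.* x l ℤ.+ ℤ.-1ℤ ℤ.* y l
    cancel : ∀ p q → 1ℤ ℤ.* p ℤ.+ ℤ.-1ℤ ℤ.* q ℤ.+ q ≡ p
    cancel = ℤ-Ring.solve-∀
    sub : ∀ p q → 1ℤ ℤ.* p ℤ.+ ℤ.-1ℤ ℤ.* q ≡ p ℤ.- q
    sub = ℤ-Ring.solve-∀
    split : ∀ H → total H z ℤ.+ total H y ≡ total H x
    split H = trans (cong (ℤ._+ total H y) (total-linear H 1ℤ x ℤ.-1ℤ y)) (cancel (total H x) (total H y))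

    weak-z : Weak G z
    weak-z {u} u<m = subst (0ℤ ℤ.≤_) (sym (trans (linear G u 1ℤ x ℤ.-1ℤ y) (sub (gap G u x) (gap G u y))))
      (ℤ.i≤j⇒0≤j-i (subst (ℤ._≤ gap G u x) (sym (gap-y u<m)) dominated))
      where
      dominated : δ w u ℤ.≤ gap G u x
      dominated with u ≟ w
      ... | yes refl = ℤ.i<j⇒suc[i]≤j gw>0
      ... | no _     = weak u<m

    total-z≤N : total G z ℤ.≤ + N
    total-z≤N = subst (ℤ._≤ + N)
      (sym (trans (total-linear G 1ℤ x ℤ.-1ℤ y) (trans (sub (total G x) (total G y)) (cong (λ t → total G x ℤ.- t) total-y))))
      (ℤ.+-monoˡ-≤ ℤ.-1ℤ le)

module _ {m : ℕ} (F G : Gaps m) (F⇒G : ∀ {x} → Strict F x → Strict G x) (G⇒F : ∀ {x} → Strict G x → Strict F x) where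

  private
    total-≡-weak : ∀ {x} → Weak F x → total F x ≡ total G x
    total-≡-weak {x} weak = ℤ.≤-antisym
      (total-≤ G F G⇒F F⇒G ℤ.∣ total F x ∣ weak (ℤ.≤-reflexive (sym (ℤ.0≤i⇒+∣i∣≡i (total-nonneg F weak)))))
      (total-≤ F G F⇒G G⇒F ℤ.∣ total G x ∣ weakG (ℤ.≤-reflexive (sym (ℤ.0≤i⇒+∣i∣≡i (total-nonneg G weakG)))))
      where
      weakG : Weak G x
      weakG = weak-transfer F G F⇒G weak

  -- A large multiple of `unit F` moves any vector into the cone, where the totals agree; they agree
  -- at `unit F` too, so linearity cancels the multiple.
  total-≡ : ∀ y → total F y ≡ total G y
  total-≡ y = trans (sym (ℤ.*-identityˡ _)) (trans (ℤ-Group.∙-cancelˡ (+ b ℤ.* total F s) _ _ (begin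
      + b ℤ.* total F s ℤ.+ 1ℤ ℤ.* total F y  ≡⟨ sym (total-linear F (+ b) s 1ℤ y) ⟩
      total F x                               ≡⟨ total-≡-weak weak-x ⟩
      total G x                               ≡⟨ total-linear G (+ b) s 1ℤ y ⟩
      + b ℤ.* total G s ℤ.+ 1ℤ ℤ.* total G y  ≡⟨ cong (λ t → + b ℤ.* t ℤ.+ 1ℤ ℤ.* total G y) (sym (total-≡-weak weak-s)) ⟩
      + b ℤ.* total F s ℤ.+ 1ℤ ℤ.* total G y  ∎)) (ℤ.*-identityˡ _))
    where
    open ≡-Reasoning
    s = unit F
    b = proj₁ (bounded m (λ w → gap F w y))
    x = λ l → + b ℤ.* s l ℤ.+ 1ℤ ℤ.* y l
    weak-s : Weak F s
    weak-s w<m = subst (0ℤ ℤ.≤_) (sym (gap-unit F w<m)) (+≤+ z≤n)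
    weak-x : Weak F x
    weak-x {w} w<m = subst (0ℤ ℤ.≤_)
      (sym (trans (linear F w (+ b) s 1ℤ y) (cong₂ ℤ._+_
        (trans (cong (+ b ℤ.*_) (gap-unit F w<m)) (ℤ.*-identityʳ (+ b))) (ℤ.*-identityˡ (gap F w y)))))
      (+-nonneg (gap F w y) (proj₂ (bounded m (λ w → gap F w y)) w<m))

-- The support of `D` is an interval. Supports suffice because proportional functionals share them,
-- whatever the sign and scale.
Convex : (ℕ → ℤ) → Set
Convex D = ∀ {i j k} → i < j → j < k → D i ≢ 0ℤ → D k ≢ 0ℤ → D j ≢ 0ℤ

convex-cong : ∀ {D E} → (∀ l → D l ≡ E l) → Convex D → Convex E
convex-cong eq convex {i} {j} {k} i<j j<k Ei Ek Ej≡0 =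
  convex i<j j<k (Ei ∘ trans (sym (eq i))) (Ek ∘ trans (sym (eq k))) (trans (eq j) Ej≡0)

module _ {m : ℕ} (F G : Gaps m) (F⇒G : ∀ {x} → Strict F x → Strict G x) (G⇒F : ∀ {x} → Strict G x → Strict F x) where

  -- The labels on which a facet of one cone is nonzero are those on which some facet of the other is.
  facet-convex : (∀ q → q < m → Convex (λ l → gap G q (δ l))) → (∀ q → q < m → ∃ λ l → gap G q (δ l) ≢ 0ℤ) →
                 ∀ {v} → v < m → Convex (λ l → gap F v (δ l))
  facet-convex convex nonzero {v} v<m {i} {j} {k} i<j j<k ai≢0 ak≢0 aj≡0
    with facet F G F⇒G G⇒F v<m
  ... | q , q<m , vanish with nonzero q q<m
  ... | l₀ , g₀≢0 = convex q q<m i<j j<k (support i ai≢0) (support k ak≢0) (vanish (δ j) aj≡0)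
    where
    a g : ℕ → ℤ
    a l = gap F v (δ l)
    g l = gap G q (δ l)

    swap-cancel : ∀ a b → a ℤ.* b ℤ.+ (ℤ.- b) ℤ.* a ≡ 0ℤ
    swap-cancel = ℤ-Ring.solve-∀
    neg-* : ∀ a b c d → a ℤ.* b ℤ.+ (ℤ.- c) ℤ.* d ≡ a ℤ.* b ℤ.- c ℤ.* d
    neg-* = ℤ-Ring.solve-∀

    -- The combination `a l′ δ l - a l δ l′` is killed by gap `v` of `F`, hence by gap `q` of `G`.
    proportional : ∀ l l′ → a l′ ℤ.* g l ≡ a l ℤ.* g l′
    proportional l l′ = ℤ.i-j≡0⇒i≡j (a l′ ℤ.* g l) (a l ℤ.* g l′)
      (trans (sym (trans (linear G q (a l′) (δ l) (ℤ.- a l) (δ l′)) (neg-* (a l′) (g l) (a l) (g l′))))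
        (vanish (λ t → a l′ ℤ.* δ l t ℤ.+ (ℤ.- a l) ℤ.* δ l′ t)
          (trans (linear F v (a l′) (δ l) (ℤ.- a l) (δ l′)) (swap-cancel (a l′) (a l)))))

    support : ∀ l → a l ≢ 0ℤ → g l ≢ 0ℤ
    support l al≢0 gl≡0 with ℤ.i*j≡0⇒i≡0∨j≡0 (a l) (trans (sym (proportional l l₀)) (trans (cong (a l₀ ℤ.*_) gl≡0) (ℤ.*-zeroʳ (a l₀))))
    ... | inj₁ al≡0  = al≢0 al≡0
    ... | inj₂ gl₀≡0 = g₀≢0 gl₀≡0

-- The cone of an arrangement

-- The labels of the steps leading from the start of the walk to the point of value `v`; their sum
-- is its height above the start.
before : ℕ → List ℕ → List ℕ → List ℕ
before v []      es       = []
before v (a ∷ u) []       = []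
before v (a ∷ u) (e ∷ es) with v ≟ a
... | yes _ = []
... | no _  = e ∷ before v u es

before-here : ∀ v u es → before v (v ∷ u) es ≡ []
before-here v u []       = refl
before-here v u (e ∷ es) with v ≟ v
... | yes _  = refl
... | no v≢v = contradiction refl v≢v

before-there : ∀ {v a} u e es → v ≢ a → before v (a ∷ u) (e ∷ es) ≡ e ∷ before v u es
before-there {v} {a} u e es v≢a with v ≟ a
... | yes v≡a = contradiction v≡a v≢a
... | no _    = refl

before-⊆ : ∀ {l} v u es → l ∈ before v u es → l ∈ es
before-⊆ v (a ∷ u) (e ∷ es) l∈ with v ≟ a
before-⊆ v (a ∷ u) (e ∷ es) (here l≡e) | no _ = here l≡e
before-⊆ v (a ∷ u) (e ∷ es) (there l∈) | no _ = there (before-⊆ v u es l∈)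

before-unique : ∀ v u {es} → Unique es → Unique (before v u es)
before-unique v []      uniq = []
before-unique v (a ∷ u) []   = []
before-unique v (a ∷ u) {e ∷ es} (e∉ ∷ uniq) with v ≟ a
... | yes _ = []
... | no _  = All.tabulate (λ l∈ → All.lookup e∉ (before-⊆ v u es l∈)) ∷ before-unique v u uniq

-- The source of the interval property: in the sorted arrangement the labels before a value form an
-- initial segment, and two initial segments differ by an interval. The general `f` lets the
-- recursion pass to `f ∘ suc`.
before-applyUpTo : ∀ v u (f : ℕ → ℕ) m → ∃ λ p → before v u (applyUpTo f m) ≡ applyUpTo f p
before-applyUpTo v []      f m       = 0 , refl
before-applyUpTo v (a ∷ u) f zero    = 0 , refl
before-applyUpTo v (a ∷ u) f (suc m) with v ≟ a
... | yes _ = 0 , refl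
... | no _  with before-applyUpTo v u (f ∘ suc) m
... | p , eq = suc p , cong (f 0 ∷_) eq

Σ[_] : (ℕ → ℤ) → List ℕ → ℤ
Σ[ x ] []       = 0ℤ
Σ[ x ] (l ∷ ls) = x l ℤ.+ Σ[ x ] ls

Σ-cong : ∀ {x y} ls → (∀ {l} → l ∈ ls → x l ≡ y l) → Σ[ x ] ls ≡ Σ[ y ] ls
Σ-cong []       eq = refl
Σ-cong (l ∷ ls) eq = cong₂ ℤ._+_ (eq (here refl)) (Σ-cong ls (eq ∘ there))

Σ-linear : ∀ b x c y ls → Σ[ (λ l → b ℤ.* x l ℤ.+ c ℤ.* y l) ] ls ≡ b ℤ.* Σ[ x ] ls ℤ.+ c ℤ.* Σ[ y ] ls
Σ-linear b x c y []       = sym (cong₂ ℤ._+_ (ℤ.*-zeroʳ b) (ℤ.*-zeroʳ c))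
Σ-linear b x c y (l ∷ ls) = trans (cong (λ t → (b ℤ.* x l ℤ.+ c ℤ.* y l) ℤ.+ t) (Σ-linear b x c y ls))
  (combine b c (x l) (y l) (Σ[ x ] ls) (Σ[ y ] ls))

Σ-δ-∉ : ∀ {l} ls → l ∉ ls → Σ[ δ l ] ls ≡ 0ℤ
Σ-δ-∉ []       l∉ = refl
Σ-δ-∉ (k ∷ ls) l∉ = cong₂ ℤ._+_ (δ-≢ (l∉ ∘ here ∘ sym)) (Σ-δ-∉ ls (l∉ ∘ there))

Σ-δ-∈ : ∀ {l ls} → Unique ls → l ∈ ls → Σ[ δ l ] ls ≡ 1ℤ
Σ-δ-∈ {l} {_ ∷ ls} (l∉ ∷ uniq) (here refl) =
  cong₂ ℤ._+_ (δ-refl l) (Σ-δ-∉ ls λ l∈ → All.lookup l∉ l∈ refl)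
Σ-δ-∈ (k∉ ∷ uniq) (there l∈) = cong₂ ℤ._+_ (δ-≢ (All.lookup k∉ l∈)) (Σ-δ-∈ uniq l∈)

height : List ℕ → List ℕ → ℕ → (ℕ → ℤ) → ℤ
height es u v x = Σ[ x ] (before v u es)

-- Recovers steps from prescribed heights `H`. They are integral when `H` is, which provides the
-- integer solutions demanded by `realize`.
stepFrom : (ℕ → ℤ) → List ℕ → List ℕ → ℕ → ℤ
stepFrom H (a ∷ b ∷ u) (e ∷ es) l with l ≟ e
... | yes _ = H b ℤ.- H a
... | no _  = stepFrom H (b ∷ u) es l
stepFrom H _ _ l = 0ℤ

stepFrom-head : ∀ H a b u e es → stepFrom H (a ∷ b ∷ u) (e ∷ es) e ≡ H b ℤ.- H a
stepFrom-head H a b u e es with e ≟ e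
... | yes _  = refl
... | no e≢e = contradiction refl e≢e

stepFrom-tail : ∀ H a b u e es {l} → l ≢ e → stepFrom H (a ∷ b ∷ u) (e ∷ es) l ≡ stepFrom H (b ∷ u) es l
stepFrom-tail H a b u e es {l} l≢e with l ≟ e
... | yes l≡e = contradiction l≡e l≢e
... | no _    = refl

telescope : ∀ a b c → (b ℤ.- a) ℤ.+ (c ℤ.- b) ≡ c ℤ.- a
telescope = ℤ-Ring.solve-∀

height-stepFrom : ∀ H a u es → Unique es → length (a ∷ u) ≡ suc (length es) → ∀ {w} → w ∈ a ∷ u →
                  height es (a ∷ u) w (stepFrom H (a ∷ u) es) ≡ H w ℤ.- H a
height-stepFrom H a u es uniq len {w} w∈ with w ≟ a
... | yes refl = trans (cong Σ[ stepFrom H (a ∷ u) es ] (before-here w u es)) (sym (ℤ.+-inverseʳ (H w)))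
height-stepFrom H a u es uniq len (here w≡a) | no w≢a = contradiction w≡a w≢a
height-stepFrom H a (b ∷ u) (e ∷ es) (e∉ ∷ uniq) len {w} (there w∈) | no w≢a = begin
  Σ[ x ] (before w (a ∷ b ∷ u) (e ∷ es))
    ≡⟨ cong Σ[ x ] (before-there (b ∷ u) e es w≢a) ⟩
  x e ℤ.+ Σ[ x ] (before w (b ∷ u) es)
    ≡⟨ cong₂ ℤ._+_ (stepFrom-head H a b u e es) (trans
         (Σ-cong (before w (b ∷ u) es) λ l∈ → stepFrom-tail H a b u e es
           (λ l≡e → All.lookup e∉ (before-⊆ w (b ∷ u) es l∈) (sym l≡e)))
         (height-stepFrom H b u es uniq (ℕ.suc-injective len) w∈)) ⟩
  (H b ℤ.- H a) ℤ.+ (H w ℤ.- H b)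
    ≡⟨ telescope (H a) (H b) (H w) ⟩
  H w ℤ.- H a ∎
  where
  open ≡-Reasoning
  x = stepFrom H (a ∷ b ∷ u) (e ∷ es)

difference : ∀ b c p q r s → (b ℤ.* p ℤ.+ c ℤ.* q) ℤ.- (b ℤ.* r ℤ.+ c ℤ.* s) ≡ b ℤ.* (p ℤ.- r) ℤ.+ c ℤ.* (q ℤ.- s)
difference = ℤ-Ring.solve-∀

-- Gap v lies between the heights of the values v + 1 and v + 2.
gaps : ∀ {m es u} → Valid m es u → Gaps m
gaps {m} {es} {u} valid = record
  { gap     = λ v x → h (suc (suc v)) x ℤ.- h (suc v) x
  ; linear  = λ v b x c y → trans
      (cong₂ ℤ._-_ (Σ-linear b x c y (before (suc (suc v)) u es)) (Σ-linear b x c y (before (suc v) u es)))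
      (difference b c (h (suc (suc v)) x) (h (suc (suc v)) y) (h (suc v) x) (h (suc v) y))
  ; realize = solve u refl
  }
  where
  h = height es u
  cancel : ∀ s t a → (s ℤ.+ t ℤ.- a) ℤ.- (s ℤ.- a) ≡ t
  cancel = ℤ-Ring.solve-∀
  solve : ∀ u′ → u ≡ u′ → ∀ (t : ℕ → ℤ) → ∃ λ x → ∀ {v} → v < m → h (suc (suc v)) x ℤ.- h (suc v) x ≡ t v
  solve []       refl t = case length-values valid of λ ()
  solve (a ∷ u′) refl t = stepFrom H u es , λ {v} v<m → trans
      (cong₂ ℤ._-_ (height-at (s≤s z≤n , s≤s v<m)) (height-at (s≤s z≤n , ℕ.m≤n⇒m≤1+n v<m)))
      (cancel (sumTo v t) (t v) (H a))
    where
    -- Prefix sums of the prescribed gaps, shifted by one because values start at 1: the heights of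
    -- `v + 1` and `v + 2` then differ by `t v`.
    H : ℕ → ℤ
    H zero    = 0ℤ
    H (suc v) = sumTo v t
    height-at : ∀ {v} → 1 ≤ v × v ≤ suc m → h v (stepFrom H u es) ≡ H v ℤ.- H a
    height-at v-in = height-stepFrom H a u′ es (unique-labels valid) (sym (labels-length valid))
      (Equivalence.from (values valid _) v-in)

i<j⇒0<j-i : ∀ {i j} → i ℤ.< j → 0ℤ ℤ.< j ℤ.- i
i<j⇒0<j-i {i} {j} i<j = subst (ℤ._< j ℤ.- i) (ℤ.+-inverseʳ i) (ℤ.+-monoˡ-< (ℤ.- i) i<j)

0<j-i⇒i<j : ∀ {i j} → 0ℤ ℤ.< j ℤ.- i → i ℤ.< j
0<j-i⇒i<j {i} {j} lt = subst₂ ℤ._<_ (ℤ.+-identityˡ i) (cancel i j) (ℤ.+-monoˡ-< i lt)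
  where
  cancel : ∀ i j → j ℤ.- i ℤ.+ i ≡ j
  cancel = ℤ-Ring.solve-∀

-- Integer vectors as rational walks

ι : ℤ → ℚ
ι i = i ℚ./ 1

toℚᵘ-ι : ∀ i → ℚ.toℚᵘ (ι i) ℚᵘ.≃ ℚᵘ.mkℚᵘ i 0
toℚᵘ-ι i = ℚ.toℚᵘ-fromℚᵘ (ℚᵘ.mkℚᵘ i 0)

ι-+ : ∀ i j → ι (i ℤ.+ j) ≡ ι i +ℚ ι j
ι-+ i j = ℚ.toℚᵘ-injective (begin
  ℚ.toℚᵘ (ι (i ℤ.+ j))                     ≈⟨ toℚᵘ-ι (i ℤ.+ j) ⟩
  ℚᵘ.mkℚᵘ (i ℤ.+ j) 0                      ≈⟨ ℚᵘ.*≡* (cross i j) ⟩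
  ℚᵘ.mkℚᵘ i 0 ℚᵘ.+ ℚᵘ.mkℚᵘ j 0             ≈⟨ ℚᵘₚ.≃-sym (ℚᵘₚ.+-cong (toℚᵘ-ι i) (toℚᵘ-ι j)) ⟩
  ℚ.toℚᵘ (ι i) ℚᵘ.+ ℚ.toℚᵘ (ι j)           ≈⟨ ℚᵘₚ.≃-sym (ℚ.toℚᵘ-homo-+ (ι i) (ι j)) ⟩
  ℚ.toℚᵘ (ι i +ℚ ι j)                      ∎)
  where
  open ℚᵘₚ.≃-Reasoning
  cross : ∀ i j → (i ℤ.+ j) ℤ.* 1ℤ ≡ (i ℤ.* 1ℤ ℤ.+ j ℤ.* 1ℤ) ℤ.* 1ℤ
  cross = ℤ-Ring.solve-∀

ι-mono-< : ∀ {i j} → i ℤ.< j → ι i <ℚ ι j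
ι-mono-< {i} {j} i<j = ℚ.toℚᵘ-cancel-< (ℚᵘₚ.<-respˡ-≃ (ℚᵘₚ.≃-sym (toℚᵘ-ι i))
  (ℚᵘₚ.<-respʳ-≃ (ℚᵘₚ.≃-sym (toℚᵘ-ι j)) (ℚᵘ.*<* (subst₂ ℤ._<_ (sym (ℤ.*-identityʳ i)) (sym (ℤ.*-identityʳ j)) i<j))))

ι-cancel-< : ∀ {i j} → ι i <ℚ ι j → i ℤ.< j
ι-cancel-< {i} {j} lt = ℤ.≰⇒> λ j≤i → case ℤ.<-cmp i j of λ
  { (tri< i<j _ _)  → ℤ.<⇒≱ i<j j≤i
  ; (tri≈ _ refl _) → ℚ.<-irrefl refl lt
  ; (tri> _ _ j<i)  → ℚ.<-asym lt (ι-mono-< j<i) }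

ι-injective : ∀ {i j} → ι i ≡ ι j → i ≡ j
ι-injective {i} {j} eq with ℤ.<-cmp i j
... | tri< i<j _ _ = contradiction (ι-mono-< i<j) (ℚ.<-irrefl eq)
... | tri≈ _ i≡j _ = i≡j
... | tri> _ _ j<i = contradiction (ι-mono-< j<i) (ℚ.<-irrefl (sym eq))

walk-heights : ∀ z (x : ℕ → ℤ) es u → Unique u → suc (length es) ≡ length u →
               map (λ v → z +ℚ ι (height es u v x)) u ≡ walk z (map (ι ∘ x) es)
walk-heights z x []       (a ∷ []) uniq len = cong [_] (ℚ.+-identityʳ z)
walk-heights z x (e ∷ es) (a ∷ u)  (a∉ ∷ uniq) len = cong₂ _∷_
  (trans (cong (λ b → z +ℚ ι (Σ[ x ] b)) (before-here a u (e ∷ es))) (ℚ.+-identityʳ z))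
  (trans (List.map-cong-local (All.tabulate λ {v} v∈ → begin
      z +ℚ ι (Σ[ x ] (before v (a ∷ u) (e ∷ es)))
        ≡⟨ cong (λ b → z +ℚ ι (Σ[ x ] b)) (before-there u e es (λ v≡a → All.lookup a∉ v∈ (sym v≡a))) ⟩
      z +ℚ ι (x e ℤ.+ height es u v x)
        ≡⟨ cong (z +ℚ_) (ι-+ (x e) (height es u v x)) ⟩
      z +ℚ (ι (x e) +ℚ ι (height es u v x))
        ≡⟨ sym (ℚ.+-assoc z (ι (x e)) (ι (height es u v x))) ⟩
      z +ℚ ι (x e) +ℚ ι (height es u v x) ∎))
    (walk-heights (z +ℚ ι (x e)) x es u uniq (ℕ.suc-injective len)))
  where open ≡-Reasoning

increasing : ∀ {m} (h : ℕ → ℤ) → (∀ {v} → v < m → h v ℤ.< h (suc v)) → ∀ {v w} → v < w → w ≤ m → h v ℤ.< h w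
increasing h lt {v} {suc w} v<1+w w<m with ℕ.m≤n⇒m<n∨m≡n (s≤s⁻¹ v<1+w)
... | inj₁ v<w  = ℤ.<-trans (increasing h lt v<w (ℕ.<⇒≤ w<m)) (lt w<m)
... | inj₂ refl = lt w<m

module _ {m : ℕ} {es u : List ℕ} (valid : Valid m es u) where

  private
    h : ℕ → (ℕ → ℤ) → ℤ
    h = height es u

    points : ℚ → (ℕ → ℤ) → List Point
    points z x = map (λ v → z +ℚ ι (h v x) , v) u

    heights≡ : ∀ z x → map proj₁ (points z x) ≡ walk z (map (ι ∘ x) es)
    heights≡ z x = trans (sym (List.map-∘ u)) (walk-heights z x es u (unique-values valid) (labels-length valid))

    word≡ : ∀ z x → map proj₂ (points z x) ≡ u
    word≡ z x = trans (sym (List.map-∘ u)) (List.map-id u)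

  ordered⇒strict : ∀ {x} → Ordered (map (ι ∘ x) es) u → Strict (gaps valid) x
  ordered⇒strict {x} (z , ps , walk≡ , u≡ , mono) {v} v<m
    with refl ← points-≡ ps (points z x) (trans walk≡ (sym (heights≡ z x))) (trans u≡ (sym (word≡ z x)))
    = i<j⇒0<j-i {h (suc v) x} {h (suc (suc v)) x} (ι-cancel-< (+ℚ-cancelˡ-< z (_≼_.strict (mono
        (point∈ (s≤s z≤n , ℕ.m≤n⇒m≤1+n v<m)) (point∈ (s≤s z≤n , s≤s v<m))) (ℕ.n<1+n (suc v)))))
    where
    point∈ : ∀ {w} → 1 ≤ w × w ≤ suc m → (z +ℚ ι (h w x) , w) ∈ points z x
    point∈ {w} w-in = Mem.∈-map⁺ (λ v → z +ℚ ι (h v x) , v) (Equivalence.from (values valid w) w-in)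

  strict⇒ordered : ∀ {x} → Strict (gaps valid) x → Ordered (map (ι ∘ x) es) u
  strict⇒ordered {x} strict = 0ℚ , points 0ℚ x , heights≡ 0ℚ x , word≡ 0ℚ x , mono
    where
    h-increasing : ∀ {v w} → v ∈ u → w ∈ u → v < w → 0ℚ +ℚ ι (h v x) <ℚ 0ℚ +ℚ ι (h w x)
    h-increasing {v} {w} v∈ w∈ v<w with Equivalence.to (values valid v) v∈ | Equivalence.to (values valid w) w∈ | v<w
    ... | s≤s _ , _ | s≤s _ , w≤ | s≤s v<w′ = ℚ.+-monoʳ-< 0ℚ (ι-mono-<
      (increasing (λ k → h (suc k) x) (λ {k} k<m → 0<j-i⇒i<j {h (suc k) x} (strict k<m)) v<w′ (s≤s⁻¹ w≤)))
    mono : Monotone (points 0ℚ x)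
    mono p∈ q∈ with Mem.∈-map⁻ (λ v → 0ℚ +ℚ ι (h v x) , v) p∈ | Mem.∈-map⁻ (λ v → 0ℚ +ℚ ι (h v x) , v) q∈
    ... | v , v∈ , refl | w , w∈ , refl
      = (λ v≤w → case ℕ.m≤n⇒m<n∨m≡n v≤w of λ
          { (inj₁ v<w) → ℚ.<⇒≤ (h-increasing v∈ w∈ v<w) ; (inj₂ refl) → ℚ.≤-refl })
      , h-increasing v∈ w∈

-- `Same` speaks of rational steps; its integer instances already identify the integer points of the
-- two open cones.
same⇒strict : ∀ {m es u es′ u′} (valid : Valid m es u) (valid′ : Valid m es′ u′) → Same es u es′ u′ →
              ∀ {x} → Strict (gaps valid) x → Strict (gaps valid′) x
same⇒strict valid valid′ same {x} strict =
  ordered⇒strict valid′ (Equivalence.to (same (ι ∘ x)) (strict⇒ordered valid strict))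

-- The telescoped sum is the functional of the pair 1, `m + 1`, the values adjacent across the wrap.
total-gaps : ∀ {es u} m x → sumTo m (λ v → height es u (suc (suc v)) x ℤ.- height es u (suc v) x)
                            ≡ height es u (suc m) x ℤ.- height es u 1 x
total-gaps {es} {u} zero    x = sym (ℤ.+-inverseʳ (height es u 1 x))
total-gaps {es} {u} (suc m) x = trans (cong (ℤ._+ (h (suc (suc m)) ℤ.- h (suc m))) (total-gaps {es} {u} m x))
  (telescope (h 1) (h (suc m)) (h (suc (suc m))))
  where
  h : ℕ → ℤ
  h v = height es u v x

-- Intervals of labels between adjacent values

initial : ℕ → ℕ → ℤ
initial p l = Σ[ δ l ] (upTo p)

initial-< : ∀ {p l} → l < p → initial p l ≡ 1ℤ
initial-< {p} l<p = Σ-δ-∈ (Unique.upTo⁺ p) (Mem.∈-upTo⁺ l<p)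

initial-≥ : ∀ {p l} → p ≤ l → initial p l ≡ 0ℤ
initial-≥ {p} p≤l = Σ-δ-∉ (upTo p) λ l∈ → ℕ.<⇒≱ (Mem.∈-upTo⁻ l∈) p≤l

Between : ℕ → ℕ → ℕ → Set
Between p q l = (p ≤ l × l < q) ⊎ (q ≤ l × l < p)

between⇒≢ : ∀ {p q l} → Between p q l → initial q l ℤ.- initial p l ≢ 0ℤ
between⇒≢ (inj₁ (p≤l , l<q)) eq = case trans (sym (cong₂ ℤ._-_ (initial-< l<q) (initial-≥ p≤l))) eq of λ ()
between⇒≢ (inj₂ (q≤l , l<p)) eq = case trans (sym (cong₂ ℤ._-_ (initial-≥ q≤l) (initial-< l<p))) eq of λ ()

≢⇒between : ∀ {p q l} → initial q l ℤ.- initial p l ≢ 0ℤ → Between p q l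
≢⇒between {p} {q} {l} ≢0 with l <? p | l <? q
... | yes l<p | yes l<q = contradiction (cong₂ ℤ._-_ (initial-< l<q) (initial-< l<p)) ≢0
... | yes l<p | no l≮q  = inj₂ (ℕ.≮⇒≥ l≮q , l<p)
... | no l≮p  | yes l<q = inj₁ (ℕ.≮⇒≥ l≮p , l<q)
... | no l≮p  | no l≮q  = contradiction (cong₂ ℤ._-_ (initial-≥ (ℕ.≮⇒≥ l≮q)) (initial-≥ (ℕ.≮⇒≥ l≮p))) ≢0

initial-convex : ∀ p q → Convex (λ l → initial q l ℤ.- initial p l)
initial-convex p q {i} {j} {k} i<j j<k i≢ k≢ = between⇒≢ {p} {q} (join (≢⇒between {p} i≢) (≢⇒between {p} k≢))
  where
  join : Between p q i → Between p q k → Between p q j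
  join (inj₁ (p≤i , _)) (inj₁ (_ , k<q)) = inj₁ (ℕ.≤-trans p≤i (ℕ.<⇒≤ i<j) , ℕ.<-trans j<k k<q)
  join (inj₂ (q≤i , _)) (inj₂ (_ , k<p)) = inj₂ (ℕ.≤-trans q≤i (ℕ.<⇒≤ i<j) , ℕ.<-trans j<k k<p)
  join (inj₁ (p≤i , _)) (inj₂ (_ , k<p)) = contradiction (ℕ.<-trans i<j (ℕ.<-trans j<k k<p)) (ℕ.≤⇒≯ p≤i)
  join (inj₂ (q≤i , _)) (inj₁ (_ , k<q)) = contradiction (ℕ.<-trans i<j (ℕ.<-trans j<k k<q)) (ℕ.≤⇒≯ q≤i)

-- Nonzero exactly at the labels of the steps between the positions of the values v and w.
crossing : List ℕ → List ℕ → ℕ → ℕ → ℕ → ℤ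
crossing es u v w l = height es u w (δ l) ℤ.- height es u v (δ l)

module _ {m : ℕ} {u : List ℕ} where

  cut : ℕ → ℕ
  cut v = proj₁ (before-applyUpTo v u id m)

  before-upTo : ∀ v → before v u (upTo m) ≡ upTo (cut v)
  before-upTo v = proj₂ (before-applyUpTo v u id m)

  crossing-upTo : ∀ v w l → initial (cut w) l ℤ.- initial (cut v) l ≡ crossing (upTo m) u v w l
  crossing-upTo v w l = sym (cong₂ ℤ._-_ (cong Σ[ δ l ] (before-upTo w)) (cong Σ[ δ l ] (before-upTo v)))

  crossing-upTo-convex : ∀ v w → Convex (crossing (upTo m) u v w)
  crossing-upTo-convex v w = convex-cong (crossing-upTo v w) (initial-convex (cut v) (cut w))

  -- If the two cuts coincided, the gap would vanish identically, although it is 1 at `unit`.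
  crossing-upTo-≢ : (valid : Valid m (upTo m) u) → ∀ {v} → v < m →
                    ∃ λ l → crossing (upTo m) u (suc v) (suc (suc v)) l ≢ 0ℤ
  crossing-upTo-≢ valid {v} v<m with ℕ.<-cmp (cut (suc v)) (cut (suc (suc v)))
  ... | tri< lt _ _ = cut (suc v) , λ ≡0 → between⇒≢ {cut (suc v)} {cut (suc (suc v))} (inj₁ (ℕ.≤-refl , lt))
    (trans (crossing-upTo (suc v) (suc (suc v)) (cut (suc v))) ≡0)
  ... | tri> _ _ gt = cut (suc (suc v)) , λ ≡0 → between⇒≢ {cut (suc v)} {cut (suc (suc v))} (inj₂ (ℕ.≤-refl , gt))
    (trans (crossing-upTo (suc v) (suc (suc v)) (cut (suc (suc v)))) ≡0)
  ... | tri≈ _ eq _ = contradiction (trans (sym gap≡1) gap≡0) λ ()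
    where
    x = unit (gaps valid)
    h : ℕ → ℤ
    h v = height (upTo m) u v x
    gap≡1 : h (suc (suc v)) ℤ.- h (suc v) ≡ 1ℤ
    gap≡1 = gap-unit (gaps valid) v<m
    gap≡0 : h (suc (suc v)) ℤ.- h (suc v) ≡ 0ℤ
    gap≡0 = ℤ.i≡j⇒i-j≡0 {h (suc (suc v))} {h (suc v)}
      (cong Σ[ x ] (trans (before-upTo (suc (suc v))) (trans (cong upTo (sym eq)) (sym (before-upTo (suc v))))))

module _ {m : ℕ} {es u u′ : List ℕ} (valid : Valid m es u) (valid′ : Valid m (upTo m) u′) (same : Same es u (upTo m) u′) where

  private
    F = gaps valid
    G = gaps valid′
    F⇒G : ∀ {x} → Strict F x → Strict G x
    F⇒G = same⇒strict valid valid′ same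
    G⇒F : ∀ {x} → Strict G x → Strict F x
    G⇒F = same⇒strict valid′ valid (λ x → ⇔-sym (same x))

  -- The pair 1, `m + 1` need not give a facet; its functional is the sum of all gaps, which is the
  -- same for both arrangements.
  ends-convex : Convex (crossing es u 1 (suc m))
  ends-convex = convex-cong {crossing (upTo m) u′ 1 (suc m)} {crossing es u 1 (suc m)} (λ l → trans (sym (total-gaps {upTo m} {u′} m (δ l)))
      (trans (sym (total-≡ F G F⇒G G⇒F (δ l))) (total-gaps {es} {u} m (δ l))))
    (crossing-upTo-convex {m} {u′} 1 (suc m))

  neighbours-convex : ∀ {v} → v < m → Convex (crossing es u (suc v) (suc (suc v)))
  neighbours-convex = facet-convex F G F⇒G G⇒F
    (λ q _ → crossing-upTo-convex {m} {u′} (suc q) (suc (suc q))) (λ _ → crossing-upTo-≢ {m} {u′} valid′)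

-- The arrangement and the cone determine the word

sumTo-one : ∀ m → sumTo m (λ _ → 1ℤ) ≡ + m
sumTo-one zero    = refl
sumTo-one (suc m) = trans (cong (ℤ._+ 1ℤ) (sumTo-one m)) (ℤ.+-comm (+ m) 1ℤ)

≥1-sum≡length : ∀ m {h} → (∀ {v} → v < m → 1ℤ ℤ.≤ h v) → sumTo m h ℤ.≤ + m → ∀ {v} → v < m → h v ≡ 1ℤ
≥1-sum≡length (suc m) {h} ≥1 sum≤ {v} v<1+m with ℕ.m≤n⇒m<n∨m≡n (s≤s⁻¹ v<1+m)
... | inj₂ refl = ℤ.≤-antisym (ℤ.≮⇒≥ λ 1<hm → ℤ.<⇒≱ (ℤ.+-mono-≤-< (ℤ.≤-reflexive (refl {x = + m})) 1<hm)
    (ℤ.≤-trans (ℤ.+-monoˡ-≤ (h m) (subst (ℤ._≤ sumTo m h) (sumTo-one m) (sumTo-mono m (≥1 ∘ ℕ.m<n⇒m<1+n))))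
      (ℤ.≤-trans sum≤ (ℤ.≤-reflexive (ℤ.+-comm 1ℤ (+ m)))))) (≥1 v<1+m)
... | inj₁ v<m  = ≥1-sum≡length m (≥1 ∘ ℕ.m<n⇒m<1+n) (ℤ.≮⇒≥ λ m<sum → ℤ.<⇒≱ (ℤ.+-mono-<-≤ m<sum (≥1 (ℕ.n<1+n m)))
    (ℤ.≤-trans sum≤ (ℤ.≤-reflexive (ℤ.+-comm 1ℤ (+ m))))) v<m

module _ {m : ℕ} {es u : List ℕ} (valid : Valid m es u) {x : ℕ → ℤ} (gap≡1 : ∀ {v} → v < m → gap (gaps valid) v x ≡ 1ℤ) where

  private
    h : ℕ → ℤ
    h v = height es u v x

  unit-height : ∀ v → v ≤ m → h (suc v) ≡ h 1 ℤ.+ + v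
  unit-height zero    _   = sym (ℤ.+-identityʳ (h 1))
  unit-height (suc v) v<m = begin
    h (suc (suc v))                               ≡⟨ restore (h (suc (suc v))) (h (suc v)) ⟩
    (h (suc (suc v)) ℤ.- h (suc v)) ℤ.+ h (suc v) ≡⟨ cong₂ ℤ._+_ (gap≡1 v<m) (unit-height v (ℕ.<⇒≤ v<m)) ⟩
    1ℤ ℤ.+ (h 1 ℤ.+ + v)                          ≡⟨ rotate (h 1) (+ v) ⟩
    h 1 ℤ.+ + suc v                               ∎
    where
    open ≡-Reasoning
    restore : ∀ a b → a ≡ (a ℤ.- b) ℤ.+ b
    restore = ℤ-Ring.solve-∀
    rotate : ∀ a b → 1ℤ ℤ.+ (a ℤ.+ b) ≡ a ℤ.+ (1ℤ ℤ.+ b)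
    rotate = ℤ-Ring.solve-∀

  unit-height-∈ : ∀ {v} → v ∈ u → h v ≡ (h 1 ℤ.- 1ℤ) ℤ.+ + v
  unit-height-∈ {v} v∈ with Equivalence.to (values valid v) v∈
  unit-height-∈ {suc v} v∈ | s≤s _ , v≤ = trans (unit-height v (s≤s⁻¹ v≤)) (shift (h 1) (+ v))
    where
    shift : ∀ a b → a ℤ.+ b ≡ (a ℤ.- 1ℤ) ℤ.+ (1ℤ ℤ.+ b)
    shift = ℤ-Ring.solve-∀

  unit-height-≥ : ∀ {v} → v ∈ u → h 1 ℤ.≤ h v
  unit-height-≥ {v} v∈ with Equivalence.to (values valid v) v∈
  unit-height-≥ {suc v} v∈ | s≤s _ , v≤ = subst (h 1 ℤ.≤_) (sym (unit-height v (s≤s⁻¹ v≤)))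
    (subst (ℤ._≤ h 1 ℤ.+ + v) (ℤ.+-identityʳ (h 1)) (ℤ.+-monoʳ-≤ (h 1) (+≤+ z≤n)))

-- Position by position the height depends on the steps alone, not on the value written there: both
-- lists are the same walk.
heights-agree : ∀ {m es u u′} → Valid m es u → Valid m es u′ → ∀ x →
                map (λ v → height es u v x) u ≡ map (λ v → height es u′ v x) u′
heights-agree {es = es} {u} {u′} valid valid′ x = List.map-injective ι+-injective (begin
  map (λ i → 0ℚ +ℚ ι i) (map (λ v → height es u v x) u)    ≡⟨ sym (List.map-∘ u) ⟩
  map (λ v → 0ℚ +ℚ ι (height es u v x)) u                  ≡⟨ walk-heights 0ℚ x es u (unique-values valid) (labels-length valid) ⟩
  walk 0ℚ (map (ι ∘ x) es)                                 ≡⟨ sym (walk-heights 0ℚ x es u′ (unique-values valid′) (labels-length valid′)) ⟩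
  map (λ v → 0ℚ +ℚ ι (height es u′ v x)) u′                ≡⟨ List.map-∘ u′ ⟩
  map (λ i → 0ℚ +ℚ ι i) (map (λ v → height es u′ v x) u′)  ∎)
  where
  open ≡-Reasoning
  ι+-injective : ∀ {i j} → 0ℚ +ℚ ι i ≡ 0ℚ +ℚ ι j → i ≡ j
  ι+-injective {i} {j} eq = ι-injective (trans (sym (ℚ.+-identityˡ (ι i))) (trans eq (ℚ.+-identityˡ (ι j))))

-- The point all of whose gaps are 1 for u must have all its gaps equal to 1 for u′ as well.
same-steps⇒same-word : ∀ {m es u u′} → Valid m es u → Valid m es u′ → Same es u es u′ → u ≡ u′
same-steps⇒same-word {m} {es} {u} {u′} valid valid′ same = List.map-injective shift-injective
  (trans (sym (List.map-cong-local (All.tabulate (unit-height-∈ valid gapF))))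
  (trans heights (List.map-cong-local (All.tabulate λ v∈ →
    trans (unit-height-∈ valid′ gapG v∈) (cong (λ t → t ℤ.- 1ℤ ℤ.+ + _) (sym bases))))))
  where
  F = gaps valid
  G = gaps valid′
  F⇒G : ∀ {x} → Strict F x → Strict G x
  F⇒G = same⇒strict valid valid′ same
  x = unit F
  gapF : ∀ {v} → v < m → gap F v x ≡ 1ℤ
  gapF = gap-unit F
  -- These gaps are positive integers, and their total is that of the gaps for `u`, namely `m`.
  gapG : ∀ {v} → v < m → gap G v x ≡ 1ℤ
  gapG = ≥1-sum≡length m {λ v → gap G v x}
    (λ v<m → ℤ.i<j⇒suc[i]≤j (F⇒G (λ w<m → subst (0ℤ ℤ.<_) (sym (gapF w<m)) (ℤ.+<+ (s≤s z≤n))) v<m))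
    (ℤ.≤-reflexive (trans (sym (total-≡ F G F⇒G (same⇒strict valid′ valid (λ x → ⇔-sym (same x))) x))
      (trans (sumTo-cong m gapF) (sumTo-one m))))
  h h′ : ℕ → ℤ
  h v = height es u v x
  h′ v = height es u′ v x
  heights : map h u ≡ map h′ u′
  heights = heights-agree valid valid′ x

  1∈ : ∀ {w} → Valid m es w → 1 ∈ w
  1∈ v = Equivalence.from (values v 1) (s≤s z≤n , s≤s z≤n)

  -- In each word the value 1 sits at the minimum of the heights, and the two lists of heights
  -- coincide.
  bases : h 1 ≡ h′ 1
  bases with Mem.∈-map⁻ h′ (subst (h 1 ∈_) heights (Mem.∈-map⁺ h (1∈ valid)))
           | Mem.∈-map⁻ h (subst (h′ 1 ∈_) (sym heights) (Mem.∈-map⁺ h′ (1∈ valid′)))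
  ... | v , v∈ , eq | w , w∈ , eq′ = ℤ.≤-antisym
    (subst (h 1 ℤ.≤_) (sym eq′) (unit-height-≥ valid gapF w∈))
    (subst (h′ 1 ℤ.≤_) (sym eq) (unit-height-≥ valid′ gapG v∈))

  shift-injective : ∀ {v w} → (h 1 ℤ.- 1ℤ) ℤ.+ + v ≡ (h 1 ℤ.- 1ℤ) ℤ.+ + w → v ≡ w
  shift-injective {v} {w} eq = ℤ.+-injective (ℤ-Group.∙-cancelˡ (h 1 ℤ.- 1ℤ) (+ v) (+ w) eq)

-- Sorting the steps by flips

before-++ : ∀ {v} A {u} E {es} → length A ≡ length E → v ∉ A → before v (A ++ u) (E ++ es) ≡ E ++ before v u es
before-++ []      []      len v∉ = refl
before-++ (a ∷ A) {u} (e ∷ E) {es} len v∉ = trans (before-there (A ++ u) e (E ++ es) (v∉ ∘ here))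
  (cong (e ∷_) (before-++ A E (ℕ.suc-injective len) (v∉ ∘ there)))

-- `A` may be one entry longer than `E` because a walk has one more point than steps: the last value
-- of `A` then comes right after the last step of `E`.
before-prefix : ∀ {v l} A {u} E {es} → length A ≤ suc (length E) → v ∈ A → l ∈ before v (A ++ u) (E ++ es) → l ∈ E
before-prefix {v} {l} (a ∷ A) {u} [] {es} (s≤s len) v∈A l∈ with A | len | v∈A
... | [] | z≤n | here refl = contradiction (subst (l ∈_) (before-here v u es) l∈) λ ()
before-prefix {v} (a ∷ A) {u} (e ∷ E) (s≤s len) v∈A l∈ with v ≟ a
before-prefix (a ∷ A) (e ∷ E) (s≤s len) (here v≡a)  l∈         | no v≢a = contradiction v≡a v≢a
before-prefix (a ∷ A) (e ∷ E) (s≤s len) (there v∈A) (here l≡e) | no v≢a = here l≡e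
before-prefix (a ∷ A) (e ∷ E) (s≤s len) (there v∈A) (there l∈) | no v≢a = there (before-prefix A E len v∈A l∈)

convex-flip : ∀ {es u v w} → Convex (crossing es u v w) → Convex (crossing es u w v)
convex-flip {es} {u} {v} {w} convex i<j j<k i≢ k≢ = convex i<j j<k (i≢ ∘ flip) (k≢ ∘ flip) ∘ flip
  where
  flip : ∀ {v w l} → crossing es u v w l ≡ 0ℤ → crossing es u w v l ≡ 0ℤ
  flip {v} {w} {l} eq = ℤ.i≡j⇒i-j≡0 {height es u v (δ l)} {height es u w (δ l)}
    (sym (ℤ.i-j≡0⇒i≡j (height es u w (δ l)) (height es u v (δ l)) eq))

-- Cyclic adjacency on `1, …, m + 1`. The wrap has its own constructors because its convexity comes
-- from the sum of the gaps and not from a single facet.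
data Neighbours (m : ℕ) : ℕ → ℕ → Set where
  up    : ∀ {k} → k < m → Neighbours m (suc k) (suc (suc k))
  down  : ∀ {k} → k < m → Neighbours m (suc (suc k)) (suc k)
  wrap↓ : Neighbours m 1 (suc m)
  wrap↑ : Neighbours m (suc m) 1

module _ {m : ℕ} {es u u′ : List ℕ} (valid : Valid m es u) (valid′ : Valid m (upTo m) u′) (same : Same es u (upTo m) u′) where

  crossing-convex : ∀ {v w} → Neighbours m v w → Convex (crossing es u v w)
  crossing-convex (up k<m)       = neighbours-convex valid valid′ same k<m
  crossing-convex (down {k} k<m) = convex-flip {es} {u} {suc k} {suc (suc k)} (neighbours-convex valid valid′ same k<m)
  crossing-convex wrap↓          = ends-convex valid valid′ same
  crossing-convex wrap↑          = convex-flip {es} {u} {1} {suc m} (ends-convex valid valid′ same)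

-- The two arcs into which lo and hi cut the cycle of values 1, …, m + 1.
module Arcs {m lo hi : ℕ} (lo<hi : lo < hi) (hi≤ : hi ≤ suc m) (P : ℕ → Set)
  (spread : ∀ {v w} → Neighbours m v w → w ≢ lo → w ≢ hi → P v → P w) where

  Off : ℕ → Set
  Off v = v ≢ lo × v ≢ hi

  private
    run-up : ∀ {v w} → 1 ≤ v → v ≤ w → w ≤ suc m → (∀ {x} → v ≤ x → x ≤ w → Off x) → P v → P w
    run-up {v} {w} 1≤v v≤w w≤ off p with ℕ.m≤n⇒m<n∨m≡n v≤w
    ... | inj₂ refl = p
    run-up {suc v} {suc (suc w)} 1≤v v≤w (s≤s w<m) off p | inj₁ (s≤s v<w) =
      spread (up w<m) (proj₁ (off v≤w ℕ.≤-refl)) (proj₂ (off v≤w ℕ.≤-refl))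
        (run-up 1≤v v<w (ℕ.m≤n⇒m≤1+n w<m) (λ v≤x x≤w → off v≤x (ℕ.m≤n⇒m≤1+n x≤w)) p)

    run-down : ∀ {v w} → 1 ≤ w → w ≤ v → v ≤ suc m → (∀ {x} → w ≤ x → x ≤ v → Off x) → P v → P w
    run-down {v} {w} 1≤w w≤v v≤ off p with ℕ.m≤n⇒m<n∨m≡n w≤v
    ... | inj₂ refl = p
    run-down {suc (suc v)} {suc w} 1≤w w≤v (s≤s v<m) off p | inj₁ (s≤s w<v) =
      run-down 1≤w w<v (ℕ.m≤n⇒m≤1+n v<m) (λ w≤x x≤v → off w≤x (ℕ.m≤n⇒m≤1+n x≤v))
        (spread (down v<m) (proj₁ (off w<v (ℕ.n≤1+n _))) (proj₂ (off w<v (ℕ.n≤1+n _))) p)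

    run : ∀ {v w} → 1 ≤ v → v ≤ suc m → 1 ≤ w → w ≤ suc m →
          (∀ {x} → v ≤ x → x ≤ w → Off x) → (∀ {x} → w ≤ x → x ≤ v → Off x) → P v → P w
    run {v} {w} 1≤v v≤ 1≤w w≤ off off′ with ℕ.≤-total v w
    ... | inj₁ v≤w = run-up 1≤v v≤w w≤ off
    ... | inj₂ w≤v = run-down 1≤w w≤v v≤ off′

  inner : ∀ {v w} → lo < v → v < hi → lo < w → w < hi → P v → P w
  inner lo<v v<hi lo<w w<hi = run (ℕ.≤-<-trans z≤n lo<v) (ℕ.≤-trans (ℕ.<⇒≤ v<hi) hi≤)
      (ℕ.≤-<-trans z≤n lo<w) (ℕ.≤-trans (ℕ.<⇒≤ w<hi) hi≤) (off lo<v w<hi) (off lo<w v<hi)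
    where
    off : ∀ {v w x} → lo < v → w < hi → v ≤ x → x ≤ w → Off x
    off lo<v w<hi v≤x x≤w = ℕ.>⇒≢ (ℕ.<-≤-trans lo<v v≤x) , ℕ.<⇒≢ (ℕ.≤-<-trans x≤w w<hi)

  private
    off-low : ∀ {w x} → w < lo → x ≤ w → Off x
    off-low w<lo x≤w = ℕ.<⇒≢ (ℕ.≤-<-trans x≤w w<lo) , ℕ.<⇒≢ (ℕ.≤-<-trans x≤w (ℕ.<-trans w<lo lo<hi))
    off-high : ∀ {v x} → hi < v → v ≤ x → Off x
    off-high hi<v v≤x = ℕ.>⇒≢ (ℕ.<-≤-trans (ℕ.<-trans lo<hi hi<v) v≤x) , ℕ.>⇒≢ (ℕ.<-≤-trans hi<v v≤x)

  outer : ∀ {v w} → 1 ≤ v → v ≤ suc m → 1 ≤ w → w ≤ suc m → Outside lo hi v → Outside lo hi w → P v → P w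
  outer 1≤v v≤ 1≤w w≤ (inj₁ v<lo) (inj₁ w<lo) =
    run 1≤v v≤ 1≤w w≤ (λ _ → off-low w<lo) (λ _ → off-low v<lo)
  outer 1≤v v≤ 1≤w w≤ (inj₂ hi<v) (inj₂ hi<w) =
    run 1≤v v≤ 1≤w w≤ (λ v≤x _ → off-high hi<v v≤x) (λ w≤x _ → off-high hi<w w≤x)
  -- The outer arc runs through the wrap: down from `v` to 1, across to `m + 1`, then down to `w`.
  outer 1≤v v≤ 1≤w w≤ (inj₁ v<lo) (inj₂ hi<w) p =
    run-down 1≤w w≤ ℕ.≤-refl (λ w≤x _ → off-high hi<w w≤x)
      (spread wrap↓ (proj₁ (off-high hi<w w≤)) (proj₂ (off-high hi<w w≤))
        (run-down ℕ.≤-refl 1≤v v≤ (λ _ → off-low v<lo) p))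
  outer 1≤v v≤ 1≤w w≤ (inj₂ hi<v) (inj₁ w<lo) p =
    run-up ℕ.≤-refl 1≤w w≤ (λ _ → off-low w<lo)
      (spread wrap↑ (proj₁ (off-low w<lo 1≤w)) (proj₂ (off-low w<lo 1≤w))
        (run-up 1≤v v≤ ℕ.≤-refl (λ v≤x _ → off-high hi<v v≤x) p))

-- Reversing one segment of the arrangement

height-∈ : ∀ {m es u} → Valid m es u → ∀ {v l} → l ∈ before v u es → height es u v (δ l) ≡ 1ℤ
height-∈ {u = u} valid {v} l∈ = Σ-δ-∈ (before-unique v u (unique-labels valid)) l∈

height-∉ : ∀ es u {v l} → l ∉ before v u es → height es u v (δ l) ≡ 0ℤ
height-∉ es u {v} l∉ = Σ-δ-∉ (before v u es) l∉

reverse-turn : ∀ {A : Set} (xs : List A) {l mid q} ys →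
               reverse (xs ++ l ∷ mid ++ q ∷ ys) ≡ reverse ys ++ q ∷ reverse mid ++ l ∷ reverse xs
reverse-turn xs {l} {mid} {q} ys = begin
  reverse (xs ++ l ∷ mid ++ q ∷ ys)
    ≡⟨ List.reverse-++ xs (l ∷ mid ++ q ∷ ys) ⟩
  reverse (l ∷ mid ++ q ∷ ys) ++ reverse xs
    ≡⟨ cong (_++ reverse xs) (List.unfold-reverse l (mid ++ q ∷ ys)) ⟩
  (reverse (mid ++ q ∷ ys) ∷ʳ l) ++ reverse xs
    ≡⟨ List.++-assoc (reverse (mid ++ q ∷ ys)) [ l ] (reverse xs) ⟩
  reverse (mid ++ q ∷ ys) ++ l ∷ reverse xs
    ≡⟨ cong (_++ l ∷ reverse xs) (List.reverse-++ mid (q ∷ ys)) ⟩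
  (reverse (q ∷ ys) ++ reverse mid) ++ l ∷ reverse xs
    ≡⟨ List.++-assoc (reverse (q ∷ ys)) (reverse mid) (l ∷ reverse xs) ⟩
  reverse (q ∷ ys) ++ reverse mid ++ l ∷ reverse xs
    ≡⟨ cong (_++ reverse mid ++ l ∷ reverse xs) (List.unfold-reverse q ys) ⟩
  (reverse ys ∷ʳ q) ++ reverse mid ++ l ∷ reverse xs
    ≡⟨ List.++-assoc (reverse ys) [ q ] (reverse mid ++ l ∷ reverse xs) ⟩
  reverse ys ++ q ∷ reverse mid ++ l ∷ reverse xs ∎
  where open ≡-Reasoning

-- Values and steps are aligned: `a` is the value just before step `l`, `b` the one just after step
-- `q`, and `M` holds the values strictly inside the segment, one more than `mid` has steps.
module Turn {m l q a b : ℕ} {E₁ mid E₃ A M B t : List ℕ}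
  (lenA : length A ≡ length E₁) (lenM : length M ≡ suc (length mid)) (lenB : length B ≡ length E₃)
  (valid : Valid m (E₁ ++ l ∷ mid ++ q ∷ E₃) (A ++ a ∷ M ++ b ∷ B))
  (valid-t : Valid m (upTo m) t)
  (same : Same (E₁ ++ l ∷ mid ++ q ∷ E₃) (A ++ a ∷ M ++ b ∷ B) (upTo m) t)
  (E₁<q : All (_< q) E₁) (q<l : q < l) (l<E₃ : All (l <_) E₃) where

  private
    es u es′ : List ℕ
    es  = E₁ ++ l ∷ mid ++ q ∷ E₃
    u   = A ++ a ∷ M ++ b ∷ B
    es′ = E₁ ++ q ∷ reverse mid ++ l ∷ E₃

    Rest : ℕ → Set
    Rest v = v ∈ A ⊎ v ∈ B

    splitA = unique-++⁻ A (unique-values valid)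
    splitM = unique-++⁻ (a ∷ M) (proj₁ (proj₂ splitA))

    M∉A : ∀ {v} → v ∈ M → v ∉ A
    M∉A v∈M v∈A = proj₂ (proj₂ splitA) v∈A (there (Mem.∈-++⁺ˡ v∈M))
    M∉B : ∀ {v} → v ∈ M → v ∉ B
    M∉B v∈M v∈B = proj₂ (proj₂ splitM) (there v∈M) (there v∈B)
    M≢a : ∀ {v} → v ∈ M → v ≢ a
    M≢a v∈M refl = Unique.Unique[x∷xs]⇒x∉xs (proj₁ splitM) v∈M
    M≢b : ∀ {v} → v ∈ M → v ≢ b
    M≢b v∈M refl = proj₂ (proj₂ splitM) (there v∈M) (here refl)
    a≢b : a ≢ b
    a≢b refl = proj₂ (proj₂ splitM) (here refl) (here refl)
    A≢a : ∀ {v} → v ∈ A → v ≢ a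
    A≢a v∈A refl = proj₂ (proj₂ splitA) v∈A (here refl)
    A≢b : ∀ {v} → v ∈ A → v ≢ b
    A≢b v∈A refl = proj₂ (proj₂ splitA) v∈A (there (Mem.∈-++⁺ʳ M (here refl)))
    A∉B : ∀ {v} → v ∈ B → v ∉ A
    A∉B v∈B v∈A = proj₂ (proj₂ splitA) v∈A (there (Mem.∈-++⁺ʳ M (there v∈B)))
    B∉aM : ∀ {v} → v ∈ B → v ∉ a ∷ M
    B∉aM v∈B v∈aM = proj₂ (proj₂ splitM) v∈aM (there v∈B)
    B≢b : ∀ {v} → v ∈ B → v ≢ b
    B≢b v∈B refl = Unique.Unique[x∷xs]⇒x∉xs (proj₁ (proj₂ splitM)) v∈B

    splitE = unique-++⁻ E₁ (unique-labels valid)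
    splitmid = unique-++⁻ (l ∷ mid) (proj₁ (proj₂ splitE))

    before-M : ∀ {v} → v ∈ M → before v u es ≡ E₁ ++ l ∷ before v (M ++ b ∷ B) (mid ++ q ∷ E₃)
    before-M v∈M = trans (before-++ A E₁ lenA (M∉A v∈M))
      (cong (E₁ ++_) (before-there (M ++ b ∷ B) l (mid ++ q ∷ E₃) (M≢a v∈M)))

    E₁∈M : ∀ {v e} → v ∈ M → e ∈ E₁ → e ∈ before v u es
    E₁∈M v∈M e∈ = subst (_ ∈_) (sym (before-M v∈M)) (Mem.∈-++⁺ˡ e∈)

    l∈M : ∀ {v} → v ∈ M → l ∈ before v u es
    l∈M v∈M = subst (l ∈_) (sym (before-M v∈M)) (Mem.∈-++⁺ʳ E₁ (here refl))

    late∉M : ∀ {v e} → v ∈ M → e ∈ q ∷ E₃ → e ∉ before v u es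
    late∉M v∈M e∈ e∈before with Mem.∈-++⁻ E₁ (subst (_ ∈_) (before-M v∈M) e∈before)
    ... | inj₁ e∈E₁ = proj₂ (proj₂ splitE) e∈E₁ (there (Mem.∈-++⁺ʳ mid e∈))
    ... | inj₂ (here refl) = proj₂ (proj₂ splitmid) (here refl) e∈
    ... | inj₂ (there e∈′) = proj₂ (proj₂ splitmid)
      (there (before-prefix M mid (ℕ.≤-reflexive lenM) v∈M e∈′)) e∈

    assoc-u : (A ++ a ∷ M) ++ b ∷ B ≡ u
    assoc-u = List.++-assoc A (a ∷ M) (b ∷ B)

    assoc-es : (E₁ ++ l ∷ mid ∷ʳ q) ++ E₃ ≡ es
    assoc-es = trans (List.++-assoc E₁ (l ∷ mid ∷ʳ q) E₃) (cong (λ xs → E₁ ++ l ∷ xs) (List.++-assoc mid [ q ] E₃))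

    before-B : ∀ {w e E} → E₃ ≡ e ∷ E → w ∈ B → ∃ λ xs → before w u es ≡ (E₁ ++ l ∷ mid ∷ʳ q) ++ e ∷ xs
    before-B {w} {e} {E} refl w∈B = before w B E , (begin
      before w u es
        ≡⟨ cong₂ (before w) (sym assoc-u) (sym assoc-es) ⟩
      before w ((A ++ a ∷ M) ++ b ∷ B) ((E₁ ++ l ∷ mid ∷ʳ q) ++ e ∷ E)
        ≡⟨ before-++ (A ++ a ∷ M) (E₁ ++ l ∷ mid ∷ʳ q) len
             (λ w∈ → [ A∉B w∈B , B∉aM w∈B ]′ (Mem.∈-++⁻ A w∈)) ⟩
      (E₁ ++ l ∷ mid ∷ʳ q) ++ before w (b ∷ B) (e ∷ E)
        ≡⟨ cong ((E₁ ++ l ∷ mid ∷ʳ q) ++_) (before-there B e E (B≢b w∈B)) ⟩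
      (E₁ ++ l ∷ mid ∷ʳ q) ++ e ∷ before w B E ∎)
      where
      open ≡-Reasoning
      len : length (A ++ a ∷ M) ≡ length (E₁ ++ l ∷ mid ∷ʳ q)
      len = trans (List.length-++ A) (trans (cong₂ (λ x y → x + suc y) lenA
        (trans lenM (trans (ℕ.+-comm 1 (length mid)) (sym (List.length-++ mid))))) (sym (List.length-++ E₁)))

    crossing-≢0ˡ : ∀ {v w k} → k ∈ before v u es → k ∉ before w u es → crossing es u v w k ≢ 0ℤ
    crossing-≢0ˡ k∈ k∉ eq = case trans (sym (cong₂ ℤ._-_ (height-∉ es u k∉) (height-∈ valid k∈))) eq of λ ()

    crossing-≢0ʳ : ∀ {v w k} → k ∉ before v u es → k ∈ before w u es → crossing es u v w k ≢ 0ℤ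
    crossing-≢0ʳ k∉ k∈ eq = case trans (sym (cong₂ ℤ._-_ (height-∈ valid k∈) (height-∉ es u k∉))) eq of λ ()

    -- The steps q and E₃ lie between v and w, but the step l in between does not.
    M-B : ∀ {v w} → v ∈ M → w ∈ B → ¬ Convex (crossing es u v w)
    M-B {v} {w} v∈M w∈B convex = go E₃ refl
      where
      go : ∀ E → E₃ ≡ E → ⊥
      go []      eq = contradiction (subst (0 <_) (trans lenB (cong length eq)) (Mem.∈-length w∈B)) λ ()
      go (e ∷ E) eq with before-B eq w∈B
      ... | xs , before≡ = convex q<l (All.lookup l<E₃ e∈E₃)
          (crossing-≢0ʳ (late∉M v∈M (here refl)) (in-w (Mem.∈-++⁺ˡ (Mem.∈-++⁺ʳ E₁ (there (Mem.∈-++⁺ʳ mid (here refl)))))))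
          (crossing-≢0ʳ (late∉M v∈M (there e∈E₃)) (in-w (Mem.∈-++⁺ʳ (E₁ ++ l ∷ mid ∷ʳ q) (here refl))))
          (cong₂ ℤ._-_ (height-∈ valid (in-w (Mem.∈-++⁺ˡ (Mem.∈-++⁺ʳ E₁ (here refl))))) (height-∈ valid (l∈M v∈M)))
        where
        e∈E₃ : e ∈ E₃
        e∈E₃ = subst (e ∈_) (sym eq) (here refl)
        in-w : ∀ {k} → k ∈ (E₁ ++ l ∷ mid ∷ʳ q) ++ e ∷ xs → k ∈ before w u es
        in-w = subst (_ ∈_) (sym before≡)

    -- The step l and the last step of E₁ lie between v and w, but the step q in between does not.
    M-A : ∀ {v w} → v ∈ M → w ∈ A → ¬ Convex (crossing es u v w)
    M-A {v} {w} v∈M w∈A convex = go (initLast E₁) refl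
      where
      go : ∀ {E} → InitLast E → E₁ ≡ E → ⊥
      go []        eq = contradiction (subst (0 <_) (trans lenA (cong length eq)) (Mem.∈-length w∈A)) λ ()
      go (E ∷ʳ′ e) eq = convex (All.lookup E₁<q e∈E₁) q<l
          (crossing-≢0ˡ (E₁∈M v∈M e∈E₁) e∉w)
          (crossing-≢0ˡ (l∈M v∈M) (E₁-only λ l∈E₁ → proj₂ (proj₂ splitE) l∈E₁ (here refl)))
          (cong₂ ℤ._-_
            (height-∉ es u (E₁-only λ q∈E₁ → proj₂ (proj₂ splitE) q∈E₁ (there (Mem.∈-++⁺ʳ mid (here refl)))))
            (height-∉ es u (late∉M v∈M (here refl))))
        where
        e∈E₁ : e ∈ E₁
        e∈E₁ = subst (e ∈_) (sym eq) (Mem.∈-++⁺ʳ E (here refl))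
        lenE : length A ≡ suc (length E)
        lenE = trans lenA (trans (cong length eq) (trans (List.length-++ E) (ℕ.+-comm (length E) 1)))
        es≡ : es ≡ E ++ e ∷ l ∷ mid ++ q ∷ E₃
        es≡ = trans (cong (_++ l ∷ mid ++ q ∷ E₃) eq) (List.++-assoc E [ e ] (l ∷ mid ++ q ∷ E₃))
        in-E : ∀ {k} → k ∈ before w u es → k ∈ E
        in-E k∈ = before-prefix A E (ℕ.≤-reflexive lenE) w∈A (subst (λ xs → _ ∈ before w u xs) es≡ k∈)
        E₁-only : ∀ {k} → k ∉ E₁ → k ∉ before w u es
        E₁-only k∉ k∈ = k∉ (subst (_ ∈_) (sym eq) (Mem.∈-++⁺ˡ (in-E k∈)))
        e∉w : e ∉ before w u es
        e∉w e∈ = proj₂ (proj₂ (unique-++⁻ E (subst Unique eq (proj₁ splitE)))) (in-E e∈) (here refl)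

    not-neighbours : ∀ {v w} → v ∈ M → Rest w → ¬ Neighbours m v w
    not-neighbours v∈M (inj₁ w∈A) nb = M-A v∈M w∈A (crossing-convex valid valid-t same nb)
    not-neighbours v∈M (inj₂ w∈B) nb = M-B v∈M w∈B (crossing-convex valid valid-t same nb)

    ∈u : ∀ {v} → 1 ≤ v → v ≤ suc m → v ∈ A ⊎ v ≡ a ⊎ v ∈ M ⊎ v ≡ b ⊎ v ∈ B
    ∈u 1≤v v≤ with Mem.∈-++⁻ A (Equivalence.from (values valid _) (1≤v , v≤))
    ... | inj₁ v∈A         = inj₁ v∈A
    ... | inj₂ (here v≡a)  = inj₂ (inj₁ v≡a)
    ... | inj₂ (there v∈)  with Mem.∈-++⁻ M v∈
    ... | inj₁ v∈M         = inj₂ (inj₂ (inj₁ v∈M))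
    ... | inj₂ (here v≡b)  = inj₂ (inj₂ (inj₂ (inj₁ v≡b)))
    ... | inj₂ (there v∈B) = inj₂ (inj₂ (inj₂ (inj₂ v∈B)))

    u-range : ∀ {v} → v ∈ u → 1 ≤ v × v ≤ suc m
    u-range = Equivalence.to (values valid _)

    A⊆u : ∀ {v} → v ∈ A → v ∈ u
    A⊆u = Mem.∈-++⁺ˡ
    a∈u : a ∈ u
    a∈u = Mem.∈-++⁺ʳ A (here refl)
    M⊆u : ∀ {v} → v ∈ M → v ∈ u
    M⊆u = Mem.∈-++⁺ʳ A ∘ there ∘ Mem.∈-++⁺ˡ
    b∈u : b ∈ u
    b∈u = Mem.∈-++⁺ʳ A (there (Mem.∈-++⁺ʳ M (here refl)))
    B⊆u : ∀ {v} → v ∈ B → v ∈ u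
    B⊆u = Mem.∈-++⁺ʳ A ∘ there ∘ Mem.∈-++⁺ʳ M ∘ there

  Turned : Set
  Turned = ∃ λ u′ → Star Move u u′ × Step m es u es′ u′

  private
    -- `lo` and `hi` are `a` and `b` in increasing order, so both orientations of the border are
    -- treated at once.
    module Flip {lo hi : ℕ} (lo<hi : lo < hi) (ends : (lo ≡ a × hi ≡ b) ⊎ (lo ≡ b × hi ≡ a)) where

      lo≤a≤hi : lo ≤ a × a ≤ hi
      lo≤a≤hi = [ (λ { (refl , refl) → ℕ.≤-refl , ℕ.<⇒≤ lo<hi }) , (λ { (refl , refl) → ℕ.<⇒≤ lo<hi , ℕ.≤-refl }) ]′ ends
      lo≤b≤hi : lo ≤ b × b ≤ hi
      lo≤b≤hi = [ (λ { (refl , refl) → ℕ.<⇒≤ lo<hi , ℕ.≤-refl }) , (λ { (refl , refl) → ℕ.≤-refl , ℕ.<⇒≤ lo<hi }) ]′ ends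
      1≤lo : 1 ≤ lo
      1≤lo = [ (λ { (refl , _) → proj₁ (u-range a∈u) }) , (λ { (refl , _) → proj₁ (u-range b∈u) }) ]′ ends
      hi≤ : hi ≤ suc m
      hi≤ = [ (λ { (_ , refl) → proj₂ (u-range b∈u) }) , (λ { (_ , refl) → proj₂ (u-range a∈u) }) ]′ ends

      off : ∀ {v} → v ≢ a → v ≢ b → v ≢ lo × v ≢ hi
      off v≢a v≢b = [ (λ { (refl , refl) → v≢a , v≢b }) , (λ { (refl , refl) → v≢b , v≢a }) ]′ ends
      on : ∀ {v} → v ≢ lo → v ≢ hi → v ≢ a × v ≢ b
      on v≢lo v≢hi = [ (λ { (refl , refl) → v≢lo , v≢hi }) , (λ { (refl , refl) → v≢hi , v≢lo }) ]′ ends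

      M-spread : ∀ {v w} → Neighbours m v w → w ≢ lo → w ≢ hi → v ∈ M → w ∈ M
      M-spread {v} {w} nb w≢lo w≢hi v∈M with ∈u (proj₁ (range nb)) (proj₂ (range nb))
        where
        range : ∀ {v w} → Neighbours m v w → 1 ≤ w × w ≤ suc m
        range (up k<m)   = s≤s z≤n , s≤s k<m
        range (down k<m) = s≤s z≤n , ℕ.m≤n⇒m≤1+n k<m
        range wrap↓      = s≤s z≤n , ℕ.≤-refl
        range wrap↑      = s≤s z≤n , s≤s z≤n
      ... | inj₁ w∈A                      = contradiction nb (not-neighbours v∈M (inj₁ w∈A))
      ... | inj₂ (inj₁ w≡a)               = contradiction w≡a (proj₁ (on w≢lo w≢hi))
      ... | inj₂ (inj₂ (inj₁ w∈M))        = w∈M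
      ... | inj₂ (inj₂ (inj₂ (inj₁ w≡b))) = contradiction w≡b (proj₂ (on w≢lo w≢hi))
      ... | inj₂ (inj₂ (inj₂ (inj₂ w∈B))) = contradiction nb (not-neighbours v∈M (inj₂ w∈B))

      open Arcs {m} lo<hi hi≤ (_∈ M) M-spread

      Inner : ℕ → Set
      Inner v = lo < v × v < hi

      classify : ∀ {v} → v ≢ lo → v ≢ hi → Inner v ⊎ Outside lo hi v
      classify {v} v≢lo v≢hi with ℕ.<-cmp v lo | ℕ.<-cmp v hi
      ... | tri< v<lo _ _ | _             = inj₂ (inj₁ v<lo)
      ... | tri≈ _ v≡lo _ | _             = contradiction v≡lo v≢lo
      ... | tri> _ _ lo<v | tri< v<hi _ _ = inj₁ (lo<v , v<hi)
      ... | tri> _ _ lo<v | tri≈ _ v≡hi _ = contradiction v≡hi v≢hi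
      ... | tri> _ _ lo<v | tri> _ _ hi<v = inj₂ (inj₂ hi<v)

      not-outside : ∀ {v} → lo ≤ v → v ≤ hi → ¬ Outside lo hi v
      not-outside lo≤v v≤hi = [ ℕ.≤⇒≯ lo≤v , ℕ.≤⇒≯ v≤hi ]′

      classify-M : ∀ {v} → v ∈ M → Inner v ⊎ Outside lo hi v
      classify-M v∈M = classify (proj₁ (off (M≢a v∈M) (M≢b v∈M))) (proj₂ (off (M≢a v∈M) (M≢b v∈M)))

      rest-off : ∀ {v} → Rest v → v ≢ lo × v ≢ hi
      rest-off (inj₁ v∈A) = off (A≢a v∈A) (A≢b v∈A)
      rest-off (inj₂ v∈B) = off (B∉aM v∈B ∘ here) (B≢b v∈B)

      rest-u : ∀ {v} → Rest v → v ∈ u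
      rest-u (inj₁ v∈A) = A⊆u v∈A
      rest-u (inj₂ v∈B) = B⊆u v∈B

      rest-∉M : ∀ {v} → Rest v → v ∉ M
      rest-∉M (inj₁ v∈A) v∈M = M∉A v∈M v∈A
      rest-∉M (inj₂ v∈B) v∈M = M∉B v∈M v∈B

      outer-u : ∀ {v w} → v ∈ u → w ∈ u → Outside lo hi v → Outside lo hi w → v ∈ M → w ∈ M
      outer-u v∈ w∈ = outer (proj₁ (u-range v∈)) (proj₂ (u-range v∈)) (proj₁ (u-range w∈)) (proj₂ (u-range w∈))

      ordinary : (∀ {v} → v ∈ M → Inner v) → (∀ {v} → Rest v → Outside lo hi v) → Turned
      ordinary M-in rest-out = A ++ flipW lo hi w ++ B , move ◅ ε , step
        where
        w = a ∷ M ∷ʳ b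
        u≡ : A ++ w ++ B ≡ u
        u≡ = cong (λ xs → A ++ a ∷ xs) (List.++-assoc M [ b ] B)
        D = l ∷ mid ∷ʳ q
        es≡ : E₁ ++ D ++ E₃ ≡ es
        es≡ = cong (λ xs → E₁ ++ l ∷ xs) (List.++-assoc mid [ q ] E₃)
        es′≡ : E₁ ++ reverse D ++ E₃ ≡ es′
        es′≡ = trans (cong (λ xs → E₁ ++ xs ++ E₃) (reverse-turn [] {l} {mid} {q} []))
          (cong (λ xs → E₁ ++ q ∷ xs) (List.++-assoc (reverse mid) [ l ] E₃))

        to : ∀ {v} → v ∈ w → lo ≤ v × v ≤ hi
        to (here refl) = lo≤a≤hi
        to (there v∈) with Mem.∈-++⁻ M v∈
        ... | inj₁ v∈M         = ℕ.<⇒≤ (proj₁ (M-in v∈M)) , ℕ.<⇒≤ (proj₂ (M-in v∈M))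
        ... | inj₂ (here refl) = lo≤b≤hi
        from : ∀ {v} → lo ≤ v × v ≤ hi → v ∈ w
        from (lo≤v , v≤hi) with ∈u (ℕ.≤-trans 1≤lo lo≤v) (ℕ.≤-trans v≤hi hi≤)
        ... | inj₁ v∈A                      = contradiction (rest-out (inj₁ v∈A)) (not-outside lo≤v v≤hi)
        ... | inj₂ (inj₁ refl)              = here refl
        ... | inj₂ (inj₂ (inj₁ v∈M))        = there (Mem.∈-++⁺ˡ v∈M)
        ... | inj₂ (inj₂ (inj₂ (inj₁ refl))) = there (Mem.∈-++⁺ʳ M (here refl))
        ... | inj₂ (inj₂ (inj₂ (inj₂ v∈B))) = contradiction (rest-out (inj₂ v∈B)) (not-outside lo≤v v≤hi)

        range : ValuesRange w lo hi
        range v = mk⇔ to from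
        bordered : Bordered w lo hi
        bordered = Sum.map (λ { (refl , refl) → refl , last-++ (a ∷ M) λ () })
                           (λ { (refl , refl) → refl , last-++ (a ∷ M) λ () }) ends

        move : Move u (A ++ flipW lo hi w ++ B)
        move = subst (λ u → Move u (A ++ flipW lo hi w ++ B)) u≡ (ordFlip A w B lo hi range bordered)
        lenw : suc (length D) ≡ length w
        lenw = cong (λ n → suc n) (trans (cong suc (List.length-++ mid)) (trans (cong (λ n → n + 1) (sym lenM)) (sym (List.length-++ M))))
        step : Step m es u es′ (A ++ flipW lo hi w ++ B)
        step = subst (λ e → Step m es u e (A ++ flipW lo hi w ++ B)) es′≡
          (subst₂ (λ e v → Step m e v (E₁ ++ reverse D ++ E₃) (A ++ flipW lo hi w ++ B)) es≡ u≡
            (ordFlip-step {m} {A} {w} {B} {lo} {hi} E₁ {D} {E₃} (sym lenA) lenw range bordered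
              (subst₂ (Valid m) (sym es≡) (sym u≡) valid)))

      -- Here the block is the complement: `b`, `B`, `A`, `a` in cyclic order. Its flip reverses the
      -- two outer segments and exchanges them; reversing the whole arrangement afterwards restores
      -- them and leaves just the middle reversed.
      wrapping : (∀ {v} → v ∈ M → Outside lo hi v) → (∀ {v} → Rest v → Inner v) → M ≢ [] → Turned
      wrapping M-out rest-in M≢[] = RC u₁ , move ◅ rc u₁ ◅ ε , subst (λ e → Step m es u e (RC u₁)) es′≡ (step-trans step (rc-step (proj₁ step)))
        where
        w = b ∷ B ++ A ∷ʳ a
        u≡ : (A ∷ʳ a) ++ M ++ b ∷ B ≡ u
        u≡ = List.++-assoc A [ a ] (M ++ b ∷ B)
        u₁ = flipW lo hi (b ∷ B) ++ M ++ flipW lo hi (A ∷ʳ a)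
        es₁ = reverse E₃ ++ l ∷ mid ++ q ∷ reverse E₁
        es′≡ : reverse es₁ ≡ es′
        es′≡ = trans (reverse-turn (reverse E₃) (reverse E₁))
          (cong₂ (λ x y → x ++ q ∷ reverse mid ++ l ∷ y) (List.reverse-involutive E₁) (List.reverse-involutive E₃))

        to : ∀ {v} → v ∈ w → lo ≤ v × v ≤ hi
        to (here refl) = lo≤b≤hi
        to (there v∈) with Mem.∈-++⁻ B v∈
        ... | inj₁ v∈B = ℕ.<⇒≤ (proj₁ (rest-in (inj₂ v∈B))) , ℕ.<⇒≤ (proj₂ (rest-in (inj₂ v∈B)))
        ... | inj₂ v∈Aa with Mem.∈-++⁻ A v∈Aa
        ... | inj₁ v∈A = ℕ.<⇒≤ (proj₁ (rest-in (inj₁ v∈A))) , ℕ.<⇒≤ (proj₂ (rest-in (inj₁ v∈A)))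
        ... | inj₂ (here refl) = lo≤a≤hi
        from : ∀ {v} → lo ≤ v × v ≤ hi → v ∈ w
        from (lo≤v , v≤hi) with ∈u (ℕ.≤-trans 1≤lo lo≤v) (ℕ.≤-trans v≤hi hi≤)
        ... | inj₁ v∈A                       = there (Mem.∈-++⁺ʳ B (Mem.∈-++⁺ˡ v∈A))
        ... | inj₂ (inj₁ refl)               = there (Mem.∈-++⁺ʳ B (Mem.∈-++⁺ʳ A (here refl)))
        ... | inj₂ (inj₂ (inj₁ v∈M))         = contradiction (M-out v∈M) (not-outside lo≤v v≤hi)
        ... | inj₂ (inj₂ (inj₂ (inj₁ refl))) = here refl
        ... | inj₂ (inj₂ (inj₂ (inj₂ v∈B)))  = there (Mem.∈-++⁺ˡ v∈B)

        range : ValuesRange w lo hi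
        range v = mk⇔ to from
        ∷ʳ≢[] : ∀ xs → xs ∷ʳ a ≢ []
        ∷ʳ≢[] []      ()
        ∷ʳ≢[] (_ ∷ _) ()
        last-w : last w ≡ just a
        last-w = trans (last-++ (b ∷ B) (∷ʳ≢[] A)) (last-++ A λ ())
        bordered : Bordered w lo hi
        bordered = [ (λ { (refl , refl) → inj₂ (refl , last-w) }) , (λ { (refl , refl) → inj₁ (refl , last-w) }) ]′ ends

        move : Move u u₁
        move = subst₂ Move u≡ (wrapFlip≡ lo hi (A ∷ʳ a) M (b ∷ B))
          (wrapFlip (A ∷ʳ a) M (b ∷ B) lo hi (∷ʳ≢[] A) M≢[] (λ ()) range bordered)
        step : Step m es u es₁ u₁
        step = subst (λ v → Step m es v es₁ u₁) u≡
          (wrapFlip-step {m} {A ∷ʳ a} {M} {b ∷ B} {lo} {hi} E₁ {l} {mid} {q} {E₃}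
            (trans (cong suc (sym lenA)) (trans (ℕ.+-comm 1 (length A)) (sym (List.length-++ A))))
            (sym lenM) (cong suc (sym lenB)) range bordered (subst (Valid m es) (sym u≡) valid))

      -- Each open arc lies entirely in `M` or entirely in the rest, so one value of each kind
      -- decides which arc is which; two such values cannot share an arc.
      by-arc : ∀ {v o} → v ∈ M → Rest o → Turned
      by-arc {v} {o} v∈M o∈ with classify-M v∈M | classify (proj₁ (rest-off o∈)) (proj₂ (rest-off o∈))
      ... | inj₁ (lo<v , v<hi) | inj₁ (lo<o , o<hi) =
        contradiction (inner lo<v v<hi lo<o o<hi v∈M) (rest-∉M o∈)
      ... | inj₂ v-out | inj₂ o-out =
        contradiction (outer-u (M⊆u v∈M) (rest-u o∈) v-out o-out v∈M) (rest-∉M o∈)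
      ... | inj₁ (lo<v , v<hi) | inj₂ o-out = ordinary M-in rest-out
        where
        M-in : ∀ {x} → x ∈ M → Inner x
        M-in x∈M with classify-M x∈M
        ... | inj₁ x-in  = x-in
        ... | inj₂ x-out = contradiction (outer-u (M⊆u x∈M) (rest-u o∈) x-out o-out x∈M) (rest-∉M o∈)
        rest-out : ∀ {x} → Rest x → Outside lo hi x
        rest-out x∈ with classify (proj₁ (rest-off x∈)) (proj₂ (rest-off x∈))
        ... | inj₁ (lo<x , x<hi) = contradiction (inner lo<v v<hi lo<x x<hi v∈M) (rest-∉M x∈)
        ... | inj₂ x-out         = x-out
      ... | inj₂ v-out | inj₁ (lo<o , o<hi) = wrapping M-out rest-in λ { refl → case v∈M of λ () }
        where
        M-out : ∀ {x} → x ∈ M → Outside lo hi x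
        M-out x∈M with classify-M x∈M
        ... | inj₁ (lo<x , x<hi) = contradiction (inner lo<x x<hi lo<o o<hi x∈M) (rest-∉M o∈)
        ... | inj₂ x-out         = x-out
        rest-in : ∀ {x} → Rest x → Inner x
        rest-in x∈ with classify (proj₁ (rest-off x∈)) (proj₂ (rest-off x∈))
        ... | inj₁ x-in  = x-in
        ... | inj₂ x-out = contradiction (outer-u (M⊆u v∈M) (rest-u x∈) v-out x-out v∈M) (rest-∉M x∈)

    by-rest : ∀ {v o} → v ∈ M → Rest o → Turned
    by-rest v∈M o∈ with ℕ.<-cmp a b
    ... | tri< a<b _ _ = Flip.by-arc a<b (inj₁ (refl , refl)) v∈M o∈
    ... | tri≈ _ a≡b _ = contradiction a≡b a≢b
    ... | tri> _ _ b<a = Flip.by-arc b<a (inj₂ (refl , refl)) v∈M o∈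

    whole : A ≡ [] → B ≡ [] → Turned
    whole refl refl = RC u , rc u ◅ ε , subst (λ e → Step m es u e (RC u)) es′≡ (rc-step valid)
      where
      empty : ∀ (xs : List ℕ) → 0 ≡ length xs → xs ≡ []
      empty [] refl = refl
      es′≡ : reverse es ≡ es′
      es′≡ = trans (reverse-turn E₁ E₃) (cong₂ (λ x y → x ++ q ∷ reverse mid ++ l ∷ y)
        (trans (cong reverse (empty E₃ lenB)) (sym (empty E₁ lenA))) (trans (cong reverse (empty E₁ lenA)) (sym (empty E₃ lenB))))

  turn : Turned
  turn = go M A B refl refl refl
    where
    go : ∀ M′ A′ B′ → M ≡ M′ → A ≡ A′ → B ≡ B′ → Turned
    go []      _       _       refl _    _    = case lenM of λ ()
    go (v ∷ _) []      []      refl A≡[] B≡[] = whole A≡[] B≡[]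
    go (v ∷ _) (o ∷ _) _       refl refl _    = by-rest (here refl) (inj₁ (here refl))
    go (v ∷ _) []      (o ∷ _) refl _    refl = by-rest (here refl) (inj₂ (here refl))

-- Descent to the sorted arrangement

-- Taking the last label below `l` makes all later labels exceed `l`, as the interval argument at
-- the right end of the segment requires.
last-below : ∀ l r → All (l ≢_) r →
             All (l <_) r ⊎ ∃ λ mid → ∃₂ λ q E → r ≡ mid ++ q ∷ E × q < l × All (l <_) E
last-below l []      []           = inj₁ []
last-below l (x ∷ r) (l≢x ∷ l≢r) with last-below l r l≢r
... | inj₂ (mid , q , E , refl , q<l , l<E) = inj₂ (x ∷ mid , q , E , refl , q<l , l<E)
... | inj₁ l<r with ℕ.<-cmp x l
... | tri< x<l _ _ = inj₂ ([] , x , r , refl , x<l , l<r)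
... | tri≈ _ x≡l _ = contradiction (sym x≡l) l≢x
... | tri> _ _ l<x = inj₁ (l<x ∷ l<r)

turn-at : ∀ {m t} E₁ {l} mid {q} E₃ {u} → Valid m (E₁ ++ l ∷ mid ++ q ∷ E₃) u → Valid m (upTo m) t →
  Same (E₁ ++ l ∷ mid ++ q ∷ E₃) u (upTo m) t → All (_< q) E₁ → q < l → All (l <_) E₃ →
  ∃ λ u′ → Star Move u u′ × Step m (E₁ ++ l ∷ mid ++ q ∷ E₃) u (E₁ ++ q ∷ reverse mid ++ l ∷ E₃) u′
turn-at E₁ {l} mid {q} E₃ {u} valid valid-t same E₁<q q<l l<E₃
  with split-length (length E₁) {suc (suc (length mid) + suc (length E₃))} u (begin
      length u                                                   ≡⟨ sym (labels-length valid) ⟩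
      suc (length (E₁ ++ l ∷ mid ++ q ∷ E₃))                     ≡⟨ cong suc (List.length-++ E₁) ⟩
      suc (length E₁ + suc (length (mid ++ q ∷ E₃)))             ≡⟨ cong (λ n → suc (length E₁ + suc n)) (List.length-++ mid) ⟩
      suc (length E₁ + suc (length mid + suc (length E₃)))       ≡⟨ sym (ℕ.+-suc (length E₁) _) ⟩
      length E₁ + suc (suc (length mid) + suc (length E₃))       ∎)
  where open ≡-Reasoning
... | A , a ∷ u′ , refl , lenA , len with split-length (suc (length mid)) u′ (ℕ.suc-injective len)
... | M , b ∷ B , refl , lenM , lenB =
  Turn.turn {A = A} {M = M} lenA lenM (ℕ.suc-injective lenB) valid valid-t same E₁<q q<l l<E₃

-- Lexicographic descent: a turn puts a smaller label in place of l, the first label out of order.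
sort : ∀ N {m k rest u t} → length rest ≡ N → Valid m (upTo k ++ rest) u → Valid m (upTo m) t →
       Same (upTo k ++ rest) u (upTo m) t → Star Move u t
sort zero {m} {k} {[]} {u} {t} len valid valid-t same =
  subst (Star Move u) (same-steps⇒same-word (subst (λ es → Valid m es u) sorted valid) valid-t
    (subst (λ es → Same es u (upTo m) t) sorted same)) ε
  where
  sorted : upTo k ++ [] ≡ upTo m
  sorted = trans (List.++-identityʳ (upTo k)) (cong upTo (trans (sym (List.length-upTo k))
    (trans (cong length (sym (List.++-identityʳ (upTo k)))) (length-labels valid))))
sort (suc N) {m} {k} {l ∷ r} {u} {t} len valid valid-t same = descend (<-wellFounded l) len valid same
  where
  descend : ∀ {l r u} → Acc _<_ l → length (l ∷ r) ≡ suc N → Valid m (upTo k ++ l ∷ r) u →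
            Same (upTo k ++ l ∷ r) u (upTo m) t → Star Move u t
  descend {l} {r} {u} (acc smaller) len valid same with l ≟ k
  ... | yes refl = sort N {k = suc k} {rest = r} (ℕ.suc-injective len) (subst (λ es → Valid m es u) extend valid) valid-t
                     (subst (λ es → Same es u (upTo m) t) extend same)
    where
    extend : upTo k ++ k ∷ r ≡ upTo (suc k) ++ r
    extend = trans (sym (List.++-assoc (upTo k) [ k ] r)) (cong (_++ r) (List.upTo-∷ʳ k))
  ... | no l≢k with unique-++⁻ (upTo k) (unique-labels valid)
  ... | _ , l≢r ∷ _ , disjoint = by-last (last-below l r l≢r)
    where
    es = upTo k ++ l ∷ r
    ≥k : ∀ {x} → x ∈ l ∷ r → k ≤ x
    ≥k x∈ = ℕ.≮⇒≥ λ x<k → disjoint (Mem.∈-upTo⁺ x<k) x∈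
    k<l : k < l
    k<l = ℕ.≤∧≢⇒< (≥k (here refl)) (l≢k ∘ sym)
    l<m : l < m
    l<m = Mem.∈-upTo⁻ (↭.∈-resp-↭ (proj₁ valid) (Mem.∈-++⁺ʳ (upTo k) (here refl)))
    k∈r : k ∈ r
    k∈r with Mem.∈-++⁻ (upTo k) (↭.∈-resp-↭ (↭-sym (proj₁ valid)) (Mem.∈-upTo⁺ (ℕ.<-trans k<l l<m)))
    ... | inj₁ k∈upTo       = contradiction (Mem.∈-upTo⁻ k∈upTo) (ℕ.<-irrefl refl)
    ... | inj₂ (here k≡l)   = contradiction (sym k≡l) l≢k
    ... | inj₂ (there k∈r)  = k∈r

    by-last : (All (l <_) r ⊎ ∃ λ mid → ∃₂ λ q E → r ≡ mid ++ q ∷ E × q < l × All (l <_) E) → Star Move u t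
    -- The label `k` is missing from the sorted prefix and differs from `l`, so it occurs in `r`,
    -- and it is below `l`.
    by-last (inj₁ l<r) = contradiction (All.lookup l<r k∈r) (ℕ.<-asym k<l)
    by-last (inj₂ (mid , q , E , refl , q<l , l<E))
      with turn-at (upTo k) mid E valid valid-t same
             (All.tabulate λ x∈ → ℕ.<-≤-trans (Mem.∈-upTo⁻ x∈) (≥k (there (Mem.∈-++⁺ʳ mid (here refl))))) q<l l<E
    ... | u′ , moves , valid′ , same′ = moves ◅◅ descend (smaller q<l) len′ valid′ (λ x → same x ⇔-∘ ⇔-sym (same′ x))
      where
      len′ : length (q ∷ reverse mid ++ l ∷ E) ≡ suc N
      len′ = trans (cong suc (trans (List.length-++ (reverse mid))
        (trans (cong (λ n → n + suc (length E)) (List.length-reverse mid)) (sym (List.length-++ mid))))) len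

sim⇒moves : ∀ {m} (π τ : Permutation′ (suc m)) → Sim π τ → Star Move (word π) (word τ)
sim⇒moves {m} π τ sim with sim⇒same π τ sim
... | es , es↭ , same = sort (length es) {k = 0} refl (valid-word es π es↭) (valid-word (upTo m) τ ↭-refl) same

theorem2p1 : (m : ℕ) → 1 ≤ m → (π τ : Permutation′ (suc m)) →
    Sim π τ ⇔ Star Move (word π) (word τ)
theorem2p1 m _ π τ = mk⇔ (sim⇒moves π τ) (moves⇒sim π τ)
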